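{- Let $\alpha$ be a fixed partition. Then, as formal power series in $t$, $$\frac{\sum_{n\geq0}F_{2n}^{\alpha}\,\frac{t^n}{n!}}{\sum_{n\geq0}F_{ -2n}^{\alpha}\,\frac{(x^2y^2zt)^n}{n!}}=\exp\big((x+y)t\big).$$
   Context: Partitions are identified with Young diagrams (cell $(i,j)$ in row $i$, column $j$); for $\mu\subseteq\lambda$, $\lambda/\mu$ is the set of cells of $\lambda$ not in $\mu$, $\lambda/\mu\vdash n$ means it has $n$ cells. $v(\lambda/\mu),h(\lambda/\mu),d(\lambda/\mu)$ are the numbers of cells of $\lambda/\mu$ in even rows, in even columns, and in both even rows and even columns. A standard Young tableau (SYT) of shape $\lambda/\mu\vdash n$ is a bijection $T$ from its cells to $[n]$ with $T(i,j)\le T(i',j')$ whenever $i\le i',j\le j'$. Write $(i,j)\lhd(i',j')$ if $i<i'$ or ($i=i'$, $j<j'$). For an SYT $T$ of straight shape, ${\rm sign}(T)=(-1)^{\#\{(a,b):a\lhd b,\,T(a)>T(b)\}}$. For $T_1$ of shape $\nu/\mu\vdash k$ and $T_2$ of shape $\lambda/\nu$, $T_1\diamond T_2$ is the SYT of shape $\lambda/\mu$ equal to $T_1$ on $\nu/\mu$ and $T_2+k$ on $\lambda/\nu$. For $T$ of shape $\lambda/\mu$, ${\rm sign}(T)={\rm sign}(T_0){\rm sign}(T_0\diamond T)$ for any SYT $T_0$ of shape $\mu$ (independent of $T_0$), and $I_{\lambda/\mu}=\sum_T{\rm sign}(T)$ over SYTs of shape $\lambda/\mu$. For $n\ge0$: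 $F_{2n}^\alpha=\sum_{\lambda:\ \lambda/\alpha\vdash 2n}x^{v(\lambda/\alpha)}y^{h(\lambda/\alpha)}z^{d(\lambda/\alpha)}I_{\lambda/\alpha}$ and $F_{ -2n}^\alpha=\sum_{\mu:\ \alpha/\mu\vdash 2n}(-x)^{ -v(\alpha/\mu)}y^{ -h(\alpha/\mu)}z^{ -d(\alpha/\mu)}I_{\alpha/\mu}$. -}

module Defs where

open import Data.Bool using (Bool; true; false; _∧_; _∨_; not; if_then_else_)
open import Data.Nat as ℕ using (ℕ; zero; suc; _∸_; _≤ᵇ_; _<ᵇ_; _≡ᵇ_; _!)
open import Data.Nat.Properties using (_!≢0)
open import Data.Bool.ListAction using (all)
open import Data.Integer as ℤ using (ℤ; +_)
open import Data.Rational as ℚ using (ℚ; 0ℚ; 1ℚ)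
open import Data.List using (List; []; _∷_; _++_; map; concatMap; filter; length; upTo; foldr; zip)
open import Data.Product using (_×_; _,_; proj₁; proj₂)
open import Relation.Nullary.Decidable using (⌊_⌋)
open import Relation.Binary.PropositionalEquality using (_≡_)

-- i-th part, rows indexed from 1; parts beyond the list are 0.
part : List ℕ → ℕ → ℕ
part []       _             = 0
part (p ∷ ps) zero          = 0
part (p ∷ ps) (suc zero)    = p
part (p ∷ ps) (suc (suc i)) = part ps (suc i)

size : List ℕ → ℕ
size = foldr ℕ._+_ 0

decreasingᵇ : List ℕ → Bool
decreasingᵇ []           = true
decreasingᵇ (p ∷ [])     = true
decreasingᵇ (p ∷ q ∷ ps) = (q ≤ᵇ p) ∧ decreasingᵇ (q ∷ ps)

data IsPartition : List ℕ → Set where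
  nil  : IsPartition []
  one  : ∀ p → 1 ℕ.≤ p → IsPartition (p ∷ [])
  cons : ∀ p q ps → q ℕ.≤ p → IsPartition (q ∷ ps) → IsPartition (p ∷ q ∷ ps)

rows : ℕ → List ℕ
rows m = map suc (upTo m)

⊆ᵇ : List ℕ → List ℕ → Bool
⊆ᵇ μ λ' = all (λ i → part μ i ≤ᵇ part λ' i) (rows (length μ ℕ.+ length λ'))

Cell : Set
Cell = ℕ × ℕ   -- (row i, column j), both starting at 1

cells : List ℕ → List ℕ → List Cell
cells μ λ' = concatMap
  (λ i → map (λ k → (i , suc (part μ i ℕ.+ k))) (upTo (part λ' i ∸ part μ i)))
  (rows (length λ'))

count : {A : Set} → (A → Bool) → List A → ℕ
count p []       = 0
count p (x ∷ xs) = (if p x then 1 else 0) ℕ.+ count p xs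

evenᵇ : ℕ → Bool
evenᵇ zero          = true
evenᵇ (suc zero)    = false
evenᵇ (suc (suc n)) = evenᵇ n

vS hS dS : List ℕ → List ℕ → ℕ
vS μ λ' = count (λ c → evenᵇ (proj₁ c)) (cells μ λ')
hS μ λ' = count (λ c → evenᵇ (proj₂ c)) (cells μ λ')
dS μ λ' = count (λ c → evenᵇ (proj₁ c) ∧ evenᵇ (proj₂ c)) (cells μ λ')

_⊲ᵇ_ : Cell → Cell → Bool
(i , j) ⊲ᵇ (i' , j') = (i <ᵇ i') ∨ ((i ≡ᵇ i') ∧ (j <ᵇ j'))

_≼ᵇ_ : Cell → Cell → Bool
(i , j) ≼ᵇ (i' , j') = (i ≤ᵇ i') ∧ (j ≤ᵇ j')

-- Tableaux.  A bijection T from the cells of λ/μ (⊢ n) to [n] is encoded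
-- by the list w of cells with w[k] = T⁻¹(k+1), i.e. an ordering of the
-- cells.  All bijections = all permutations of the cell list.

insertAll : {A : Set} → A → List A → List (List A)
insertAll x []       = (x ∷ []) ∷ []
insertAll x (y ∷ ys) = (x ∷ y ∷ ys) ∷ map (y ∷_) (insertAll x ys)

perms : {A : Set} → List A → List (List A)
perms []       = [] ∷ []
perms (x ∷ xs) = concatMap (insertAll x) (perms xs)

indexed : {A : Set} → List A → List (ℕ × A)
indexed w = zip (upTo (length w)) w

isSYTᵇ : List Cell → Bool
isSYTᵇ w = all (λ pc → all (λ qc → not (proj₂ pc ≼ᵇ proj₂ qc) ∨ (proj₁ pc ≤ᵇ proj₁ qc))
                             (indexed w)) (indexed w)

inversions : List Cell → ℕ
inversions []       = 0
inversions (c ∷ cs) = count (λ c' → c' ⊲ᵇ c) cs ℕ.+ inversions cs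

signℕ : ℕ → ℤ
signℕ zero    = + 1
signℕ (suc n) = ℤ.- signℕ n

signStraight : List Cell → ℤ
signStraight w = signℕ (inversions w)

rowFill : List ℕ → List Cell
rowFill μ = cells [] μ

-- sign(T) = sign(T0) · sign(T0 ⋄ T) ; T0 ⋄ T is the concatenated ordering
signSkew : List ℕ → List Cell → ℤ
signSkew μ w = signStraight (rowFill μ) ℤ.* signStraight (rowFill μ ++ w)

filterᵇ : {A : Set} → (A → Bool) → List A → List A
filterᵇ p []       = []
filterᵇ p (x ∷ xs) = if p x then x ∷ filterᵇ p xs else filterᵇ p xs

sumℤ : List ℤ → ℤ
sumℤ = foldr ℤ._+_ (+ 0)

I : List ℕ → List ℕ → ℤ
I μ λ' = sumℤ (map (signSkew μ) (filterᵇ isSYTᵇ (perms (cells μ λ'))))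

-- Enumerating shapes.  A partition with at most L parts is represented
-- uniquely as a weakly decreasing list of length L (padded with zeros).

boxLists : ℕ → ℕ → List (List ℕ)
boxLists zero    B = [] ∷ []
boxLists (suc L) B = concatMap (λ p → map (p ∷_) (boxLists L B)) (upTo (suc B))

-- all partitions λ with α ⊆ λ and |λ/α| = m
-- (such λ have at most length α + m parts, each ≤ size α + m)
outerShapes : List ℕ → ℕ → List (List ℕ)
outerShapes α m = filterᵇ
  (λ λ' → decreasingᵇ λ' ∧ ⊆ᵇ α λ' ∧ (size λ' ≡ᵇ (size α ℕ.+ m)))
  (boxLists (length α ℕ.+ m) (size α ℕ.+ m))

innerShapes : List ℕ → ℕ → List (List ℕ)
innerShapes α m = filterᵇ
  (λ μ → decreasingᵇ μ ∧ ⊆ᵇ μ α ∧ ((size μ ℕ.+ m) ≡ᵇ size α))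
  (boxLists (length α) (size α))

-- Laurent polynomials in x, y, z over ℚ, as finite lists of terms
-- q · x^a y^b z^c ; compared coefficientwise.

Term : Set
Term = ℚ × ℤ × ℤ × ℤ

LPoly : Set
LPoly = List Term

mono : ℚ → ℤ → ℤ → ℤ → LPoly
mono q a b c = (q , a , b , c) ∷ []

0P 1P : LPoly
0P = []
1P = mono 1ℚ (+ 0) (+ 0) (+ 0)

_+P_ : LPoly → LPoly → LPoly
_+P_ = _++_

_*P_ : LPoly → LPoly → LPoly
P *P Q = concatMap (λ s → map (λ t → mul s t) Q) P
  where
  mul : Term → Term → Term
  mul (q , a , b , c) (q' , a' , b' , c') = (q ℚ.* q' , a ℤ.+ a' , b ℤ.+ b' , c ℤ.+ c')

scaleP : ℚ → LPoly → LPoly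
scaleP r P = mono r (+ 0) (+ 0) (+ 0) *P P

_^P_ : LPoly → ℕ → LPoly
P ^P zero  = 1P
P ^P suc n = P *P (P ^P n)

sumP : List LPoly → LPoly
sumP = foldr _+P_ 0P

coeff : LPoly → ℤ → ℤ → ℤ → ℚ
coeff P a b c = foldr ℚ._+_ 0ℚ (map proj₁ (filterᵇ
  (λ t → ⌊ proj₁ (proj₂ t) ℤ.≟ a ⌋ ∧ ⌊ proj₁ (proj₂ (proj₂ t)) ℤ.≟ b ⌋
          ∧ ⌊ proj₂ (proj₂ (proj₂ t)) ℤ.≟ c ⌋) P))

_≈P_ : LPoly → LPoly → Set
P ≈P Q = ∀ a b c → coeff P a b c ≡ coeff Q a b c

ℤtoℚ : ℤ → ℚ
ℤtoℚ i = i ℚ./ 1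

xP yP zP : LPoly
xP = mono 1ℚ (+ 1) (+ 0) (+ 0)
yP = mono 1ℚ (+ 0) (+ 1) (+ 0)
zP = mono 1ℚ (+ 0) (+ 0) (+ 1)

-- (-x)^{-v} y^{-h} z^{-d} :  (-x)^{-v} = (-1)^v x^{-v}
negMono : ℕ → ℕ → ℕ → LPoly
negMono v h d = mono (ℤtoℚ (signℕ v)) (ℤ.- (+ v)) (ℤ.- (+ h)) (ℤ.- (+ d))

Fpos : List ℕ → ℕ → LPoly
Fpos α n = sumP (map
  (λ λ' → scaleP (ℤtoℚ (I α λ')) ((xP ^P vS α λ') *P ((yP ^P hS α λ') *P (zP ^P dS α λ'))))
  (outerShapes α (2 ℕ.* n)))

Fneg : List ℕ → ℕ → LPoly
Fneg α n = sumP (map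
  (λ μ → scaleP (ℤtoℚ (I μ α)) (negMono (vS μ α) (hS μ α) (dS μ α)))
  (innerShapes α (2 ℕ.* n)))

PS : Set
PS = ℕ → LPoly

_≈S_ : PS → PS → Set
A ≈S B = ∀ n → A n ≈P B n

_*S_ : PS → PS → PS
(A *S B) n = sumP (map (λ k → A k *P B (n ∸ k)) (upTo (suc n)))

invFact : ℕ → ℚ
invFact n = (+ 1 ℚ./ (n !)) {{n !≢0}}

numSeries : List ℕ → PS
numSeries α n = scaleP (invFact n) (Fpos α n)

denSeries : List ℕ → PS
denSeries α n = scaleP (invFact n)
  (Fneg α n *P (((xP ^P 2) *P ((yP ^P 2) *P zP)) ^P n))

expSeries : PS
expSeries n = scaleP (invFact n) ((xP +P yP) ^P n)

{-# OPTIONS --safe #-}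

-- Let U and D add resp. remove one cell of a partition, weighted by the monomial of the cell (resp. by
-- its inverse, with a sign in even rows) and by the sign (-1)^(number of cells in lower rows).  They
-- satisfy the Clifford relation U D + D U = 1, so U² commutes with D.  On the constant function 𝟙
-- only dominoes survive in U² and D², and matching addable with removable dominoes yields
-- U² 𝟙 = κ D² 𝟙 + (x + y) with κ = x²y²z.  Hence
-- U²ⁿ 𝟙 = ∑ₖ (n choose k) (x + y)^(n-k) κᵏ D²ᵏ 𝟙.  Splitting off the largest entry of a tableau shows
-- F₋₂ₙ(α) = (D²ⁿ 𝟙)(α), and, U being adjoint to the removal of cells, F₂ₙ(α) = (U²ⁿ 𝟙)(α).
module Submission where

open import Defs
open import Algebra.Bundles using (CommutativeRing; RawRing)
import Algebra.Properties.AbelianGroup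
import Algebra.Properties.Ring
import Algebra.Properties.Semiring.Exp
import Algebra.Properties.Semiring.Mult
import Algebra.Solver.Ring
import Algebra.Solver.Ring.AlmostCommutativeRing as ACR
open import Data.Bool using (Bool; true; false; _∧_; _∨_; not; if_then_else_; T)
open import Data.Bool.ListAction using (all)
import Data.Bool.Properties as 𝔹ₚ
open import Data.Empty using (⊥-elim)
open import Data.Integer as ℤ using (ℤ; +_)
import Data.Integer.Properties as ℤₚ
open import Data.List using (List; []; _∷_; _++_; map; concat; concatMap; foldr; upTo; applyUpTo; replicate; length; zip)
import Data.List.Properties as Listₚ
open import Data.List.Relation.Binary.Permutation.Propositional as Perm using (_↭_; prep; swap)
import Data.List.Relation.Binary.Permutation.Propositional.Properties as Permₚ
open import Data.List.Relation.Unary.All as All using (All; []; _∷_)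
import Data.List.Relation.Unary.All.Properties as Allₚ
open import Data.Maybe using (Maybe; just; nothing)
open import Data.Nat as ℕ using (ℕ; zero; suc; pred; _∸_; _<ᵇ_; _≤ᵇ_; _≡ᵇ_; z≤n; s≤s; NonZero; _!)
import Data.Nat.Properties as ℕₚ
open import Data.Nat.Solver using (module +-*-Solver)
open import Data.Product using (_×_; _,_; proj₁; proj₂)
open import Data.Rational as ℚ using (ℚ; 0ℚ; 1ℚ)
import Data.Rational.Properties as ℚₚ
open import Data.Rational.Unnormalised as ℚᵘ using (mkℚᵘ; *≡*)
import Data.Rational.Unnormalised.Properties as ℚᵘₚ
open import Data.Sum using (_⊎_; inj₁; inj₂)
open import Data.Unit using (⊤; tt)
open import Function.Base using (_∘_; id)
open import Level using (Level; 0ℓ)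
import Relation.Binary.PropositionalEquality as ≡
open ≡ using (_≡_)
import Relation.Binary.Reasoning.Setoid
open import Relation.Nullary using (yes; ¬_)
open import Relation.Nullary.Decidable using (⌊_⌋)

-- The constant `κ` is the product of the weights of any two-by-two square. Such a square splits
-- into two parallel dominoes, so `κ` times the inverse weight of one is, up to sign, the weight of
-- the other. The matching moves a horizontal domino one row down and a vertical one one column to
-- the right, which has the same effect on weights. Two addable dominoes have no partner: the
-- horizontal one in row 1, of weight `y`, and the vertical one in column 1, of weight `x`. The
-- minus sign in the powers of `-x` works twice. It lets the diagonal terms of the Clifford relation
-- alternate from row to row and telescope, and it offsets the sign that arises because a vertical
-- domino is removed lower cell first. Two obstacles shape the encoding. Removing a cell may leave a
-- row of length 0 in the list, so a partition has many representatives and functions must not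
-- distinguish them. And adjointness is a statement about finite sums over shapes in a box, inside
-- which no row can be created; enough spare zeros make the box invisible.

module N = +-*-Solver

-- Commutative rings: a solver with integer coefficients, signs and guards

module RingFacts {c ℓ : Level} (R : CommutativeRing c ℓ) where
  open CommutativeRing R public
  open Algebra.Properties.Ring ring public using (-‿distribˡ-*; -‿distribʳ-*; -0#≈0#; -‿involutive)
  open Algebra.Properties.AbelianGroup +-abelianGroup using (⁻¹-∙-comm)
  open Algebra.Properties.Semiring.Mult semiring using (×-homo-+; ×1-homo-*) renaming (_×_ to _×ᴿ_)
  open Relation.Binary.Reasoning.Setoid setoid public

  private
    almostRing : ACR.AlmostCommutativeRing c ℓ
    almostRing = ACR.fromCommutativeRing R

    -- With the ring's own elements as coefficients nothing reveals that a coefficient vanishes, so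
    -- this solver cannot cancel. It serves to set up the solver over `Coeff`, which can.
    module B = Algebra.Solver.Ring _ almostRing (ACR.-raw-almostCommutative⟶ almostRing)
                         (λ _ _ → nothing)

    -- Integer coefficients as reduced formal differences of naturals.
    reduce : ℕ → ℕ → ℕ × ℕ
    reduce zero    b       = 0 , b
    reduce (suc a) zero    = suc a , 0
    reduce (suc a) (suc b) = reduce a b

    Coeff : RawRing _ _
    Coeff = record
      { Carrier = ℕ × ℕ
      ; _≈_ = _≡_
      ; _+_ = λ (a , b) (a' , b') → reduce (a ℕ.+ a') (b ℕ.+ b')
      ; _*_ = λ (a , b) (a' , b') → reduce (a ℕ.* a' ℕ.+ b ℕ.* b') (a ℕ.* b' ℕ.+ b ℕ.* a')
      ; -_  = λ (a , b) → b , a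
      ; 0#  = 0 , 0
      ; 1#  = 1 , 0
      }

    ⟦_⟧ᶜ : ℕ × ℕ → Carrier
    ⟦ a , b ⟧ᶜ = a ×ᴿ 1# - b ×ᴿ 1#

    ⟦reduce⟧ : ∀ a b → ⟦ reduce a b ⟧ᶜ ≈ ⟦ a , b ⟧ᶜ
    ⟦reduce⟧ zero    b       = refl
    ⟦reduce⟧ (suc a) zero    = refl
    ⟦reduce⟧ (suc a) (suc b) = begin
      ⟦ reduce a b ⟧ᶜ                           ≈⟨ ⟦reduce⟧ a b ⟩
      x - y                                     ≈⟨ +-identityˡ _ ⟨
      0# + (x - y)                              ≈⟨ +-congʳ (-‿inverseʳ 1#) ⟨
      (1# - 1#) + (x - y)                       ≈⟨ B.solve 4 (λ o m x n →
                                                     (o B.:+ m) B.:+ (x B.:+ n)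
                                                     B.:= (o B.:+ x) B.:+ (m B.:+ n))
                                                     refl 1# (- 1#) x (- y) ⟩
      (1# + x) + (- 1# - y)                     ≈⟨ +-congˡ (⁻¹-∙-comm 1# y) ⟩
      (1# + x) - (1# + y)                       ∎
      where
      x = a ×ᴿ 1#
      y = b ×ᴿ 1#

    -- ⟦_⟧ sends the literals 0 and 1 to 0# and 1# on the nose, so that they can be used in goals.
    ⟦_⟧ : ℕ × ℕ → Carrier
    ⟦ 0 , 0 ⟧ = 0#
    ⟦ 1 , 0 ⟧ = 1#
    ⟦ a , b ⟧ = ⟦ a , b ⟧ᶜ

    ⟦⟧≈ : ∀ p → ⟦ p ⟧ ≈ ⟦ p ⟧ᶜ
    ⟦⟧≈ (0 , 0)               = sym (-‿inverseʳ 0#)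
    ⟦⟧≈ (0 , suc b)           = refl
    ⟦⟧≈ (1 , 0)               = sym (trans (+-congˡ -0#≈0#) (trans (+-identityʳ _) (+-identityʳ _)))
    ⟦⟧≈ (1 , suc b)           = refl
    ⟦⟧≈ (suc (suc a) , 0)     = refl
    ⟦⟧≈ (suc (suc a) , suc b) = refl

    +-homoᶜ : ∀ p q → ⟦ RawRing._+_ Coeff p q ⟧ᶜ ≈ ⟦ p ⟧ᶜ + ⟦ q ⟧ᶜ
    +-homoᶜ (a , b) (a' , b') = trans (⟦reduce⟧ (a ℕ.+ a') (b ℕ.+ b'))
      (trans (+-cong (×-homo-+ 1# a a') (-‿cong (×-homo-+ 1# b b')))
      (trans (+-congˡ (sym (⁻¹-∙-comm _ _)))
      (B.solve 4 (λ x x' m m' → (x B.:+ x') B.:+ (m B.:+ m') B.:= (x B.:+ m) B.:+ (x' B.:+ m'))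
        refl (a ×ᴿ 1#) (a' ×ᴿ 1#) (- (b ×ᴿ 1#)) (- (b' ×ᴿ 1#)))))

    *-homoᶜ : ∀ p q → ⟦ RawRing._*_ Coeff p q ⟧ᶜ ≈ ⟦ p ⟧ᶜ * ⟦ q ⟧ᶜ
    *-homoᶜ (a , b) (a' , b') = trans (⟦reduce⟧ (a ℕ.* a' ℕ.+ b ℕ.* b') (a ℕ.* b' ℕ.+ b ℕ.* a'))
      (trans (+-cong (trans (×-homo-+ 1# (a ℕ.* a') (b ℕ.* b')) (+-cong (×1-homo-* a a') (×1-homo-* b b')))
                     (-‿cong (trans (×-homo-+ 1# (a ℕ.* b') (b ℕ.* a')) (+-cong (×1-homo-* a b') (×1-homo-* b a')))))
      (trans (+-cong (+-congˡ (trans (sym (-‿involutive _)) (trans (-‿cong (-‿distribˡ-* _ _)) (-‿distribʳ-* _ _))))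
                     (trans (sym (⁻¹-∙-comm _ _)) (+-cong (-‿distribʳ-* _ _) (-‿distribˡ-* _ _))))
      (B.solve 4 (λ x m x' m' → (x B.:* x' B.:+ m B.:* m') B.:+ (x B.:* m' B.:+ m B.:* x')
                         B.:= (x B.:+ m) B.:* (x' B.:+ m'))
        refl (a ×ᴿ 1#) (- (b ×ᴿ 1#)) (a' ×ᴿ 1#) (- (b' ×ᴿ 1#)))))

    homᶜ : Coeff ACR.-Raw-AlmostCommutative⟶ almostRing
    homᶜ = record
      { ⟦_⟧    = ⟦_⟧
      ; +-homo = λ p q → trans (⟦⟧≈ (RawRing._+_ Coeff p q)) (trans (+-homoᶜ p q) (sym (+-cong (⟦⟧≈ p) (⟦⟧≈ q))))
      ; *-homo = λ p q → trans (⟦⟧≈ (RawRing._*_ Coeff p q)) (trans (*-homoᶜ p q) (sym (*-cong (⟦⟧≈ p) (⟦⟧≈ q))))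
      ; -‿homo = λ p → trans (⟦⟧≈ (RawRing.-_ Coeff p)) (trans (+-comm _ _)
          (trans (trans (+-congˡ (sym (-‿involutive _))) (⁻¹-∙-comm _ _)) (-‿cong (sym (⟦⟧≈ p)))))
      ; 0-homo = refl
      ; 1-homo = refl
      }

    -- Sums and products in `Coeff` are reduced, so an integer has one form and comparing components
    -- detects every cancellation.
    _≟ᶜ_ : ∀ x y → Maybe (⟦ x ⟧ ≈ ⟦ y ⟧)
    (a , b) ≟ᶜ (a' , b') with a ℕ.≟ a' | b ℕ.≟ b'
    ... | yes ≡.refl | yes ≡.refl = just refl
    ... | _ | _ = nothing

  open Algebra.Solver.Ring Coeff almostRing homᶜ _≟ᶜ_ public
    using (solve; _:=_; _:+_; _:*_; _:-_; :-_; con; Polynomial)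

  :0 :1 : ∀ {n} → Polynomial n
  :0 = con (0 , 0)
  :1 = con (1 , 0)

  sgn : ℕ → Carrier
  sgn zero    = 1#
  sgn (suc n) = - sgn n

  sgn² : ∀ n → sgn n * sgn n ≈ 1#
  sgn² zero    = *-identityˡ 1#
  sgn² (suc n) = trans (solve 1 (λ s → :- s :* :- s := s :* s) refl (sgn n)) (sgn² n)

  sgn-+ : ∀ m n → sgn (m ℕ.+ n) ≈ sgn m * sgn n
  sgn-+ zero    n = sym (*-identityˡ _)
  sgn-+ (suc m) n = trans (-‿cong (sgn-+ m n)) (-‿distribˡ-* _ _)

  when : Bool → Carrier → Carrier
  when b x = if b then x else 0#

  when-cong : ∀ b {x y} → x ≈ y → when b x ≈ when b y
  when-cong true  x≈y = x≈y
  when-cong false _   = refl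

  when-+ : ∀ b x y → when b (x + y) ≈ when b x + when b y
  when-+ true  x y = refl
  when-+ false x y = sym (+-identityˡ 0#)

  when-* : ∀ b k x → when b (k * x) ≈ k * when b x
  when-* true  k x = refl
  when-* false k x = sym (zeroʳ k)

  when-neg : ∀ b x → when b (- x) ≈ - when b x
  when-neg true  x = refl
  when-neg false x = sym -0#≈0#

  when-∧ : ∀ b b' x → when (b ∧ b') x ≈ when b (when b' x)
  when-∧ true  b' x = refl
  when-∧ false b' x = refl

  when-0 : ∀ b → when b 0# ≈ 0#
  when-0 true  = refl
  when-0 false = refl

  interchange : ∀ a b x y → (a + b) + (x + y) ≈ (a + x) + (b + y)
  interchange = solve 4 (λ a b x y → (a :+ b) :+ (x :+ y) := (a :+ x) :+ (b :+ y)) refl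

-- Adding and removing cells

-- The default 0 stands for the empty rows below the listed ones.
hd : List ℕ → ℕ
hd []      = 0
hd (q ∷ _) = q

tl : List ℕ → List ℕ
tl []      = []
tl (_ ∷ l) = l

T→≡ : ∀ {b} → T b → b ≡ true
T→≡ {true} _ = ≡.refl

¬T→≡ : ∀ {b} → ¬ T b → b ≡ false
¬T→≡ {true}  ¬t = ⊥-elim (¬t tt)
¬T→≡ {false} _  = ≡.refl

<ᵇ-true : ∀ {m n} → m ℕ.< n → (m <ᵇ n) ≡ true
<ᵇ-true = T→≡ ∘ ℕₚ.<⇒<ᵇ

<ᵇ-false : ∀ {m n} → n ℕ.≤ m → (m <ᵇ n) ≡ false
<ᵇ-false {m} {n} n≤m = ¬T→≡ (ℕₚ.≤⇒≯ n≤m ∘ ℕₚ.<ᵇ⇒< m n)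

≡ᵇ-refl : ∀ n → (n ≡ᵇ n) ≡ true
≡ᵇ-refl n = T→≡ (ℕₚ.≡⇒≡ᵇ n n ≡.refl)

≡ᵇ-false : ∀ {m n} → ¬ m ≡ n → (m ≡ᵇ n) ≡ false
≡ᵇ-false {m} {n} m≢n = ¬T→≡ (m≢n ∘ ℕₚ.≡ᵇ⇒≡ m n)

≡ᵇ⇒≡ : ∀ {m n} → (m ≡ᵇ n) ≡ true → m ≡ n
≡ᵇ⇒≡ {m} {n} e = ℕₚ.≡ᵇ⇒≡ m n (≡.subst T (≡.sym e) tt)

-- The length of the row above; nothing for the first row.
Cap : Set
Cap = Maybe ℕ

room : Cap → ℕ → Bool
room nothing  q = true
room (just p) q = q <ᵇ p

_≤ᶜ_ : ℕ → Cap → Set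
q ≤ᶜ nothing = ⊤
q ≤ᶜ just p  = q ℕ.≤ p

Dec : Cap → List ℕ → Set
Dec c []      = ⊤
Dec c (q ∷ l) = q ≤ᶜ c × Dec (just q) l

Dec-hd : ∀ {p} l → Dec (just p) l → hd l ℕ.≤ p
Dec-hd []      _ = z≤n
Dec-hd (q ∷ l) (q≤p , _) = q≤p

room-suc : ∀ c {q} → suc q ≤ᶜ c → room c q ≡ true
room-suc nothing  _   = ≡.refl
room-suc (just p) q<p = <ᵇ-true q<p

room⇒≤ᶜ : ∀ c q → room c q ≡ true → suc q ≤ᶜ c
room⇒≤ᶜ nothing  q _ = tt
room⇒≤ᶜ (just p) q e = ℕₚ.<ᵇ⇒< q p (≡.subst T (≡.sym e) tt)

<ᵇ⇒< : ∀ {m n} → (m <ᵇ n) ≡ true → m ℕ.< n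
<ᵇ⇒< {m} {n} e = ℕₚ.<ᵇ⇒< m n (≡.subst T (≡.sym e) tt)

Dec-weaken : ∀ {c c'} l → (∀ {q} → q ≤ᶜ c → q ≤ᶜ c') → Dec c l → Dec c' l
Dec-weaken []      _ _       = tt
Dec-weaken (q ∷ l) w (a , b) = w a , b

Dec-hd-cap : ∀ {c} l {p} → hd l ℕ.≤ p → Dec c l → Dec (just p) l
Dec-hd-cap []      _ _       = tt
Dec-hd-cap (q ∷ l) q≤p (_ , b) = q≤p , b

hd-pad : ∀ l → hd (l ++ 0 ∷ []) ≡ hd l
hd-pad []      = ≡.refl
hd-pad (_ ∷ _) = ≡.refl

size-pad : ∀ l → size (l ++ 0 ∷ []) ≡ size l
size-pad []      = ≡.refl
size-pad (q ∷ l) = ≡.cong (q ℕ.+_) (size-pad l)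

module Operators {c ℓ : Level} (R : CommutativeRing c ℓ) where
  open RingFacts R

  -- Functions of a partition rather than of the list representing it. Creating a row and emptying
  -- it again leads from `[]` to `0 ∷ []`, and `clifford` needs the same value at both.
  PadInv : (List ℕ → Carrier) → Set ℓ
  PadInv f = ∀ l → f (l ++ 0 ∷ []) ≈ f l

  -- Removing resp. adding one cell, weighted by w and by the sign (-1)^(number of cells in lower rows).
  -- With e = false no row is created below the last listed one.
  module Steps (w : Cell → Carrier) where

    d : ℕ → (List ℕ → Carrier) → List ℕ → Carrier
    d i f []      = 0#
    d i f (q ∷ l) = when (hd l <ᵇ q) (w (i , q) * sgn (size l) * f (pred q ∷ l)) + d (suc i) (f ∘ (q ∷_)) l

    -- The empty list stands for endlessly many empty rows, of which only the first can receive a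
    -- cell. On the way down `f` becomes `f ∘ (q ∷_)`, so that it is always evaluated at the whole
    -- shape.
    u : Bool → ℕ → Cap → (List ℕ → Carrier) → List ℕ → Carrier
    u e i c f []      = when (e ∧ room c 0) (w (i , 1) * f (1 ∷ []))
    u e i c f (q ∷ l) = when (room c q) (w (i , suc q) * sgn (size l) * f (suc q ∷ l)) + u e (suc i) (just q)
        (f ∘ (q ∷_)) l

    -- Removing a cell keeps the list decreasing and its length unchanged. The length matters in
    -- `tableaux-iterate`, whose claim concerns only lists at least as long as `μ`.
    d-cong-shape : ∀ i {c f g} l → Dec c l → (∀ l' → Dec c l' → length l' ≡ length l → f l' ≈ g l') → d i f l ≈ d i g l
    d-cong-shape i     []      D f≈g = refl
    d-cong-shape i {c} {f} {g} (q ∷ l) (q≤c , D) f≈g =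
      +-cong head (d-cong-shape (suc i) l D (λ l' D' e → f≈g (q ∷ l') (q≤c , D') (≡.cong suc e)))
      where
      pred-cap : ∀ c {q} → q ≤ᶜ c → pred q ≤ᶜ c
      pred-cap nothing  _   = tt
      pred-cap (just p) q≤p = ℕₚ.≤-trans ℕₚ.pred[n]≤n q≤p
      head : when (hd l <ᵇ q) (w (i , q) * sgn (size l) * f (pred q ∷ l))
          ≈ when (hd l <ᵇ q) (w (i , q) * sgn (size l) * g (pred q ∷ l))
      head with hd l <ᵇ q in eq
      ... | false = refl
      ... | true  = *-congˡ (f≈g _ (pred-cap c q≤c , Dec-hd-cap l (ℕₚ.<⇒≤pred {hd l} {q} (<ᵇ⇒< {hd l} {q} eq)) D)
          ≡.refl)

    d-cong-on : ∀ i {c f g} l → Dec c l → (∀ l → Dec c l → f l ≈ g l) → d i f l ≈ d i g l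
    d-cong-on i l D f≈g = d-cong-shape i l D (λ l' D' _ → f≈g l' D')

    d-cong : ∀ i {f g} l → (∀ l → f l ≈ g l) → d i f l ≈ d i g l
    d-cong i []      f≈g = refl
    d-cong i (q ∷ l) f≈g = +-cong (when-cong (hd l <ᵇ q) (*-congˡ (f≈g _))) (d-cong (suc i) l (f≈g ∘ (q ∷_)))

    d-+ : ∀ i f g l → d i (λ l → f l + g l) l ≈ d i f l + d i g l
    d-+ i f g []      = sym (+-identityˡ 0#)
    d-+ i f g (q ∷ l) = trans (+-cong (trans (when-cong (hd l <ᵇ q) (distribˡ _ _ _)) (when-+ (hd l <ᵇ q) _ _))
        (d-+ (suc i) _ _ l))
                              (interchange _ _ _ _)

    d-* : ∀ i k f l → d i (λ l → k * f l) l ≈ k * d i f l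
    d-* i k f []      = sym (zeroʳ k)
    d-* i k f (q ∷ l) = trans (+-cong (trans (when-cong (hd l <ᵇ q) (solve 3 (λ a k f → a :* (k :* f)
        := k :* (a :* f)) refl _ _ _)) (when-* (hd l <ᵇ q) k _)) (d-* (suc i) k _ l))
                              (sym (distribˡ _ _ _))

    d-0 : ∀ i l → d i (λ _ → 0#) l ≈ 0#
    d-0 i l = trans (d-cong i l (λ _ → sym (zeroˡ 0#))) (trans (d-* i 0# (λ _ → 0#) l) (zeroˡ _))

    -- Exactly one cell disappears, hence the `suc`; this carries the size guard through each step
    -- of `tableaux-iterate`.
    d-size : ∀ i (p : ℕ → Bool) f l → d i (λ l → when (p (suc (size l))) (f l)) l ≈ when (p (size l)) (d i f l)
    d-size i p f []      = sym (when-0 (p 0))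
    d-size i p f (q ∷ l) = begin
      when b (k * when (p (suc (pred q ℕ.+ size l))) x) + d (suc i) (λ l' → when (p (suc (q ℕ.+ size l'))) (f (q ∷ l')))
          l
        ≈⟨ +-cong (head q b ≡.refl) (trans (d-cong (suc i) l (λ l' → reflexive (≡.cong (λ n → when (p n) (f (q ∷ l')))
            (≡.sym (ℕₚ.+-suc q (size l')))))) (d-size (suc i) (λ n → p (q ℕ.+ n)) (f ∘ (q ∷_)) l)) ⟩
      when (p (q ℕ.+ size l)) (when b (k * x)) + when (p (q ℕ.+ size l)) (d (suc i) (f ∘ (q ∷_)) l)
        ≈⟨ when-+ (p (q ℕ.+ size l)) _ _ ⟨
      when (p (q ℕ.+ size l)) (when b (k * x) + d (suc i) (f ∘ (q ∷_)) l) ∎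
      where
      b = hd l <ᵇ q
      k = w (i , q) * sgn (size l)
      x = f (pred q ∷ l)
      head : ∀ q b → (hd l <ᵇ q) ≡ b → when b (k * when (p (suc (pred q ℕ.+ size l))) x)
          ≈ when (p (q ℕ.+ size l)) (when b (k * x))
      head q       false _ = sym (when-0 (p (q ℕ.+ size l)))
      head (suc q) true  _ = sym (when-* (p (suc q ℕ.+ size l)) k x)

    -- One step changes the size by one, hence flips the sign.
    d-sgn : ∀ i f l → d i (λ l → sgn (size l) * f l) l ≈ - (sgn (size l) * d i f l)
    d-sgn i f []      = solve 1 (λ s → :0 := :- (s :* :0)) refl (sgn 0)
    d-sgn i f (q ∷ l) = begin
      when b (a * s * (sgn (pred q ℕ.+ size l) * x)) + d (suc i) (λ l' → sgn (q ℕ.+ size l') * f (q ∷ l')) l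
        ≈⟨ +-cong (head b ≡.refl) (trans (d-cong (suc i) l (λ l' → trans (*-congʳ (sgn-+ q (size l'))) (*-assoc _ _ _)))
            (d-* (suc i) (sgn q) _ l)) ⟩
      - (sgn (q ℕ.+ size l) * when b (a * s * x)) + sgn q * d (suc i) (λ l' → sgn (size l') * f (q ∷ l')) l
        ≈⟨ +-congˡ (*-congˡ (d-sgn (suc i) _ l)) ⟩
      - (sgn (q ℕ.+ size l) * when b (a * s * x)) + sgn q * - (s * y)
        ≈⟨ +-congʳ (-‿cong (*-congʳ (sgn-+ q (size l)))) ⟩
      - (sgn q * s * when b (a * s * x)) + sgn q * - (s * y)
        ≈⟨ solve 4 (λ t s h y → :- (t :* s :* h) :+ t :* (:- (s :* y)) := :- (t :* s :* (h :+ y))) refl _ _ _ _ ⟩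
      - (sgn q * s * (when b (a * s * x) + y))
        ≈⟨ -‿cong (*-congʳ (sgn-+ q (size l))) ⟨
      - (sgn (q ℕ.+ size l) * (when b (a * s * x) + y)) ∎
      where
      b = hd l <ᵇ q
      a = w (i , q)
      s = sgn (size l)
      x = f (pred q ∷ l)
      y = d (suc i) (f ∘ (q ∷_)) l
      flip : ∀ q → (hd l <ᵇ q) ≡ true → sgn (pred q ℕ.+ size l) ≈ - sgn (q ℕ.+ size l)
      flip (suc q) _ = sym (-‿involutive _)
      head : ∀ b' → b ≡ b' → when b' (a * s * (sgn (pred q ℕ.+ size l) * x))
          ≈ - (sgn (q ℕ.+ size l) * when b' (a * s * x))
      head false _ = sym (trans (-‿cong (zeroʳ _)) -0#≈0#)
      head true  e = trans (*-congˡ (*-congʳ (flip q e))) (solve 4 (λ a s t x → a :* s :* (:- t :* x)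
          := :- (t :* (a :* s :* x))) refl _ _ _ _)

    d-pad : ∀ i f → PadInv f → PadInv (d i f)
    d-pad i f inv []      = +-identityˡ 0#
    d-pad i f inv (q ∷ l) = +-cong
        (trans (reflexive (≡.cong₂ (λ h n → when (h <ᵇ q) (w (i , q) * sgn n * f (pred q ∷ l ++ 0 ∷ []))) (hd-pad l)
        (size-pad l)))
                                          (when-cong (hd l <ᵇ q) (*-congˡ (inv _))))
                                   (d-pad (suc i) _ (inv ∘ (q ∷_)) l)

    u-cong-on : ∀ e i {c f g} l → Dec c l → (∀ l → Dec c l → f l ≈ g l) → u e i c f l ≈ u e i c g l
    u-cong-on e i {c} {f} {g} [] D f≈g = head e
      where
      head : ∀ e → when (e ∧ room c 0) (w (i , 1) * f (1 ∷ [])) ≈ when (e ∧ room c 0) (w (i , 1) * g (1 ∷ []))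
      head false = refl
      head true with room c 0 in eq
      ... | false = refl
      ... | true  = *-congˡ (f≈g _ (room⇒≤ᶜ c 0 eq , tt))
    u-cong-on e i {c} {f} {g} (q ∷ l) (q≤c , D) f≈g = +-cong head (u-cong-on e (suc i) l D (λ l' D' → f≈g (q ∷ l')
        (q≤c , D')))
      where
      head : when (room c q) (w (i , suc q) * sgn (size l) * f (suc q ∷ l))
          ≈ when (room c q) (w (i , suc q) * sgn (size l) * g (suc q ∷ l))
      head with room c q in eq
      ... | false = refl
      ... | true  = *-congˡ (f≈g _ (room⇒≤ᶜ c q eq , Dec-weaken l (λ r≤q → ℕₚ.≤-trans r≤q (ℕₚ.n≤1+n q)) D))

    u-cong : ∀ e i c {f g} l → (∀ l → f l ≈ g l) → u e i c f l ≈ u e i c g l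
    u-cong e i c []      f≈g = when-cong (e ∧ room c 0) (*-congˡ (f≈g _))
    u-cong e i c (q ∷ l) f≈g = +-cong (when-cong (room c q) (*-congˡ (f≈g _))) (u-cong e (suc i) (just q) l
        (f≈g ∘ (q ∷_)))

    u-+ : ∀ e i c f g l → u e i c (λ l → f l + g l) l ≈ u e i c f l + u e i c g l
    u-+ e i c f g []      = trans (when-cong (e ∧ room c 0) (distribˡ _ _ _)) (when-+ (e ∧ room c 0) _ _)
    u-+ e i c f g (q ∷ l) = trans (+-cong (trans (when-cong (room c q) (distribˡ _ _ _)) (when-+ (room c q) _ _))
        (u-+ e (suc i) (just q) _ _ l))
                                  (interchange _ _ _ _)

    u-* : ∀ e i c k f l → u e i c (λ l → k * f l) l ≈ k * u e i c f l
    u-* e i c k f []      = trans (when-cong (e ∧ room c 0) (solve 3 (λ a k f → a :* (k :* f)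
        := k :* (a :* f)) refl _ _ _)) (when-* (e ∧ room c 0) k _)
    u-* e i c k f (q ∷ l) = trans (+-cong (trans (when-cong (room c q) (solve 3 (λ a k f → a :* (k :* f)
        := k :* (a :* f)) refl _ _ _)) (when-* (room c q) k _)) (u-* e (suc i) (just q) k _ l))
                                  (sym (distribˡ _ _ _))

    u-sgn : ∀ e i c f l → u e i c (λ l → sgn (size l) * f l) l ≈ - (sgn (size l) * u e i c f l)
    u-sgn e i c f []      = trans (when-cong (e ∧ room c 0) (solve 2 (λ a x → a :* (:- :1 :* x)
        := :- (:1 :* (a :* x))) refl _ _))
                            (trans (when-neg (e ∧ room c 0) _) (-‿cong (when-* (e ∧ room c 0) _ _)))
    u-sgn e i c f (q ∷ l) = begin
      when b (a * s * (- sgn (q ℕ.+ size l) * x)) + u e (suc i) (just q) (λ l' → sgn (q ℕ.+ size l') * f (q ∷ l')) l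
        ≈⟨ +-cong (trans (when-cong b (solve 4 (λ a s t x → a :* s :* (:- t :* x)
            := :- t :* (a :* s :* x)) refl _ _ _ _)) (when-* b _ _))
                  (trans (u-cong e (suc i) (just q) l (λ l' → trans (*-congʳ (sgn-+ q (size l'))) (*-assoc _ _ _)))
                      (u-* e (suc i) (just q) (sgn q) _ l)) ⟩
      - sgn (q ℕ.+ size l) * when b (a * s * x) + sgn q * u e (suc i) (just q) (λ l' → sgn (size l') * f (q ∷ l')) l
        ≈⟨ +-cong (*-congʳ (-‿cong (sgn-+ q (size l)))) (*-congˡ (u-sgn e (suc i) (just q) _ l)) ⟩
      - (sgn q * s) * when b (a * s * x) + sgn q * - (s * y)
        ≈⟨ solve 4 (λ t s h y → :- (t :* s) :* h :+ t :* (:- (s :* y)) := :- (t :* s :* (h :+ y))) refl _ _ _ _ ⟩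
      - (sgn q * s * (when b (a * s * x) + y))
        ≈⟨ -‿cong (*-congʳ (sgn-+ q (size l))) ⟨
      - (sgn (q ℕ.+ size l) * (when b (a * s * x) + y)) ∎
      where
      b = room c q
      a = w (i , suc q)
      s = sgn (size l)
      x = f (suc q ∷ l)
      y = u e (suc i) (just q) (f ∘ (q ∷_)) l

    -- The listed 0 receives the cell that `[]` would have created, and the row below it is blocked
    -- by the cap 0. This depends on rows being created on demand, that is, on `true`.
    u-pad : ∀ i c f → PadInv f → PadInv (u true i c f)
    u-pad i c f inv []      = trans (+-identityʳ _) (when-cong (room c 0) (*-congʳ (*-identityʳ _)))
    u-pad i c f inv (q ∷ l) = +-cong
        (when-cong (room c q) (trans (reflexive (≡.cong (λ n → w (i , suc q) * sgn n * f (suc q ∷ l ++ 0 ∷ []))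
        (size-pad l))) (*-congˡ (inv _))))
                                     (u-pad (suc i) (just q) _ (inv ∘ (q ∷_)) l)

-- Iteration, binomial transforms and exponential generating functions

iterate : ∀ {a : Level} {A : Set a} → (A → A) → ℕ → A → A
iterate T zero    x = x
iterate T (suc n) x = T (iterate T n x)

iterate-comm : ∀ {a : Level} {A : Set a} (T : A → A) n x → iterate T n (T x) ≡ T (iterate T n x)
iterate-comm T zero    x = ≡.refl
iterate-comm T (suc n) x = ≡.cong T (iterate-comm T n x)

module BinomialTransform {c ℓ : Level} (R : CommutativeRing c ℓ) where
  open RingFacts R
  open Algebra.Properties.Semiring.Exp semiring using (_^_)

  -- ∑ₖ (n choose k) g k s^(n-k)
  binomial : Carrier → ℕ → (ℕ → Carrier) → Carrier
  binomial s zero    g = g 0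
  binomial s (suc n) g = binomial s n (g ∘ suc) + s * binomial s n g

  binomial-cong : ∀ s n {g g'} → (∀ k → g k ≈ g' k) → binomial s n g ≈ binomial s n g'
  binomial-cong s zero    g≈g' = g≈g' 0
  binomial-cong s (suc n) g≈g' = +-cong (binomial-cong s n (g≈g' ∘ suc)) (*-congˡ (binomial-cong s n g≈g'))

  conv : ℕ → (ℕ → Carrier) → (ℕ → Carrier) → Carrier
  conv zero    a b = a 0 * b 0
  conv (suc n) a b = a 0 * b (suc n) + conv n (a ∘ suc) b

  conv-cong : ∀ n {a a' b b'} → (∀ k → a k ≈ a' k) → (∀ k → b k ≈ b' k) → conv n a b ≈ conv n a' b'
  conv-cong zero    a≈ b≈ = *-cong (a≈ 0) (b≈ 0)
  conv-cong (suc n) a≈ b≈ = +-cong (*-cong (a≈ 0) (b≈ (suc n))) (conv-cong n (a≈ ∘ suc) b≈)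

  conv-+ : ∀ n a a' b → conv n (λ k → a k + a' k) b ≈ conv n a b + conv n a' b
  conv-+ zero    a a' b = distribʳ _ _ _
  conv-+ (suc n) a a' b = trans (+-cong (distribʳ _ _ _) (conv-+ n _ _ b)) (interchange _ _ _ _)

  conv-*ʳ : ∀ n s a b → conv n a (λ k → s * b k) ≈ s * conv n a b
  conv-*ʳ zero    s a b = solve 3 (λ a s b → a :* (s :* b) := s :* (a :* b)) refl _ _ _
  conv-*ʳ (suc n) s a b = trans (+-cong (solve 3 (λ a s b → a :* (s :* b) := s :* (a :* b)) refl _ _ _)
      (conv-*ʳ n s _ b)) (sym (distribˡ _ _ _))

  ν : ℕ → Carrier
  ν zero    = 0#
  ν (suc n) = 1# + ν n

  -- The coefficients of the formal derivative.
  ∂ : (ℕ → Carrier) → ℕ → Carrier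
  ∂ a k = ν (suc k) * a (suc k)

  -- The product rule for power series, one coefficient at a time. Shifting `a` past its constant
  -- term lowers each factor in `∂ a` by one; the summand 1 of `ν (suc (suc n))` makes up for it.
  leibniz : ∀ n a b → ν (suc n) * conv (suc n) a b ≈ conv n (∂ a) b + conv n a (∂ b)
  leibniz zero    a b = solve 4 (λ a b a' b' → (:1 :+ :0) :* (a :* b' :+ a' :* b)
      := (:1 :+ :0) :* a' :* b :+ a :* ((:1 :+ :0) :* b')) refl _ _ _ _
  leibniz (suc n) a b = begin
    ν (suc (suc n)) * (a 0 * b (suc (suc n)) + C)
      ≈⟨ solve 4 (λ v a b c → (:1 :+ v) :* (a :* b :+ c) := a :* ((:1 :+ v) :* b) :+ (c :+ v :* c)) refl _ _ _ _ ⟩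
    a 0 * ∂ b (suc n) + (C + ν (suc n) * C)
      ≈⟨ +-congˡ (+-congˡ (leibniz n (a ∘ suc) b)) ⟩
    a 0 * ∂ b (suc n) + (C + (conv n (∂ (a ∘ suc)) b + conv n (a ∘ suc) (∂ b)))
      ≈⟨ solve 4 (λ x c y z → x :+ (c :+ (y :+ z)) := (c :+ y) :+ (x :+ z)) refl _ _ _ _ ⟩
    (C + conv n (∂ (a ∘ suc)) b) + conv (suc n) a (∂ b)
      -- The convolution is extended by an initial term whose factor `ν 0` vanishes, so that it can
      -- be merged with `C`.
      ≈⟨ +-congʳ (+-congˡ (trans (sym (+-identityˡ _)) (+-congʳ (sym (trans (*-congʳ (zeroˡ _)) (zeroˡ _)))))) ⟩
    (C + conv (suc n) (λ k → ν k * a (suc k)) b) + conv (suc n) a (∂ b)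
      ≈⟨ +-congʳ (sym (conv-+ (suc n) (a ∘ suc) (λ k → ν k * a (suc k)) b)) ⟩
    conv (suc n) (λ k → a (suc k) + ν k * a (suc k)) b + conv (suc n) a (∂ b)
      ≈⟨ +-congʳ (conv-cong (suc n) (λ k → solve 2 (λ v a → a :+ v :* a := (:1 :+ v) :* a) refl (ν k) (a (suc k)))
          (λ _ → refl)) ⟩
    conv (suc n) (∂ a) b + conv (suc n) a (∂ b) ∎
    where C = conv (suc n) (a ∘ suc) b

  -- φ n plays the role of 1/n! and ρ n that of 1/(n+1).
  module DividedPowers (φ ρ : ℕ → Carrier) (φ-zero : φ 0 ≈ 1#) (φ-suc : ∀ n → φ (suc n) ≈ ρ n * φ n)
    (ρν : ∀ n → ρ n * ν (suc n) ≈ 1#) where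

    νφ : ∀ n → ν (suc n) * φ (suc n) ≈ φ n
    νφ n = begin
      ν (suc n) * φ (suc n)   ≈⟨ *-congˡ (φ-suc n) ⟩
      ν (suc n) * (ρ n * φ n) ≈⟨ solve 3 (λ v r f → v :* (r :* f) := (r :* v) :* f) refl _ _ _ ⟩
      ρ n * ν (suc n) * φ n   ≈⟨ trans (*-congʳ (ρν n)) (*-identityˡ _) ⟩
      φ n                     ∎

    -- The second factor is the exponential series, whose derivative is `s` times itself, and
    -- differentiating the first factor shifts `g`. By the product rule the right-hand side then
    -- satisfies the recursion that defines `binomial`, with `ρ n` dividing by `n + 1`.
    exponential : ∀ s n g → φ n * binomial s n g ≈ conv n (λ k → φ k * g k) (λ k → φ k * s ^ k)
    exponential s zero    g = sym (trans (*-congˡ (trans (*-identityʳ _) φ-zero)) (*-identityʳ _))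
    exponential s (suc n) g = begin
      φ (suc n) * (binomial s n (g ∘ suc) + s * binomial s n g)
        ≈⟨ *-congʳ (φ-suc n) ⟩
      ρ n * φ n * (binomial s n (g ∘ suc) + s * binomial s n g)
        ≈⟨ solve 5 (λ r f x s y → r :* f :* (x :+ s :* y) := r :* (f :* x :+ s :* (f :* y))) refl _ _ _ _ _ ⟩
      ρ n * (φ n * binomial s n (g ∘ suc) + s * (φ n * binomial s n g))
        ≈⟨ *-congˡ (+-cong (exponential s n (g ∘ suc)) (*-congˡ (exponential s n g))) ⟩
      ρ n * (conv n (λ k → φ k * g (suc k)) ψ + s * conv n a ψ)
        ≈⟨ *-congˡ (+-cong (conv-cong n (λ k → trans (*-congʳ (sym (νφ k))) (*-assoc _ _ _)) (λ _ → refl))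
                           (trans (sym (conv-*ʳ n s a ψ)) (conv-cong n (λ _ → refl) ∂ψ))) ⟩
      ρ n * (conv n (∂ a) ψ + conv n a (∂ ψ))
        ≈⟨ *-congˡ (leibniz n a ψ) ⟨
      ρ n * (ν (suc n) * conv (suc n) a ψ)
        ≈⟨ trans (sym (*-assoc _ _ _)) (trans (*-congʳ (ρν n)) (*-identityˡ _)) ⟩
      conv (suc n) a ψ ∎
      where
      a ψ : ℕ → Carrier
      a k = φ k * g k
      ψ k = φ k * s ^ k
      ∂ψ : ∀ k → s * ψ k ≈ ∂ ψ k
      ∂ψ k = trans (*-congˡ (*-congʳ (sym (νφ k)))) (solve 4 (λ s v f p → s :* (v :* f :* p)
          := v :* (f :* (s :* p))) refl _ _ _ _)

-- The Clifford relation between adding and removing cells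

module Clifford {c ℓ : Level} (R : CommutativeRing c ℓ)
  (wᵘ wᵈ : Cell → CommutativeRing.Carrier R) (ε : ℕ → CommutativeRing.Carrier R)
  (wᵘwᵈ : ∀ i j → CommutativeRing._≈_ R (CommutativeRing._*_ R (wᵘ (i , j)) (wᵈ (i , j))) (ε i))
  (ε-suc : ∀ i → CommutativeRing._≈_ R (ε (suc i)) (CommutativeRing.-_ R (ε i)))
  where
  open RingFacts R
  open Operators R
  open BinomialTransform R
  open Algebra.Properties.Semiring.Exp semiring using (_^_)
  open Steps wᵘ using (u; u-cong; u-cong-on; u-+; u-*; u-sgn; u-pad)
  open Steps wᵈ using (d; d-cong; d-cong-on; d-+; d-*; d-sgn; d-pad)

  U : ℕ → Cap → (List ℕ → Carrier) → List ℕ → Carrier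
  U = u true

  split-sgn : ∀ b k m n x → when b (k * sgn (m ℕ.+ n) * x) ≈ when b (k * sgn m) * (sgn n * x)
  split-sgn true  k m n x = trans (*-congʳ (*-congˡ (sgn-+ m n)))
    (solve 4 (λ k m n x → k :* (m :* n) :* x := (k :* m) :* (n :* x)) refl _ _ _ _)
  split-sgn false k m n x = sym (zeroˡ _)

  -- The coefficient contains the sign of the very rows in which `d` acts, and losing one cell there
  -- reverses it. Hence changes in two different rows anticommute.
  d-guarded : ∀ i b k n g l →
    d i (λ l → when b (k * sgn (n ℕ.+ size l) * g l)) l ≈ - when b (k * sgn (n ℕ.+ size l) * d i g l)
  d-guarded i b k n g l = begin
    d i (λ l → when b (k * sgn (n ℕ.+ size l) * g l)) l     ≈⟨ d-cong i l (λ l → split-sgn b k n (size l) (g l)) ⟩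
    d i (λ l → when b (k * sgn n) * (sgn (size l) * g l)) l ≈⟨ d-* i _ _ l ⟩
    when b (k * sgn n) * d i (λ l → sgn (size l) * g l) l   ≈⟨ *-congˡ (d-sgn i g l) ⟩
    when b (k * sgn n) * - (sgn (size l) * d i g l)         ≈⟨ -‿distribʳ-* _ _ ⟨
    - (when b (k * sgn n) * (sgn (size l) * d i g l))       ≈⟨ -‿cong (split-sgn b k n (size l) _) ⟨
    - when b (k * sgn (n ℕ.+ size l) * d i g l)             ∎

  u-guarded : ∀ i c b k n g l →
    U i c (λ l → when b (k * sgn (n ℕ.+ size l) * g l)) l ≈ - when b (k * sgn (n ℕ.+ size l) * U i c g l)
  u-guarded i c b k n g l = begin
    U i c (λ l → when b (k * sgn (n ℕ.+ size l) * g l)) l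
        ≈⟨ u-cong true i c l (λ l → split-sgn b k n (size l) (g l)) ⟩
    U i c (λ l → when b (k * sgn n) * (sgn (size l) * g l)) l ≈⟨ u-* true i c _ _ l ⟩
    when b (k * sgn n) * U i c (λ l → sgn (size l) * g l) l   ≈⟨ *-congˡ (u-sgn true i c g l) ⟩
    when b (k * sgn n) * - (sgn (size l) * U i c g l)         ≈⟨ -‿distribʳ-* _ _ ⟨
    - (when b (k * sgn n) * (sgn (size l) * U i c g l))       ≈⟨ -‿cong (split-sgn b k n (size l) _) ⟨
    - when b (k * sgn (n ℕ.+ size l) * U i c g l)             ∎

  -- Demanding that the first row stays shorter than q afterwards amounts to lowering the cap.
  u-lower-cap : ∀ i q k g l → Dec (just q) l →
    U i (just q) (λ l → when (hd l <ᵇ q) (k * sgn (size l) * g l)) l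
        ≈ - when (hd l <ᵇ q) (k * sgn (size l) * U i (just (pred q)) g l)
  u-lower-cap i zero          k g []      D = sym -0#≈0#
  u-lower-cap i (suc zero)    k g []      D = solve 2 (λ a k → a :* :0 := :- (k :* :1 :* :0)) refl _ _
  u-lower-cap i (suc (suc q)) k g []      D = solve 3 (λ a k g → a :* (k :* (:- :1) :* g)
      := :- (k :* :1 :* (a :* g))) refl _ _ _
  u-lower-cap i q k g (r ∷ l) (r≤q , D) = trans (+-congˡ (u-guarded (suc i) (just r) (r <ᵇ q) k r (g ∘ (r ∷_)) l))
      (total q r≤q)
    where
    a = wᵘ (i , suc r)
    s = sgn (size l)
    t = sgn (r ℕ.+ size l)
    x = g (suc r ∷ l)
    y = U (suc i) (just r) (g ∘ (r ∷_)) l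
    total : ∀ q → r ℕ.≤ q →
      when (r <ᵇ q) (a * s * when (suc r <ᵇ q) (k * - t * x)) + - when (r <ᵇ q) (k * t * y)
        ≈ - when (r <ᵇ q) (k * t * (when (r <ᵇ pred q) (a * s * x) + y))
    total zero    _ = +-identityˡ _
    total (suc q) _ with r <ᵇ suc q | r <ᵇ q
    ... | false | _     = +-identityˡ _
    ... | true  | true  = solve 6 (λ a s k t x y → a :* s :* (k :* (:- t) :* x) :+ :- (k :* t :* y)
        := :- (k :* t :* (a :* s :* x :+ y))) refl _ _ _ _ _ _
    ... | true  | false = solve 5 (λ a s k t y → a :* s :* :0 :+ :- (k :* t :* y)
        := :- (k :* t :* (:0 :+ y))) refl _ _ _ _ _

  -- Off the diagonal the two products cancel, because exactly one of the two cells is counted in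
  -- the sign of the other.  On the diagonal the contributions ±1 of the addable and removable
  -- rows alternate and telescope to the first addable row.
  clifford : ∀ i c f l → PadInv f → Dec c l → U i c (d i f) l + d i (U i c f) l ≈ when (room c (hd l)) (ε i * f l)
  clifford i c f [] inv D = trans (+-identityʳ _) (when-cong (room c 0) (begin
    wᵘ (i , 1) * (wᵈ (i , 1) * 1# * f (0 ∷ []) + 0#)
      ≈⟨ solve 3 (λ a b x → a :* (b :* :1 :* x :+ :0) := a :* b :* x) refl _ _ _ ⟩
    wᵘ (i , 1) * wᵈ (i , 1) * f (0 ∷ [])
      ≈⟨ *-cong (wᵘwᵈ i 1) (inv []) ⟩
    ε i * f [] ∎))
  clifford i c f (q ∷ l) inv (q≤c , D) = begin
    when r (a * s * (when (h <ᵇ suc q) (b * s * F) + A)) + U (suc i) (just q) (λ l' → d i f (q ∷ l')) l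
      + (when g (b' * s * (when (room c (pred q)) (a' * s * F') + B)) + d (suc i) (λ l' → U i c f (q ∷ l')) l)
      ≈⟨ +-cong (+-congˡ (trans (u-+ true (suc i) (just q) _ _ l) (+-congʳ (u-lower-cap (suc i) q b' _ l D))))
                (+-congˡ (trans (d-+ (suc i) _ _ l) (+-congʳ (d-guarded (suc i) r a 0 _ l)))) ⟩
    when r (a * s * (when (h <ᵇ suc q) (b * s * F) + A)) + (- when g (b' * s * B) + X)
      + (when g (b' * s * (when (room c (pred q)) (a' * s * F') + B)) + (- when r (a * s * A) + Y))
      ≈⟨ +-congʳ (+-congʳ (reflexive (≡.cong (λ z → when r (a * s * (when z (b * s * F) + A)))
          (<ᵇ-true (s≤s (Dec-hd l D)))))) ⟩
    when r (a * s * (b * s * F + A)) + (- when g (b' * s * B) + X)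
      + (when g (b' * s * (when (room c (pred q)) (a' * s * F') + B)) + (- when r (a * s * A) + Y))
      ≈⟨ +-cong (+-congʳ (first r)) (+-congʳ (second q q≤c g ≡.refl)) ⟩
    (when r (ε i * F) + when r (a * s * A)) + (- when g (b' * s * B) + X)
      + ((when g (ε i * F) + when g (b' * s * B)) + (- when r (a * s * A) + Y))
      ≈⟨ solve 6 (λ e A B X e' Y → (e :+ A) :+ (:- B :+ X) :+ ((e' :+ B) :+ (:- A :+ Y))
          := e :+ (e' :+ (X :+ Y))) refl _ _ _ _ _ _ ⟩
    when r (ε i * F) + (when g (ε i * F) + (X + Y))
      -- Row `suc i` can take a cell exactly when row `i` can lose one. So what is left of the lower
      -- rows, with the opposite factor `ε (suc i)`, cancels the removable cell of row `i`.
      ≈⟨ +-congˡ (+-congˡ (clifford (suc i) (just q) (f ∘ (q ∷_)) l (inv ∘ (q ∷_)) D)) ⟩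
    when r (ε i * F) + (when g (ε i * F) + when g (ε (suc i) * F))
      ≈⟨ +-congˡ (+-congˡ (trans (when-cong g (trans (*-congʳ (ε-suc i)) (sym (-‿distribˡ-* _ _)))) (when-neg g _))) ⟩
    when r (ε i * F) + (when g (ε i * F) + - when g (ε i * F))
      ≈⟨ +-congˡ (-‿inverseʳ _) ⟩
    when r (ε i * F) + 0#
      ≈⟨ +-identityʳ _ ⟩
    when r (ε i * F) ∎
    where
    h = hd l
    r = room c q
    g = h <ᵇ q
    s = sgn (size l)
    a = wᵘ (i , suc q)
    b = wᵈ (i , suc q)
    a' = wᵘ (i , suc (pred q))
    b' = wᵈ (i , q)
    F = f (q ∷ l)
    F' = f (suc (pred q) ∷ l)
    A = d (suc i) (f ∘ (suc q ∷_)) l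
    B = U (suc i) (just (pred q)) (f ∘ (pred q ∷_)) l
    X = U (suc i) (just q) (d (suc i) (f ∘ (q ∷_))) l
    Y = d (suc i) (U (suc i) (just q) (f ∘ (q ∷_))) l
    diag : ∀ j x → wᵘ (i , j) * wᵈ (i , j) * (s * s) * x ≈ ε i * x
    diag j x = *-congʳ (trans (*-cong (wᵘwᵈ i j) (sgn² (size l))) (*-identityʳ _))
    first : ∀ r → when r (a * s * (b * s * F + A)) ≈ when r (ε i * F) + when r (a * s * A)
    first r = trans (when-cong r (trans
      (solve 5 (λ a s b x y → a :* s :* (b :* s :* x :+ y) := a :* b :* (s :* s) :* x :+ a :* s :* y) refl _ _ _ _ _)
      (+-congʳ (diag (suc q) F)))) (when-+ r _ _)
    second : ∀ q → q ≤ᶜ c → ∀ g → (h <ᵇ q) ≡ g →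
      when g (wᵈ (i , q) * s * (when (room c (pred q)) (wᵘ (i , suc (pred q)) * s * f (suc (pred q) ∷ l)) + B))
        ≈ when g (ε i * f (q ∷ l)) + when g (wᵈ (i , q) * s * B)
    second q       _   false _ = sym (+-identityˡ 0#)
    second (suc q) q≤c true  _ rewrite room-suc c q≤c = trans
      (solve 5 (λ a s b x y → b :* s :* (a :* s :* x :+ y) := a :* b :* (s :* s) :* x :+ b :* s :* y) refl _ _ _ _ _)
      (+-congʳ (diag (suc q) _))

  U₁ d₁ : (List ℕ → Carrier) → List ℕ → Carrier
  U₁ = U 1 nothing
  d₁ = d 1

  U₁-cong-on : ∀ {f g} l → Dec nothing l → (∀ l → Dec nothing l → f l ≈ g l) → U₁ f l ≈ U₁ g l
  U₁-cong-on = u-cong-on true 1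

  d₁-cong-on : ∀ {f g} l → Dec nothing l → (∀ l → Dec nothing l → f l ≈ g l) → d₁ f l ≈ d₁ g l
  d₁-cong-on = d-cong-on 1

  clifford₁ : ∀ f l → PadInv f → Dec nothing l → U₁ (d₁ f) l ≈ ε 1 * f l + - 1# * d₁ (U₁ f) l
  clifford₁ f l inv D = begin
    U₁ (d₁ f) l                                   ≈⟨ solve 2 (λ x y → x := x :+ y :+ :- :1 :* y) refl _ _ ⟩
    U₁ (d₁ f) l + d₁ (U₁ f) l + - 1# * d₁ (U₁ f) l ≈⟨ +-congʳ (clifford 1 nothing f l inv D) ⟩
    ε 1 * f l + - 1# * d₁ (U₁ f) l                ∎

  U²-d : ∀ f l → PadInv f → Dec nothing l → U₁ (U₁ (d₁ f)) l ≈ d₁ (U₁ (U₁ f)) l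
  U²-d f l inv D = begin
    U₁ (U₁ (d₁ f)) l
      ≈⟨ U₁-cong-on l D (λ l' D' → clifford₁ f l' inv D') ⟩
    U₁ (λ l' → ε 1 * f l' + - 1# * d₁ (U₁ f) l') l
      ≈⟨ trans (u-+ true 1 nothing _ _ l) (+-cong (u-* true 1 nothing _ _ l) (u-* true 1 nothing _ _ l)) ⟩
    ε 1 * U₁ f l + - 1# * U₁ (d₁ (U₁ f)) l
      ≈⟨ +-congˡ (*-congˡ (clifford₁ (U₁ f) l (u-pad 1 nothing f inv) D)) ⟩
    ε 1 * U₁ f l + - 1# * (ε 1 * U₁ f l + - 1# * d₁ (U₁ (U₁ f)) l)
      ≈⟨ solve 2 (λ x y → x :+ :- :1 :* (x :+ :- :1 :* y) := y) refl _ _ ⟩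
    d₁ (U₁ (U₁ f)) l ∎

  U² d² : (List ℕ → Carrier) → List ℕ → Carrier
  U² f = U₁ (U₁ f)
  d² f = d₁ (d₁ f)

  U²-cong-on : ∀ {f g} l → Dec nothing l → (∀ l → Dec nothing l → f l ≈ g l) → U² f l ≈ U² g l
  U²-cong-on l D f≈g = U₁-cong-on l D (λ l' D' → U₁-cong-on l' D' f≈g)

  d²-cong-on : ∀ {f g} l → Dec nothing l → (∀ l → Dec nothing l → f l ≈ g l) → d² f l ≈ d² g l
  d²-cong-on l D f≈g = d₁-cong-on l D (λ l' D' → d₁-cong-on l' D' f≈g)

  U²-lin : ∀ k k' f g l → U² (λ l → k * f l + k' * g l) l ≈ k * U² f l + k' * U² g l
  U²-lin k k' f g l = trans (u-cong true 1 nothing l (lin f g)) (lin (U₁ f) (U₁ g) l)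
    where
    lin : ∀ f g l → U₁ (λ l → k * f l + k' * g l) l ≈ k * U₁ f l + k' * U₁ g l
    lin f g l = trans (u-+ true 1 nothing _ _ l) (+-cong (u-* true 1 nothing _ _ l) (u-* true 1 nothing _ _ l))

  d²-lin : ∀ k k' f g l → d² (λ l → k * f l + k' * g l) l ≈ k * d² f l + k' * d² g l
  d²-lin k k' f g l = trans (d-cong 1 l (lin f g)) (lin (d₁ f) (d₁ g) l)
    where
    lin : ∀ f g l → d₁ (λ l → k * f l + k' * g l) l ≈ k * d₁ f l + k' * d₁ g l
    lin f g l = trans (d-+ 1 _ _ l) (+-cong (d-* 1 _ _ l) (d-* 1 _ _ l))

  U²-d² : ∀ f l → PadInv f → Dec nothing l → U² (d² f) l ≈ d² (U² f) l
  U²-d² f l inv D = trans (U²-d (d₁ f) l (d-pad 1 f inv) D) (d₁-cong-on l D (λ l' D' → U²-d f l' inv D'))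

  -- Dominoes: two steps applied to the constant function

  𝟙 : List ℕ → Carrier
  𝟙 _ = 1#

  -- `H i` and `V j` are the weights of a domino lying in row `i` and of one standing in column `j`.
  -- The last two hypotheses turn removed dominoes into added ones, one row lower or one column
  -- further right.
  module Dominoes (κ : Carrier) (H V : ℕ → Carrier)
    (wᵘ-horizontal : ∀ i j → wᵘ (i , suc j) * wᵘ (i , suc (suc j)) ≈ H i)
    (wᵘ-vertical   : ∀ i j → wᵘ (i , j) * wᵘ (suc i , j) ≈ V j)
    (wᵈ-horizontal : ∀ i j → κ * (wᵈ (i , suc j) * wᵈ (i , suc (suc j))) ≈ H (suc i))
    (wᵈ-vertical   : ∀ i j → κ * (wᵈ (i , suc j) * wᵈ (suc i , suc j)) ≈ - V (suc (suc j)))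
    where

    U₂ : ℕ → Cap → List ℕ → Carrier
    U₂ i c = U i c (U i c 𝟙)

    d₂ : ℕ → List ℕ → Carrier
    d₂ i = d i (d i 𝟙)

    -- A vertical domino at the end of two rows of length `q` lies in column `q + 1`. The signs of
    -- its cells differ by the `q` cells of the lower row.
    VS : ℕ → Carrier
    VS q = V (suc q) * sgn q

    -- Only a first row of length exactly `q` gains from the longer row above. The extra cell is the
    -- lower half of a vertical domino whose upper half has just been added.
    u-raise-cap : ∀ i q l → hd l ℕ.≤ q →
      U i (just (suc q)) 𝟙 l ≈ U i (just q) 𝟙 l + when (hd l ≡ᵇ q) (wᵘ (i , suc q) * sgn (size (tl l)))
    u-raise-cap i zero    []      _ = sym (+-identityˡ _)
    u-raise-cap i (suc q) []      _ = sym (+-identityʳ _)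
    u-raise-cap i q       (r ∷ l) r≤q with ℕₚ.m≤n⇒m<n∨m≡n r≤q
    ... | inj₁ r<q rewrite <ᵇ-true (s≤s r≤q) | <ᵇ-true r<q | ≡ᵇ-false (ℕₚ.<⇒≢ r<q) = sym (+-identityʳ _)
    ... | inj₂ ≡.refl rewrite <ᵇ-true (s≤s r≤q) | <ᵇ-false {r} {r} r≤q | ≡ᵇ-refl r =
      solve 3 (λ a s y → a :* s :* :1 :+ y := :0 :+ y :+ a :* s) refl _ _ _

    sgn-size : ∀ q l → hd l ≡ q → sgn (size l) * sgn (size (tl l)) ≈ sgn q
    sgn-size q []      ≡.refl = *-identityˡ _
    sgn-size q (r ∷ l) ≡.refl = trans (*-congʳ (sgn-+ r (size l)))
        (trans (*-assoc _ _ _) (trans (*-congˡ (sgn² (size l))) (*-identityʳ _)))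

    -- Adding a cell here and one further down cancels against the same two additions in the other
    -- order. Pairs survive only if a single order is possible, and then the two cells form a
    -- domino.
    U₂-step : ∀ i c q l → Dec c (q ∷ l) →
      U₂ i c (q ∷ l) ≈ when (room c (suc q)) (H i) + (when (room c q) (when (hd l ≡ᵇ q) (VS q)) + U₂ (suc i) (just q) l)
    U₂-step i c q l (q≤c , D) = begin
      when r (a * s * (when r' (a' * s * 1#) + U (suc i) (just (suc q)) 𝟙 l))
        + U (suc i) (just q) (λ l' → when r (a * sgn (size l') * 1#) + Uᵗ l') l
        ≈⟨ +-cong (when-cong r (*-congˡ (+-congˡ (u-raise-cap (suc i) q l (Dec-hd l D)))))
                  (trans (u-+ true (suc i) (just q) _ _ l) (+-congʳ (u-guarded (suc i) (just q) r a 0 𝟙 l))) ⟩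
      when r (a * s * (when r' (a' * s * 1#) + (Uᵗ l + when e (v * s'))))
        + (- when r (a * s * Uᵗ l) + U₂ (suc i) (just q) l)
        ≈⟨ cases r r' ≡.refl ≡.refl ⟩
      when r' (H i) + (when r (when e (VS q)) + U₂ (suc i) (just q) l) ∎
      where
      r = room c q
      r' = room c (suc q)
      e = hd l ≡ᵇ q
      a = wᵘ (i , suc q)
      a' = wᵘ (i , suc (suc q))
      v = wᵘ (suc i , suc q)
      s = sgn (size l)
      s' = sgn (size (tl l))
      Uᵗ = U (suc i) (just q) 𝟙
      room-mono : ∀ c {q} → room c (suc q) ≡ true → room c q ≡ true
      room-mono nothing  _ = ≡.refl
      room-mono (just p) {q} e = <ᵇ-true (ℕₚ.<-trans (ℕₚ.n<1+n q) (<ᵇ⇒< {suc q} {p} e))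
      vertical : ∀ e → (hd l ≡ᵇ q) ≡ e → a * s * when e (v * s') ≈ when e (VS q)
      vertical false _ = zeroʳ _
      vertical true  h = trans (solve 4 (λ a s v s' → a :* s :* (v :* s') := (a :* v) :* (s :* s')) refl _ _ _ _)
                               (*-cong (wᵘ-vertical i (suc q)) (sgn-size q l (≡ᵇ⇒≡ h)))
      horizontal : ∀ r' → a * s * when r' (a' * s * 1#) ≈ when r' (H i)
      horizontal false = zeroʳ _
      horizontal true  = trans (solve 3 (λ a s a' → a :* s :* (a' :* s :* :1) := (a :* a') :* (s :* s)) refl _ _ _)
                               (trans (*-cong (wᵘ-horizontal i q) (sgn² (size l))) (*-identityʳ _))
      cases : ∀ r r' → room c q ≡ r → room c (suc q) ≡ r' →
        when r (a * s * (when r' (a' * s * 1#) + (Uᵗ l + when e (v * s')))) + (- when r (a * s * Uᵗ l) + U₂ (suc i)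
            (just q) l)
          ≈ when r' (H i) + (when r (when e (VS q)) + U₂ (suc i) (just q) l)
      cases false false _ _ = solve 1 (λ y → :0 :+ (:- :0 :+ y) := :0 :+ (:0 :+ y)) refl _
      cases false true  eq eq' with () ← ≡.trans (≡.sym eq) (room-mono c eq')
      cases true  r'    _ _ = trans
        (solve 5 (λ k x y z t → k :* (x :+ (y :+ z)) :+ (:- (k :* y) :+ t) := k :* x :+ (k :* z :+ t)) refl _ _ _ _ _)
        (+-cong (horizontal r') (+-congʳ (vertical e ≡.refl)))

    -- As for additions, pairs removable in both orders cancel. A vertical domino loses its lower
    -- cell first, so its term keeps the minus sign of `below`, which `wᵈ-vertical` absorbs.
    d₂-step : ∀ i q l → Dec (just q) l →
      κ * d₂ i (q ∷ l) ≈ when (hd l <ᵇ pred q) (H (suc i)) + (when ((hd l ≡ᵇ q) ∧ (hd (tl l) <ᵇ q)) (VS q) + κ * d₂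
          (suc i) l)
    d₂-step i zero          []      D = solve 1 (λ k → k :* (:0 :+ :0) := :0 :+ (:0 :+ k :* :0)) refl _
    d₂-step i (suc zero)    []      D = solve 2 (λ k b → k :* (b :* :1 :* (:0 :+ :0) :+ :0)
        := :0 :+ (:0 :+ k :* :0)) refl _ _
    d₂-step i (suc (suc q)) []      D = trans
      (solve 3 (λ k b b' → k :* (b' :* :1 :* (b :* :1 :* :1 :+ :0) :+ :0)
          := k :* (b :* b') :+ (:0 :+ k :* :0)) refl _ _ _)
      (+-congʳ (wᵈ-horizontal i q))
    d₂-step i q (r ∷ l) (r≤q , D) = begin
      κ * (when (r <ᵇ q) (b * s * (when (r <ᵇ pred q) (b' * s * 1#) + (when g (v * t * 1#) + Z)))
        + d (suc i) (λ l' → when (hd l' <ᵇ q) (b * sgn (size l') * 1#) + d (suc i) 𝟙 l') (r ∷ l))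
        ≈⟨ *-congˡ (+-congˡ (trans (d-+ (suc i) (λ l' → when (hd l' <ᵇ q) (b * sgn (size l') * 1#)) (d (suc i) 𝟙)
            (r ∷ l)) (+-congʳ (+-cong (below r r≤q) (d-guarded (suc (suc i)) (r <ᵇ q) b r 𝟙 l))))) ⟩
      κ * (when (r <ᵇ q) (b * s * (when (r <ᵇ pred q) (b' * s * 1#) + (when g (v * t * 1#) + Z)))
        + ((- when g (b * v * (s * t)) + - when (r <ᵇ q) (b * s * Z)) + d₂ (suc i) (r ∷ l)))
        ≈⟨ cases (ℕₚ.m≤n⇒m<n∨m≡n r≤q) ⟩
      when (r <ᵇ pred q) (H (suc i)) + (when ((r ≡ᵇ q) ∧ (hd l <ᵇ q)) (VS q) + κ * d₂ (suc i) (r ∷ l)) ∎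
      where
      g = hd l <ᵇ r
      b = wᵈ (i , q)
      b' = wᵈ (i , pred q)
      v = wᵈ (suc i , r)
      t = sgn (size l)
      s = sgn (r ℕ.+ size l)
      Z = d (suc (suc i)) 𝟙 l
      below : ∀ r → r ℕ.≤ q →
        when (hd l <ᵇ r) (wᵈ (suc i , r) * t * when (pred r <ᵇ q) (b * sgn (pred r ℕ.+ size l) * 1#))
          ≈ - when (hd l <ᵇ r) (b * wᵈ (suc i , r) * (sgn (r ℕ.+ size l) * t))
      below zero    _   = sym -0#≈0#
      below (suc r) r<q rewrite <ᵇ-true r<q = trans
        (when-cong (hd l <ᵇ suc r) (solve 4 (λ v t b s → v :* t :* (b :* s :* :1)
            := :- (b :* v :* (:- s :* t))) refl _ _ _ _))
        (when-neg (hd l <ᵇ suc r) _)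
      horizontal : ∀ q → κ * (wᵈ (i , q) * s * when (r <ᵇ pred q) (wᵈ (i , pred q) * s * 1#))
          ≈ when (r <ᵇ pred q) (H (suc i))
      horizontal zero    = trans (*-congˡ (zeroʳ _)) (zeroʳ _)
      horizontal (suc zero) = trans (*-congˡ (zeroʳ _)) (zeroʳ _)
      horizontal (suc (suc q)) with r <ᵇ suc q
      ... | false = trans (*-congˡ (zeroʳ _)) (zeroʳ _)
      ... | true  = trans (solve 4 (λ k b s b' → k :* (b' :* s :* (b :* s :* :1))
          := k :* (b :* b') :* (s :* s)) refl _ _ _ _)
                          (trans (*-cong (wᵈ-horizontal i q) (sgn² (r ℕ.+ size l))) (*-identityʳ _))
      vertical : ∀ q → q ≡ r → - (κ * when (hd l <ᵇ q) (wᵈ (i , q) * wᵈ (suc i , q) * (s * t)))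
          ≈ when (hd l <ᵇ q) (VS q)
      vertical zero    _ = trans (-‿cong (zeroʳ _)) -0#≈0#
      vertical (suc q) e with hd l <ᵇ suc q
      ... | false = trans (-‿cong (zeroʳ _)) -0#≈0#
      ... | true  = begin
        - (κ * (wᵈ (i , suc q) * wᵈ (suc i , suc q) * (s * t))) ≈⟨ solve 3 (λ k w s → :- (k :* (w :* s))
            := :- (k :* w) :* s) refl _ _ _ ⟩
        - (κ * (wᵈ (i , suc q) * wᵈ (suc i , suc q))) * (s * t)
            ≈⟨ *-cong (trans (-‿cong (wᵈ-vertical i q)) (-‿involutive _)) (sgn-size (suc q) (r ∷ l) (≡.sym e)) ⟩
        VS (suc q) ∎
      cases : r ℕ.< q ⊎ r ≡ q →
        κ * (when (r <ᵇ q) (b * s * (when (r <ᵇ pred q) (b' * s * 1#) + (when g (v * t * 1#) + Z)))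
          + ((- when g (b * v * (s * t)) + - when (r <ᵇ q) (b * s * Z)) + d₂ (suc i) (r ∷ l)))
          ≈ when (r <ᵇ pred q) (H (suc i)) + (when ((r ≡ᵇ q) ∧ (hd l <ᵇ q)) (VS q) + κ * d₂ (suc i) (r ∷ l))
      cases (inj₁ r<q) rewrite <ᵇ-true r<q | ≡ᵇ-false (ℕₚ.<⇒≢ r<q) = begin
        κ * (b * s * (x + (when g (v * t * 1#) + Z)) + ((- when g (b * v * (s * t)) + - (b * s * Z)) + y))
          ≈⟨ *-congˡ (+-congˡ (+-congʳ (+-congʳ (-‿cong (trans (when-cong g (solve 4 (λ b v s t → b :* v :* (s :* t)
              := b :* s :* (v :* t :* :1)) refl _ _ _ _)) (when-* g _ _)))))) ⟩
        κ * (b * s * (x + (w + Z)) + ((- (b * s * w) + - (b * s * Z)) + y))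
          ≈⟨ solve 6 (λ k b x w z y → k :* (b :* (x :+ (w :+ z)) :+ ((:- (b :* w) :+ :- (b :* z)) :+ y))
              := k :* (b :* x) :+ (:0 :+ k :* y)) refl κ (b * s) x w Z y ⟩
        κ * (b * s * x) + (0# + κ * y)
          ≈⟨ +-congʳ (horizontal q) ⟩
        when (r <ᵇ pred q) (H (suc i)) + (0# + κ * y) ∎
        where
        x = when (r <ᵇ pred q) (b' * s * 1#)
        y = d₂ (suc i) (r ∷ l)
        w = when g (v * t * 1#)
      cases (inj₂ ≡.refl) rewrite <ᵇ-false {r} {r} ℕₚ.≤-refl | <ᵇ-false {r} {pred r} ℕₚ.pred[n]≤n | ≡ᵇ-refl r = trans
        (solve 3 (λ k x y → k :* (:0 :+ ((:- x :+ :- :0) :+ y)) := :0 :+ (:- (k :* x) :+ k :* y)) refl _ _ _)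
        (+-congˡ (+-congʳ (vertical r ≡.refl)))

    -- Horizontal dominoes removable from a row correspond to those addable to the next row.  A maximal
    -- run of at least two rows of equal positive length q has one addable vertical domino (at its top, in
    -- column q + 1) and one removable one (at its bottom, in column q).
    domino-balance : ∀ i p l → Dec (just p) l →
      U₂ (suc i) (just p) l + when (hd l ≡ᵇ p) (VS p) ≈ κ * d₂ i (p ∷ l) + V 1
    -- The vertical domino addable to the endless run of empty rows has no removable partner: this
    -- is the term `V 1`.
    domino-balance i zero [] D = solve 2 (λ k v → :0 :+ v :* :1 := k :* (:0 :+ :0) :+ v) refl _ _
    domino-balance i (suc zero) [] D = trans
      (solve 4 (λ k a v b → a :* (:0 :+ v :* :1) :+ :0 := k :* (b :* :1 :* (:0 :+ :0) :+ :0) :+ a :* v) refl κ _ _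
          (wᵈ (i , 1)))
      (+-congˡ (wᵘ-vertical (suc i) 1))
    domino-balance i (suc (suc p)) [] D = begin
      a * (a' * 1# * 1# + v * 1#) + 0#          ≈⟨ solve 3 (λ a a' v → a :* (a' :* :1 :* :1 :+ v :* :1) :+ :0
          := a :* a' :+ a :* v) refl _ _ _ ⟩
      a * a' + a * v                            ≈⟨ +-cong (wᵘ-horizontal (suc i) 0) (wᵘ-vertical (suc i) 1) ⟩
      H (suc i) + V 1                           ≈⟨ +-congʳ (wᵈ-horizontal i p) ⟨
      κ * (b * b') + V 1
          ≈⟨ +-congʳ (*-congˡ (solve 2 (λ b b' → b :* b' := b' :* :1 :* (b :* :1 :* :1 :+ :0) :+ :0) refl _ _)) ⟩
      κ * (b' * 1# * (b * 1# * 1# + 0#) + 0#) + V 1 ∎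
      where
      a = wᵘ (suc i , 1)
      a' = wᵘ (suc i , 2)
      v = wᵘ (suc (suc i) , 1)
      b = wᵈ (i , suc p)
      b' = wᵈ (i , suc (suc p))
    domino-balance i p (q ∷ l) (q≤p , D) = begin
      U₂ (suc i) (just p) (q ∷ l) + when (q ≡ᵇ p) (VS p)
        ≈⟨ +-congʳ (U₂-step (suc i) (just p) q l (q≤p , D)) ⟩
      (when (suc q <ᵇ p) (H (suc i)) + (when (q <ᵇ p) (when (hd l ≡ᵇ q) (VS q)) + U₂ (suc (suc i)) (just q) l)) + when
          (q ≡ᵇ p) (VS p)
        ≈⟨ +-congʳ (+-congʳ (reflexive (≡.cong (λ z → when z (H (suc i))) (shift p)))) ⟩
      (x + (when (q <ᵇ p) (when (hd l ≡ᵇ q) (VS q)) + y)) + when (q ≡ᵇ p) (VS p)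
        ≈⟨ solve 4 (λ x a y b → (x :+ (a :+ y)) :+ b := x :+ ((a :+ b) :+ y)) refl _ _ _ _ ⟩
      x + ((when (q <ᵇ p) (when (hd l ≡ᵇ q) (VS q)) + when (q ≡ᵇ p) (VS p)) + y)
        -- If `q ≡ p`, the pending `VS p` is matched with a removable domino when the run of equal
        -- rows ends here, and is handed down to the next row otherwise. If `q` is smaller, a new
        -- run begins.
        ≈⟨ +-congˡ (+-congʳ (runs (ℕₚ.m≤n⇒m<n∨m≡n q≤p))) ⟩
      x + ((when ((q ≡ᵇ p) ∧ (hd l <ᵇ p)) (VS p) + when (hd l ≡ᵇ q) (VS q)) + y)
        ≈⟨ solve 4 (λ x a b y → x :+ ((a :+ b) :+ y) := x :+ (a :+ (y :+ b))) refl _ _ _ _ ⟩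
      x + (when ((q ≡ᵇ p) ∧ (hd l <ᵇ p)) (VS p) + (y + when (hd l ≡ᵇ q) (VS q)))
        ≈⟨ +-congˡ (+-congˡ (domino-balance (suc i) q l D)) ⟩
      x + (when ((q ≡ᵇ p) ∧ (hd l <ᵇ p)) (VS p) + (κ * d₂ (suc i) (q ∷ l) + V 1))
        ≈⟨ solve 4 (λ x a y b → x :+ (a :+ (y :+ b)) := (x :+ (a :+ y)) :+ b) refl _ _ _ _ ⟩
      (x + (when ((q ≡ᵇ p) ∧ (hd l <ᵇ p)) (VS p) + κ * d₂ (suc i) (q ∷ l))) + V 1
        ≈⟨ +-congʳ (d₂-step i p (q ∷ l) (q≤p , D)) ⟨
      κ * d₂ i (p ∷ q ∷ l) + V 1 ∎
      where
      x = when (q <ᵇ pred p) (H (suc i))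
      y = U₂ (suc (suc i)) (just q) l
      shift : ∀ p → (suc q <ᵇ p) ≡ (q <ᵇ pred p)
      shift zero    = ≡.refl
      shift (suc p) = ≡.refl
      runs : q ℕ.< p ⊎ q ≡ p →
        when (q <ᵇ p) (when (hd l ≡ᵇ q) (VS q)) + when (q ≡ᵇ p) (VS p)
            ≈ when ((q ≡ᵇ p) ∧ (hd l <ᵇ p)) (VS p) + when (hd l ≡ᵇ q) (VS q)
      runs (inj₁ q<p) rewrite <ᵇ-true q<p | ≡ᵇ-false (ℕₚ.<⇒≢ q<p) = +-comm _ _
      runs (inj₂ ≡.refl) rewrite <ᵇ-false {q} {q} ℕₚ.≤-refl | ≡ᵇ-refl q with ℕₚ.m≤n⇒m<n∨m≡n (Dec-hd l D)
      ... | inj₁ h<q rewrite <ᵇ-true h<q | ≡ᵇ-false (ℕₚ.<⇒≢ h<q) = +-comm _ _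
      ... | inj₂ h≡q rewrite h≡q | <ᵇ-false {q} {q} ℕₚ.≤-refl | ≡ᵇ-refl q = refl

    -- `domino-balance` starts from the first row as the row above, so the horizontal domino added
    -- to that row is left over as `H 1`.
    U²-one : ∀ l → Dec nothing l → U² 𝟙 l ≈ κ * d² 𝟙 l + (H 1 + V 1)
    U²-one [] D = begin
      a * (a' * 1# * 1# + v * 1#) ≈⟨ solve 3 (λ a a' v → a :* (a' :* :1 :* :1 :+ v :* :1)
          := a :* a' :+ a :* v) refl _ _ _ ⟩
      a * a' + a * v              ≈⟨ +-cong (wᵘ-horizontal 1 0) (wᵘ-vertical 1 1) ⟩
      H 1 + V 1                   ≈⟨ trans (+-congʳ (zeroʳ _)) (+-identityˡ _) ⟨
      κ * 0# + (H 1 + V 1)        ∎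
      where
      a = wᵘ (1 , 1)
      a' = wᵘ (1 , 2)
      v = wᵘ (2 , 1)
    U²-one (q ∷ l) (q≤ , D) = begin
      U₂ 1 nothing (q ∷ l)                                              ≈⟨ U₂-step 1 nothing q l (q≤ , D) ⟩
      H 1 + (when (hd l ≡ᵇ q) (VS q) + U₂ 2 (just q) l)
          ≈⟨ +-congˡ (trans (+-comm _ _) (domino-balance 1 q l D)) ⟩
      H 1 + (κ * d₂ 1 (q ∷ l) + V 1)                                    ≈⟨ solve 3 (λ h k v → h :+ (k :+ v)
          := k :+ (h :+ v)) refl _ _ _ ⟩
      κ * d₂ 1 (q ∷ l) + (H 1 + V 1)                                    ∎

    s : Carrier
    s = H 1 + V 1

    E : ℕ → List ℕ → Carrier
    E n = iterate U² n 𝟙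

    E-pad : ∀ n → PadInv (E n)
    E-pad zero    l = refl
    E-pad (suc n)   = u-pad 1 nothing _ (u-pad 1 nothing _ (E-pad n))

    -- The relation at `𝟙` is carried along by `U²`, which commutes with `d²` on padding-invariant
    -- functions.
    E-suc : ∀ n l → Dec nothing l → E (suc n) l ≈ κ * d² (E n) l + s * E n l
    E-suc zero    l D = trans (U²-one l D) (+-congˡ (sym (*-identityʳ s)))
    E-suc (suc n) l D = begin
      U² (E (suc n)) l                            ≈⟨ U²-cong-on l D (E-suc n) ⟩
      U² (λ l → κ * d² (E n) l + s * E n l) l     ≈⟨ U²-lin κ s _ _ l ⟩
      κ * U² (d² (E n)) l + s * E (suc n) l       ≈⟨ +-congʳ (*-congˡ (U²-d² (E n) l (E-pad n) D)) ⟩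
      κ * d² (E (suc n)) l + s * E (suc n) l      ∎

    d²ⁿ-cong-on : ∀ m {f g} l → Dec nothing l → (∀ l → Dec nothing l → f l ≈ g l) → iterate d² m f l ≈ iterate d² m g l
    d²ⁿ-cong-on zero    l D f≈g = f≈g l D
    d²ⁿ-cong-on (suc m) l D f≈g = d²-cong-on l D (λ l' D' → d²ⁿ-cong-on m l' D' f≈g)

    d²ⁿ-lin : ∀ m k k' f g l → Dec nothing l → iterate d² m (λ l → k * f l + k' * g l) l
        ≈ k * iterate d² m f l + k' * iterate d² m g l
    d²ⁿ-lin zero    k k' f g l D = refl
    d²ⁿ-lin (suc m) k k' f g l D = trans (d²-cong-on l D (d²ⁿ-lin m k k' f g)) (d²-lin k k' _ _ l)

    -- Interpolates between `E n` at `m = 0` and the summands of the binomial formula at `n = 0`;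
    -- the step from one to the other is the recursion of `binomial`.
    P : ℕ → ℕ → List ℕ → Carrier
    P n m l = κ ^ m * iterate d² m (E n) l

    P-suc : ∀ n m l → Dec nothing l → P (suc n) m l ≈ P n (suc m) l + s * P n m l
    P-suc n m l D = begin
      κ ^ m * iterate d² m (E (suc n)) l
          ≈⟨ *-congˡ (d²ⁿ-cong-on m l D (E-suc n)) ⟩
      κ ^ m * iterate d² m (λ l → κ * d² (E n) l + s * E n l) l                  ≈⟨ *-congˡ (d²ⁿ-lin m κ s _ _ l D) ⟩
      κ ^ m * (κ * iterate d² m (d² (E n)) l + s * iterate d² m (E n) l)
          ≈⟨ *-congˡ (+-congʳ (*-congˡ (reflexive (≡.cong (λ f → f l) (iterate-comm d² m (E n)))))) ⟩
      κ ^ m * (κ * iterate d² (suc m) (E n) l + s * iterate d² m (E n) l)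
          ≈⟨ solve 5 (λ c k x s y → c :* (k :* x :+ s :* y) := (k :* c) :* x :+ s :* (c :* y)) refl _ _ _ _ _ ⟩
      P n (suc m) l + s * P n m l                                                ∎

    E-binomial : ∀ n l → Dec nothing l → E n l ≈ binomial s n (λ k → κ ^ k * iterate d² k 𝟙 l)
    E-binomial n l D = trans (sym (*-identityˡ _))
        (trans (go n 0) (binomial-cong s n (λ k → reflexive (≡.cong (λ k → P 0 k l) (ℕₚ.+-identityʳ k)))))
      where
      go : ∀ n m → P n m l ≈ binomial s n (λ k → P 0 (k ℕ.+ m) l)
      go zero    m = refl
      go (suc n) m = begin
        P (suc n) m l                      ≈⟨ P-suc n m l D ⟩
        P n (suc m) l + s * P n m l
            ≈⟨ +-cong (trans (go n (suc m))
            (binomial-cong s n (λ k → reflexive (≡.cong (λ k → P 0 k l) (ℕₚ.+-suc k m))))) (*-congˡ (go n m)) ⟩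
        binomial s (suc n) (λ k → P 0 (k ℕ.+ m) l) ∎

-- Tableaux

applyUpTo-cong : ∀ {A : Set} {f g : ℕ → A} n → (∀ k → f k ≡ g k) → applyUpTo f n ≡ applyUpTo g n
applyUpTo-cong zero    f≡g = ≡.refl
applyUpTo-cong (suc n) f≡g = ≡.cong₂ _∷_ (f≡g 0) (applyUpTo-cong n (f≡g ∘ suc))

rowCells : ℕ → ℕ → ℕ → List Cell
rowCells i m l = map (λ k → (i , suc (m ℕ.+ k))) (upTo (l ∸ m))

-- The cells of λ/μ, where the rows of λ and μ are numbered from i.
cellsFrom : ℕ → List ℕ → List ℕ → List Cell
cellsFrom i μ []      = []
cellsFrom i μ (l ∷ λ') = rowCells i (hd μ) l ++ cellsFrom (suc i) (tl μ) λ'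

part-tl : ∀ μ k → part μ (suc (suc k)) ≡ part (tl μ) (suc k)
part-tl []      k = ≡.refl
part-tl (_ ∷ μ) k = ≡.refl

part-hd : ∀ μ → part μ 1 ≡ hd μ
part-hd []      = ≡.refl
part-hd (_ ∷ μ) = ≡.refl

-- `cells` looks up rows by index, whereas the operators proceed row by row; the second form makes
-- inductions fit together.
cells≡cellsFrom : ∀ μ λ' → cells μ λ' ≡ cellsFrom 1 μ λ'
cells≡cellsFrom μ λ' = ≡.trans
  (≡.cong concat (≡.trans (≡.cong (map _) (Listₚ.map-upTo suc (length λ'))) (Listₚ.map-applyUpTo suc _ (length λ'))))
  (go 1 μ λ')
  where
  go : ∀ i μ λ' → concat (applyUpTo (λ k → rowCells (i ℕ.+ k) (part μ (suc k)) (part λ' (suc k))) (length λ'))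
      ≡ cellsFrom i μ λ'
  go i μ []      = ≡.refl
  go i μ (l ∷ λ') = ≡.cong₂ _++_
    (≡.cong₂ (λ i m → rowCells i m l) (ℕₚ.+-identityʳ i) (part-hd μ))
    (≡.trans (≡.cong concat (applyUpTo-cong (length λ') (λ k → ≡.cong₂ (λ i m → rowCells i m (part λ' (suc k)))
        (ℕₚ.+-suc i k) (part-tl μ k))))
             (go (suc i) (tl μ) λ'))

-- Only the rows listed in the second argument are compared. This is containment once the first list
-- is no longer than the second, as in `⊆ᵇ≡sub`.
sub : List ℕ → List ℕ → Bool
sub μ []       = true
sub μ (l ∷ λ') = (hd μ ≤ᵇ l) ∧ sub (tl μ) λ'

⊆ᵇ≡sub : ∀ μ λ' → length μ ℕ.≤ length λ' → ⊆ᵇ μ λ' ≡ sub μ λ'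
⊆ᵇ≡sub μ λ' μ≤λ' = ≡.trans
  (≡.cong andᵇ (≡.trans (≡.cong (map _) (Listₚ.map-upTo suc (length μ ℕ.+ length λ'))) (Listₚ.map-applyUpTo suc _
      (length μ ℕ.+ length λ'))))
  (go (length μ ℕ.+ length λ') μ λ' (ℕₚ.m≤n+m (length λ') (length μ)) μ≤λ')
  where
  andᵇ : List Bool → Bool
  andᵇ = foldr _∧_ true
  go : ∀ n μ λ' → length λ' ℕ.≤ n → length μ ℕ.≤ length λ' → andᵇ (applyUpTo (λ k → part μ (suc k) ≤ᵇ part λ' (suc k))
      n) ≡ sub μ λ'
  go n       [] []      _ _ = empty n
    where
    empty : ∀ n → andᵇ (applyUpTo (λ k → true) n) ≡ true
    empty zero    = ≡.refl
    empty (suc n) = empty n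
  go (suc n) μ (l ∷ λ') (s≤s a) b = ≡.cong₂ _∧_ (≡.cong (_≤ᵇ l) (part-hd μ))
    (≡.trans (≡.cong andᵇ (applyUpTo-cong n (λ k → ≡.cong (_≤ᵇ part λ' (suc k)) (part-tl μ k))))
        (go n (tl μ) λ' a (tl-length μ b)))
    where
    tl-length : ∀ μ {n} → length μ ℕ.≤ suc n → length (tl μ) ℕ.≤ n
    tl-length []      _ = z≤n
    tl-length (_ ∷ μ) (s≤s p) = p

length-tl : ∀ μ {n} → length μ ℕ.≤ suc n → length (tl μ) ℕ.≤ n
length-tl []      _       = z≤n
length-tl (_ ∷ μ) (s≤s p) = p

Dec-tl : ∀ {c} μ → Dec c μ → Dec (just (hd μ)) (tl μ)
Dec-tl []      _       = _
Dec-tl (_ ∷ μ) (_ , D) = D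

size-tl : ∀ μ → hd μ ℕ.+ size (tl μ) ≡ size μ
size-tl []      = ≡.refl
size-tl (_ ∷ _) = ≡.refl

rowCells-empty : ∀ i m → rowCells i m m ≡ []
rowCells-empty i m = ≡.cong (λ n → map (λ k → (i , suc (m ℕ.+ k))) (upTo n)) (ℕₚ.n∸n≡0 m)

rowCells-suc : ∀ i {m l} → m ℕ.≤ l → rowCells i m (suc l) ≡ rowCells i m l ++ (i , suc l) ∷ []
rowCells-suc i {m} {l} m≤l = begin
  map f (upTo (suc l ∸ m))           ≡⟨ ≡.cong (map f ∘ upTo) (ℕₚ.+-∸-assoc 1 m≤l) ⟩
  map f (upTo (suc (l ∸ m)))         ≡⟨ ≡.cong (map f) (Listₚ.upTo-∷ʳ (l ∸ m)) ⟨
  map f (upTo (l ∸ m) ++ l ∸ m ∷ []) ≡⟨ Listₚ.map-++ f (upTo (l ∸ m)) (l ∸ m ∷ []) ⟩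
  rowCells i m l ++ f (l ∸ m) ∷ []   ≡⟨ ≡.cong (λ n → rowCells i m l ++ (i , suc n) ∷ []) (ℕₚ.m+[n∸m]≡n m≤l) ⟩
  rowCells i m l ++ (i , suc l) ∷ [] ∎
  where
  open ≡.≡-Reasoning
  f : ℕ → Cell
  f k = (i , suc (m ℕ.+ k))

InRow : ℕ → ℕ → Cell → Set
InRow i l (i' , j) = i' ≡ i × j ℕ.≤ l

rowCells-InRow : ∀ i m l → m ℕ.≤ l → All (InRow i l) (rowCells i m l)
rowCells-InRow i m l m≤l = Allₚ.map⁺ (Allₚ.applyUpTo⁺₁ id (l ∸ m) (λ {k} k< →
  ≡.refl , ℕₚ.≤-trans (ℕₚ.≤-reflexive (≡.sym (ℕₚ.+-suc m k))) (ℕₚ.≤-trans (ℕₚ.+-monoʳ-≤ m k<)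
      (ℕₚ.≤-reflexive (ℕₚ.m+[n∸m]≡n m≤l)))))

length-rowCells : ∀ i m l → length (rowCells i m l) ≡ l ∸ m
length-rowCells i m l = ≡.trans (Listₚ.length-map _ (upTo (l ∸ m))) (Listₚ.length-upTo (l ∸ m))

≤ᵇ-true : ∀ {m n} → m ℕ.≤ n → (m ≤ᵇ n) ≡ true
≤ᵇ-true = T→≡ ∘ ℕₚ.≤⇒≤ᵇ

≤ᵇ-false : ∀ {m n} → n ℕ.< m → (m ≤ᵇ n) ≡ false
≤ᵇ-false {m} {n} n<m = ¬T→≡ (ℕₚ.<⇒≱ n<m ∘ ℕₚ.≤ᵇ⇒≤ m n)

≤ᵇ⇒≤ : ∀ {m n} → (m ≤ᵇ n) ≡ true → m ℕ.≤ n
≤ᵇ⇒≤ {m} {n} e = ℕₚ.≤ᵇ⇒≤ m n (≡.subst T (≡.sym e) _)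

∧-true : ∀ {a b} → a ∧ b ≡ true → a ≡ true × b ≡ true
∧-true {true} e = ≡.refl , e

length-cellsFrom : ∀ i μ λ' → length μ ℕ.≤ length λ' → sub μ λ' ≡ true → size μ ℕ.+ length (cellsFrom i μ λ') ≡ size λ'
length-cellsFrom i [] []       _ _ = ≡.refl
length-cellsFrom i μ (l ∷ λ') p s with m≤l , s' ← ∧-true {hd μ ≤ᵇ l} s = begin
  size μ ℕ.+ length (rowCells i (hd μ) l ++ B)
      ≡⟨ ≡.cong₂ ℕ._+_ (≡.sym (size-tl μ)) (≡.trans (Listₚ.length-++ (rowCells i (hd μ) l)) (≡.cong (ℕ._+ length B)
      (length-rowCells i (hd μ) l))) ⟩
  (hd μ ℕ.+ size (tl μ)) ℕ.+ ((l ∸ hd μ) ℕ.+ length B)  ≡⟨ N.solve 4 (λ a b c d → (a N.:+ b) N.:+ (c N.:+ d)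
      N.:= (a N.:+ c) N.:+ (b N.:+ d)) ≡.refl (hd μ) (size (tl μ)) (l ∸ hd μ) (length B) ⟩
  (hd μ ℕ.+ (l ∸ hd μ)) ℕ.+ (size (tl μ) ℕ.+ length B)
      ≡⟨ ≡.cong₂ ℕ._+_ (ℕₚ.m+[n∸m]≡n (≤ᵇ⇒≤ {hd μ} m≤l)) (length-cellsFrom (suc i) (tl μ) λ' (length-tl μ p) s') ⟩
  l ℕ.+ size λ' ∎
  where
  open ≡.≡-Reasoning
  B = cellsFrom (suc i) (tl μ) λ'

length-straight : ∀ i μ → length (cellsFrom i [] μ) ≡ size μ
length-straight i []      = ≡.refl
length-straight i (m ∷ μ) = ≡.trans (Listₚ.length-++ (rowCells i 0 m)) (≡.cong₂ ℕ._+_ (length-rowCells i 0 m)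
    (length-straight (suc i) μ))

cellsFrom-below : ∀ i μ λ' → All (λ c → i ℕ.≤ proj₁ c) (cellsFrom i μ λ')
cellsFrom-below i μ []       = []
cellsFrom-below i μ (l ∷ λ') = Allₚ.++⁺
  (Allₚ.map⁺ (Allₚ.applyUpTo⁺₂ id (l ∸ hd μ) (λ _ → ℕₚ.≤-refl)))
  (All.map ℕₚ.<⇒≤ (cellsFrom-below (suc i) (tl μ) λ'))

cellsFrom-right : ∀ i μ λ' {p} → Dec (just p) λ' → sub μ λ' ≡ true → All (λ c → proj₂ c ℕ.≤ p) (cellsFrom i μ λ')
cellsFrom-right i μ []       D s = []
cellsFrom-right i μ (l ∷ λ') (l≤p , D) s with m≤l , s' ← ∧-true {hd μ ≤ᵇ l} s = Allₚ.++⁺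
  (All.map (λ (_ , j≤l) → ℕₚ.≤-trans j≤l l≤p) (rowCells-InRow i (hd μ) l (≤ᵇ⇒≤ m≤l)))
  (All.map (λ j≤l → ℕₚ.≤-trans j≤l l≤p) (cellsFrom-right (suc i) (tl μ) λ' D s'))

-- Lists: tests, counts and rearrangements

all-++ : ∀ {A : Set} (p : A → Bool) xs ys → all p (xs ++ ys) ≡ all p xs ∧ all p ys
all-++ p []       ys = ≡.refl
all-++ p (x ∷ xs) ys = ≡.trans (≡.cong (p x ∧_) (all-++ p xs ys)) (≡.sym (𝔹ₚ.∧-assoc (p x) _ _))

all-true : ∀ {A : Set} {p : A → Bool} {xs} → All (λ x → p x ≡ true) xs → all p xs ≡ true
all-true []        = ≡.refl
all-true (px ∷ ps) rewrite px = all-true ps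

all-cong : ∀ {A : Set} {p q : A → Bool} {xs} → All (λ x → p x ≡ q x) xs → all p xs ≡ all q xs
all-cong []       = ≡.refl
all-cong (e ∷ es) = ≡.cong₂ _∧_ e (all-cong es)

all-∧ : ∀ {A : Set} (p q : A → Bool) xs → all (λ x → p x ∧ q x) xs ≡ all p xs ∧ all q xs
all-∧ p q []       = ≡.refl
all-∧ p q (x ∷ xs) rewrite all-∧ p q xs with p x
... | false = ≡.refl
... | true with q x
...   | false = ≡.sym (𝔹ₚ.∧-zeroʳ _)
...   | true  = ≡.refl

all-↭ : ∀ {A : Set} (p : A → Bool) {xs ys} → xs ↭ ys → all p xs ≡ all p ys
all-↭ p Perm.refl        = ≡.refl
all-↭ p (prep x r)       = ≡.cong (p x ∧_) (all-↭ p r)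
all-↭ p (swap x y r)     = ≡.trans (≡.cong (λ b → p x ∧ (p y ∧ b)) (all-↭ p r)) (lemma (p x) (p y) _)
  where
  lemma : ∀ a b c → a ∧ (b ∧ c) ≡ b ∧ (a ∧ c)
  lemma true  b c = ≡.refl
  lemma false b c = ≡.sym (𝔹ₚ.∧-zeroʳ b)
all-↭ p (Perm.trans r s) = ≡.trans (all-↭ p r) (all-↭ p s)

count-++ : ∀ {A : Set} (p : A → Bool) xs ys → count p (xs ++ ys) ≡ count p xs ℕ.+ count p ys
count-++ p []       ys = ≡.refl
count-++ p (x ∷ xs) ys = ≡.trans (≡.cong ((if p x then 1 else 0) ℕ.+_) (count-++ p xs ys))
    (≡.sym (ℕₚ.+-assoc (if p x then 1 else 0) _ _))

count-all : ∀ {A : Set} {p : A → Bool} {xs} → All (λ x → p x ≡ true) xs → count p xs ≡ length xs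
count-all []        = ≡.refl
count-all (px ∷ ps) rewrite px = ≡.cong suc (count-all ps)

count-none : ∀ {A : Set} {p : A → Bool} {xs} → All (λ x → p x ≡ false) xs → count p xs ≡ 0
count-none []        = ≡.refl
count-none (px ∷ ps) rewrite px = count-none ps

count-↭ : ∀ {A : Set} (p : A → Bool) {xs ys} → xs ↭ ys → count p xs ≡ count p ys
count-↭ p Perm.refl        = ≡.refl
count-↭ p (prep x r)       = ≡.cong ((if p x then 1 else 0) ℕ.+_) (count-↭ p r)
count-↭ p (swap x y r)     = ≡.trans (≡.cong (λ b → (if p x then 1 else 0) ℕ.+ ((if p y then 1 else 0) ℕ.+ b))
    (count-↭ p r))
  (+-left-comm (if p x then 1 else 0) (if p y then 1 else 0))
  where
  +-left-comm : ∀ a b {c} → a ℕ.+ (b ℕ.+ c) ≡ b ℕ.+ (a ℕ.+ c)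
  +-left-comm a b {c} = ≡.trans (≡.sym (ℕₚ.+-assoc a b c)) (≡.trans (≡.cong (ℕ._+ c) (ℕₚ.+-comm a b))
      (ℕₚ.+-assoc b a c))
count-↭ p (Perm.trans r s) = ≡.trans (count-↭ p r) (count-↭ p s)

insertAll-↭ : ∀ {A : Set} (x : A) w → All (_↭ x ∷ w) (insertAll x w)
insertAll-↭ x []      = Perm.refl ∷ []
insertAll-↭ x (y ∷ w) = Perm.refl ∷ Allₚ.map⁺ (All.map (λ r → Perm.trans (prep y r) (swap y x Perm.refl))
    (insertAll-↭ x w))

perms-↭ : ∀ {A : Set} (xs : List A) → All (_↭ xs) (perms xs)
perms-↭ []       = Perm.refl ∷ []
perms-↭ (x ∷ xs) = Allₚ.concat⁺
    (Allₚ.map⁺ (All.map (λ {w} r → All.map (λ s → Perm.trans s (prep x r)) (insertAll-↭ x w)) (perms-↭ xs)))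

-- Standard tableaux as orderings of cells

standard : List Cell → Bool
standard []      = true
standard (c ∷ w) = all (λ d → not (d ≼ᵇ c)) w ∧ standard w

-- The test of `isSYTᵇ` holds trivially for a cell followed by a later one. Only a later cell
-- compared with an earlier one is constrained, and there the positions drop out.
isSYTᵇ≡standard : ∀ w → isSYTᵇ w ≡ standard w
isSYTᵇ≡standard w = ≡.trans (≡.cong (λ X → all (λ p → all (ordered p) X) X) (indexed≡ id w (λ _ → ≡.refl))) (go 0 w)
  where
  indexedFrom : ℕ → List Cell → List (ℕ × Cell)
  indexedFrom k []      = []
  indexedFrom k (c ∷ w) = (k , c) ∷ indexedFrom (suc k) w
  ordered : ℕ × Cell → ℕ × Cell → Bool
  ordered p q = not (proj₂ p ≼ᵇ proj₂ q) ∨ (proj₁ p ≤ᵇ proj₁ q)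
  indexed≡ : ∀ {k} f w → (∀ j → f j ≡ k ℕ.+ j) → zip (applyUpTo f (length w)) w ≡ indexedFrom k w
  indexed≡ f []      f≡ = ≡.refl
  indexed≡ {k} f (c ∷ w) f≡ = ≡.cong₂ _∷_ (≡.cong (_, c) (≡.trans (f≡ 0) (ℕₚ.+-identityʳ k)))
    (indexed≡ (f ∘ suc) w (λ j → ≡.trans (f≡ (suc j)) (ℕₚ.+-suc k j)))
  above : ∀ k w → All (λ p → k ℕ.≤ proj₁ p) (indexedFrom k w)
  above k []      = []
  above k (c ∷ w) = ℕₚ.≤-refl ∷ All.map ℕₚ.<⇒≤ (above (suc k) w)
  all-indexed : ∀ (p : Cell → Bool) k w → all (p ∘ proj₂) (indexedFrom k w) ≡ all p w
  all-indexed p k []      = ≡.refl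
  all-indexed p k (c ∷ w) = ≡.cong (p c ∧_) (all-indexed p (suc k) w)
  go : ∀ k w → all (λ p → all (ordered p) (indexedFrom k w)) (indexedFrom k w) ≡ standard w
  go k []      = ≡.refl
  go k (c ∷ w) = ≡.cong₂ _∧_
    (all-true {p = ordered (k , c)} {(k , c) ∷ X} (late ℕₚ.≤-refl ∷ All.map (λ k< → late (ℕₚ.<⇒≤ k<))
        (above (suc k) w)))
    (≡.trans (all-∧ (λ p → ordered p (k , c)) (λ p → all (ordered p) X) X)
      (≡.cong₂ _∧_ (≡.trans (all-cong (All.map (λ {p} → early {p}) (above (suc k) w))) (all-indexed (λ d → not (d ≼ᵇ c))
          (suc k) w)) (go (suc k) w)))
    where
    X = indexedFrom (suc k) w
    late : ∀ {j b} → k ℕ.≤ j → not b ∨ (k ≤ᵇ j) ≡ true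
    late {j} {b} k≤j rewrite ≤ᵇ-true k≤j = 𝔹ₚ.∨-zeroʳ (not b)
    early : ∀ {p} → k ℕ.< proj₁ p → ordered p (k , c) ≡ not (proj₂ p ≼ᵇ c)
    early k< rewrite ≤ᵇ-false k< = 𝔹ₚ.∨-identityʳ _

-- The definitions recurse from the smallest entry, but a step of `d` corresponds to the largest,
-- which is the last of the list.
standard-snoc : ∀ w c → standard (w ++ c ∷ []) ≡ all (λ d → not (c ≼ᵇ d)) w ∧ standard w
standard-snoc []      c = ≡.refl
standard-snoc (x ∷ w) c rewrite all-++ (λ d → not (d ≼ᵇ x)) w (c ∷ []) | standard-snoc w c =
  rearrange (all (λ d → not (d ≼ᵇ x)) w) (not (c ≼ᵇ x)) (all (λ d → not (c ≼ᵇ d)) w) (standard w)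
  where
  rearrange : ∀ a b c d → (a ∧ (b ∧ true)) ∧ (c ∧ d) ≡ (b ∧ c) ∧ (a ∧ d)
  rearrange true  true  c d     = ≡.refl
  rearrange true  false c d     = ≡.refl
  rearrange false true  true  d = ≡.refl
  rearrange false true  false d = ≡.refl
  rearrange false false c d     = ≡.refl

inversions-snoc : ∀ w c → inversions (w ++ c ∷ []) ≡ count (c ⊲ᵇ_) w ℕ.+ inversions w
inversions-snoc []      c = ≡.refl
inversions-snoc (x ∷ w) c rewrite count-++ (_⊲ᵇ x) w (c ∷ []) | inversions-snoc w c | ℕₚ.+-identityʳ
    (if c ⊲ᵇ x then 1 else 0) =
  N.solve 4 (λ a b d e → (a N.:+ b) N.:+ (d N.:+ e) N.:= (b N.:+ d) N.:+ (a N.:+ e)) ≡.refl (count (_⊲ᵇ x) w)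
      (if c ⊲ᵇ x then 1 else 0) (count (c ⊲ᵇ_) w) (inversions w)

-- Finite sums, and sums over permutations by their last entry

module Sums {c ℓ : Level} (R : CommutativeRing c ℓ) where
  open RingFacts R

  ∑ : ∀ {A : Set} → (A → Carrier) → List A → Carrier
  ∑ f []       = 0#
  ∑ f (x ∷ xs) = f x + ∑ f xs

  ∑-cong-All : ∀ {A : Set} {P : A → Set} {f g : A → Carrier} {xs} → All P xs → (∀ x → P x → f x ≈ g x) → ∑ f xs ≈ ∑ g xs
  ∑-cong-All []       f≈g = refl
  ∑-cong-All (p ∷ ps) f≈g = +-cong (f≈g _ p) (∑-cong-All ps f≈g)

  ∑-cong : ∀ {A : Set} {f g : A → Carrier} xs → (∀ x → f x ≈ g x) → ∑ f xs ≈ ∑ g xs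
  ∑-cong []       f≈g = refl
  ∑-cong (x ∷ xs) f≈g = +-cong (f≈g x) (∑-cong xs f≈g)

  ∑-++ : ∀ {A : Set} (f : A → Carrier) xs ys → ∑ f (xs ++ ys) ≈ ∑ f xs + ∑ f ys
  ∑-++ f []       ys = sym (+-identityˡ _)
  ∑-++ f (x ∷ xs) ys = trans (+-congˡ (∑-++ f xs ys)) (sym (+-assoc _ _ _))

  ∑-map : ∀ {A B : Set} (f : B → Carrier) (g : A → B) xs → ∑ f (map g xs) ≈ ∑ (f ∘ g) xs
  ∑-map f g []       = refl
  ∑-map f g (x ∷ xs) = +-congˡ (∑-map f g xs)

  ∑-concatMap : ∀ {A B : Set} (f : B → Carrier) (g : A → List B) xs → ∑ f (concatMap g xs) ≈ ∑ (λ x → ∑ f (g x)) xs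
  ∑-concatMap f g []       = refl
  ∑-concatMap f g (x ∷ xs) = trans (∑-++ f (g x) (concatMap g xs)) (+-congˡ (∑-concatMap f g xs))

  ∑-+ : ∀ {A : Set} (f g : A → Carrier) xs → ∑ (λ x → f x + g x) xs ≈ ∑ f xs + ∑ g xs
  ∑-+ f g []       = sym (+-identityˡ 0#)
  ∑-+ f g (x ∷ xs) = trans (+-congˡ (∑-+ f g xs)) (interchange _ _ _ _)

  ∑-* : ∀ {A : Set} k (f : A → Carrier) xs → ∑ (λ x → k * f x) xs ≈ k * ∑ f xs
  ∑-* k f []       = sym (zeroʳ k)
  ∑-* k f (x ∷ xs) = trans (+-congˡ (∑-* k f xs)) (sym (distribˡ _ _ _))

  ∑-when : ∀ {A : Set} b (f : A → Carrier) xs → ∑ (λ x → when b (f x)) xs ≈ when b (∑ f xs)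
  ∑-when true  f xs = refl
  ∑-when false f xs = trans (∑-cong xs (λ _ → sym (zeroˡ 0#))) (trans (∑-* 0# (λ _ → 0#) xs) (zeroˡ _))

  ∑-filterᵇ : ∀ {A : Set} (f : A → Carrier) p xs → ∑ f (filterᵇ p xs) ≈ ∑ (λ x → when (p x) (f x)) xs
  ∑-filterᵇ f p []       = refl
  ∑-filterᵇ f p (x ∷ xs) with p x
  ... | true  = +-congˡ (∑-filterᵇ f p xs)
  ... | false = trans (∑-filterᵇ f p xs) (sym (+-identityˡ _))

  ∑< : (ℕ → Carrier) → ℕ → Carrier
  ∑< g zero    = 0#
  ∑< g (suc n) = g 0 + ∑< (g ∘ suc) n

  ∑<-upTo : ∀ g n → ∑ g (upTo n) ≈ ∑< g n
  ∑<-upTo g n = go id n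
    where
    go : ∀ f n → ∑ g (applyUpTo f n) ≈ ∑< (g ∘ f) n
    go f zero    = refl
    go f (suc n) = +-congˡ (go (f ∘ suc) n)

  ∑<-cong : ∀ n {g g'} → (∀ k → k ℕ.< n → g k ≈ g' k) → ∑< g n ≈ ∑< g' n
  ∑<-cong zero    g≈ = refl
  ∑<-cong (suc n) g≈ = +-cong (g≈ 0 (s≤s z≤n)) (∑<-cong n (λ k k< → g≈ (suc k) (s≤s k<)))

  ∑<-+ : ∀ n g g' → ∑< (λ k → g k + g' k) n ≈ ∑< g n + ∑< g' n
  ∑<-+ zero    g g' = sym (+-identityˡ 0#)
  ∑<-+ (suc n) g g' = trans (+-congˡ (∑<-+ n _ _)) (interchange _ _ _ _)

  ∑<-* : ∀ n k g → ∑< (λ j → k * g j) n ≈ k * ∑< g n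
  ∑<-* zero    k g = sym (zeroʳ k)
  ∑<-* (suc n) k g = trans (+-congˡ (∑<-* n k _)) (sym (distribˡ _ _ _))

  ∑<-0 : ∀ n → ∑< (λ _ → 0#) n ≈ 0#
  ∑<-0 zero    = refl
  ∑<-0 (suc n) = trans (+-identityˡ _) (∑<-0 n)

  ∑<-restrict : ∀ {n N} (g : ℕ → Carrier) → n ℕ.≤ N → ∑< (λ k → when (k <ᵇ n) (g k)) N ≈ ∑< g n
  ∑<-restrict {zero}  {N}     g _         = ∑<-0 N
  ∑<-restrict {suc n} {suc N} g (s≤s n≤N) = +-congˡ (∑<-restrict (g ∘ suc) n≤N)

  ∑<-pick : ∀ {n N} (g : ℕ → Carrier) → n ℕ.< N → ∑< (λ k → when (n ≡ᵇ k) (g k)) N ≈ g n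
  ∑<-pick {zero}  {suc N} g _         = trans (+-congˡ (∑<-0 N)) (+-identityʳ _)
  ∑<-pick {suc n} {suc N} g (s≤s n<N) = trans (+-identityˡ _) (∑<-pick (g ∘ suc) n<N)

  ∑pick : ∀ {A : Set} → (A → List A → Carrier) → List A → Carrier
  ∑pick g []       = 0#
  ∑pick g (x ∷ xs) = g x xs + ∑pick (λ c rest → g c (x ∷ rest)) xs

  ∑pick-cong-All : ∀ {A : Set} {P : A → Set} {f g : A → List A → Carrier} {xs} → All P xs →
    (∀ c rest → P c → f c rest ≈ g c rest) → ∑pick f xs ≈ ∑pick g xs
  ∑pick-cong-All []       f≈g = refl
  ∑pick-cong-All (p ∷ ps) f≈g = +-cong (f≈g _ _ p) (∑pick-cong-All ps (λ c rest → f≈g c _))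

  ∑pick-cong : ∀ {A : Set} {f g : A → List A → Carrier} xs → (∀ c rest → f c rest ≈ g c rest) → ∑pick f xs ≈ ∑pick g xs
  ∑pick-cong []       f≈g = refl
  ∑pick-cong (x ∷ xs) f≈g = +-cong (f≈g x xs) (∑pick-cong xs (λ c rest → f≈g c _))

  ∑pick-+ : ∀ {A : Set} (f g : A → List A → Carrier) xs → ∑pick (λ c rest → f c rest + g c rest) xs
      ≈ ∑pick f xs + ∑pick g xs
  ∑pick-+ f g []       = sym (+-identityˡ 0#)
  ∑pick-+ f g (x ∷ xs) = trans (+-congˡ (∑pick-+ _ _ xs)) (interchange _ _ _ _)

  ∑pick-* : ∀ {A : Set} k (f : A → List A → Carrier) xs → ∑pick (λ c rest → k * f c rest) xs ≈ k * ∑pick f xs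
  ∑pick-* k f []       = sym (zeroʳ k)
  ∑pick-* k f (x ∷ xs) = trans (+-congˡ (∑pick-* k _ xs)) (sym (distribˡ _ _ _))

  ∑pick-0 : ∀ {A : Set} (xs : List A) → ∑pick (λ _ _ → 0#) xs ≈ 0#
  ∑pick-0 []       = refl
  ∑pick-0 (x ∷ xs) = trans (+-identityˡ _) (∑pick-0 xs)

  ∑pick-++ : ∀ {A : Set} (g : A → List A → Carrier) xs ys →
    ∑pick g (xs ++ ys) ≈ ∑pick (λ c rest → g c (rest ++ ys)) xs + ∑pick (λ c rest → g c (xs ++ rest)) ys
  ∑pick-++ g []       ys = sym (+-identityˡ _)
  ∑pick-++ g (x ∷ xs) ys = trans (+-congˡ (∑pick-++ _ xs ys)) (sym (+-assoc _ _ _))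

  ∑insertAll-snoc : ∀ {A : Set} (x y : A) (f : List A → Carrier) w →
    ∑ f (insertAll x (w ++ y ∷ [])) ≈ f (w ++ y ∷ x ∷ []) + ∑ (λ v → f (v ++ y ∷ [])) (insertAll x w)
  ∑insertAll-snoc x y f []      = solve 2 (λ a b → a :+ (b :+ :0) := b :+ (a :+ :0)) refl _ _
  ∑insertAll-snoc x y f (z ∷ w) = begin
    f (x ∷ z ∷ w ++ y ∷ []) + ∑ f (map (z ∷_) (insertAll x (w ++ y ∷ [])))
      ≈⟨ +-congˡ (trans (∑-map f (z ∷_) (insertAll x (w ++ y ∷ []))) (∑insertAll-snoc x y (f ∘ (z ∷_)) w)) ⟩
    f (x ∷ z ∷ w ++ y ∷ []) + (f (z ∷ w ++ y ∷ x ∷ []) + ∑ (λ v → f (z ∷ v ++ y ∷ [])) (insertAll x w))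
      ≈⟨ solve 3 (λ a b c → a :+ (b :+ c) := b :+ (a :+ c)) refl _ _ _ ⟩
    f (z ∷ w ++ y ∷ x ∷ []) + (f (x ∷ z ∷ w ++ y ∷ []) + ∑ (λ v → f (z ∷ v ++ y ∷ [])) (insertAll x w))
      ≈⟨ +-congˡ (+-congˡ (∑-map (λ v → f (v ++ y ∷ [])) (z ∷_) (insertAll x w))) ⟨
    f (z ∷ w ++ y ∷ x ∷ []) + (f (x ∷ z ∷ w ++ y ∷ []) + ∑ (λ v → f (v ++ y ∷ [])) (map (z ∷_) (insertAll x w))) ∎

  -- `perms` inserts the head `x` into the arrangements of the tail. Either `x` lands at the end, or
  -- it lands before the last entry `c`, and then the part in front of `c` is again an arrangement
  -- obtained by inserting `x`.
  ∑perms-snoc : ∀ {A : Set} (x : A) xs (f : List A → Carrier) →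
    ∑ f (perms (x ∷ xs)) ≈ ∑pick (λ c rest → ∑ (λ w → f (w ++ c ∷ [])) (perms rest)) (x ∷ xs)
  ∑perms-snoc x []       f = sym (+-identityʳ _)
  ∑perms-snoc x (y ∷ ys) f = begin
    ∑ f (concatMap (insertAll x) (perms (y ∷ ys)))
      ≈⟨ ∑-concatMap f (insertAll x) (perms (y ∷ ys)) ⟩
    ∑ (λ v → ∑ f (insertAll x v)) (perms (y ∷ ys))
      ≈⟨ ∑perms-snoc y ys (λ v → ∑ f (insertAll x v)) ⟩
    ∑pick (λ c rest → ∑ (λ w → ∑ f (insertAll x (w ++ c ∷ []))) (perms rest)) (y ∷ ys)
      ≈⟨ ∑pick-cong (y ∷ ys) (λ c rest → trans (∑-cong (perms rest) (∑insertAll-snoc x c f)) (∑-+ _ _ (perms rest))) ⟩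
    ∑pick (λ c rest → ∑ (λ w → f (w ++ c ∷ x ∷ [])) (perms rest) + ∑ (λ w → ∑ (λ v → f (v ++ c ∷ [])) (insertAll x w))
        (perms rest)) (y ∷ ys)
      ≈⟨ ∑pick-+ (λ c rest → ∑ (λ w → f (w ++ c ∷ x ∷ [])) (perms rest))
                 (λ c rest → ∑ (λ w → ∑ (λ v → f (v ++ c ∷ [])) (insertAll x w)) (perms rest)) (y ∷ ys) ⟩
    ∑pick (λ c rest → ∑ (λ w → f (w ++ c ∷ x ∷ [])) (perms rest)) (y ∷ ys)
      + ∑pick (λ c rest → ∑ (λ w → ∑ (λ v → f (v ++ c ∷ [])) (insertAll x w)) (perms rest)) (y ∷ ys)
      ≈⟨ +-cong (trans (∑pick-cong (y ∷ ys) (λ c rest → ∑-cong (perms rest)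
          (λ w → reflexive (≡.cong f (≡.sym (Listₚ.++-assoc w (c ∷ []) (x ∷ [])))))))
                       (sym (∑perms-snoc y ys (λ v → f (v ++ x ∷ [])))))
                (∑pick-cong (y ∷ ys) (λ c rest → sym (∑-concatMap (λ v → f (v ++ c ∷ [])) (insertAll x)
                    (perms rest)))) ⟩
    ∑pick (λ c rest → ∑ (λ w → f (w ++ c ∷ [])) (perms rest)) (x ∷ y ∷ ys) ∎

-- Splitting off the largest entry of a tableau

module Tableaux {c ℓ : Level} (R : CommutativeRing c ℓ) (w : Cell → CommutativeRing.Carrier R) where
  open RingFacts R
  open Sums R
  open Operators R
  open Steps w

  ∏ : List Cell → Carrier
  ∏ []       = 1#
  ∏ (x ∷ xs) = w x * ∏ xs

  ∑pick-∏ : ∀ (g : Cell → List Cell → Carrier) L → ∑pick g L * ∏ L ≈ ∑pick (λ c rest → g c rest * (w c * ∏ rest)) L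
  ∑pick-∏ g []       = zeroˡ _
  ∑pick-∏ g (x ∷ xs) = trans (distribʳ _ _ _) (+-congˡ (begin
    ∑pick g' xs * (w x * ∏ xs)                             ≈⟨ solve 3 (λ g w p → g :* (w :* p)
        := w :* (g :* p)) refl _ _ _ ⟩
    w x * (∑pick g' xs * ∏ xs)                             ≈⟨ *-congˡ (∑pick-∏ g' xs) ⟩
    w x * ∑pick (λ c rest → g' c rest * (w c * ∏ rest)) xs ≈⟨ ∑pick-* (w x) _ xs ⟨
    ∑pick (λ c rest → w x * (g' c rest * (w c * ∏ rest))) xs
        ≈⟨ ∑pick-cong xs (λ c rest → solve 4 (λ x g c p → x :* (g :* (c :* p)) := g :* (c :* (x :* p))) refl _ _ _ _) ⟩
    ∑pick (λ c rest → g' c rest * (w c * ∏ (x ∷ rest))) xs ∎))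
    where
    g' : Cell → List Cell → Carrier
    g' c rest = g c (x ∷ rest)

  maximal : Cell → List Cell → Bool
  maximal c = all (λ d → not (c ≼ᵇ d))

  module Fillings (base : List Cell) where

    -- The sign of a skew tableau, with `base` in the role of `T₀`; nonstandard fillings get 0, so
    -- that sums can run over all permutations.
    term : List Cell → Carrier
    term v = when (standard v) (sgn (inversions base) * sgn (inversions (base ++ v)))

    signedSum : List Cell → Carrier
    signedSum L = ∑ term (perms L)

    weightedSum : List Cell → Carrier
    weightedSum L = signedSum L * ∏ L

    weightedSum-[] : weightedSum [] ≈ 1#
    weightedSum-[] rewrite Listₚ.++-identityʳ base = trans (*-identityʳ _)
        (trans (+-identityʳ _) (sgn² (inversions base)))

    lastSign : Cell → List Cell → Carrier
    lastSign c rest = sgn (count (c ⊲ᵇ_) (base ++ rest))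

    -- The largest entry forms an inversion with each cell that follows it in reading order. Their
    -- number, like maximality, depends only on which other cells there are, and so leaves the sum
    -- over their arrangements.
    term-snoc : ∀ c rest v → v ↭ rest → term (v ++ c ∷ []) ≈ when (maximal c rest) (lastSign c rest) * term v
    term-snoc c rest v r
      rewrite standard-snoc v c
            | all-↭ (λ d → not (c ≼ᵇ d)) r
            | ≡.sym (Listₚ.++-assoc base v (c ∷ []))
            | inversions-snoc (base ++ v) c
            | count-↭ (c ⊲ᵇ_) (Permₚ.++⁺ˡ base r)
      with maximal c rest
    ... | false = sym (zeroˡ _)
    ... | true  = begin
      when (standard v) (a * sgn (k ℕ.+ m))
          ≈⟨ when-cong (standard v) (trans (*-congˡ (sgn-+ k m)) (solve 3 (λ a k m → a :* (k :* m)
          := k :* (a :* m)) refl _ _ _)) ⟩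
      when (standard v) (sgn k * (a * sgn m))    ≈⟨ when-* (standard v) _ _ ⟩
      sgn k * when (standard v) (a * sgn m)      ∎
      where
      a = sgn (inversions base)
      k = count (c ⊲ᵇ_) (base ++ rest)
      m = inversions (base ++ v)

    -- The product of the weights is the same for all fillings. Kept together with the signed sum,
    -- it loses exactly the factor of the peeled cell.
    peel : ∀ L → 0 ℕ.< length L →
      weightedSum L ≈ ∑pick (λ c rest → when (maximal c rest) (lastSign c rest * w c * weightedSum rest)) L
    peel (x ∷ xs) _ = begin
      ∑ term (perms (x ∷ xs)) * ∏ (x ∷ xs)
        ≈⟨ *-congʳ (∑perms-snoc x xs term) ⟩
      ∑pick (λ c rest → ∑ (λ v → term (v ++ c ∷ [])) (perms rest)) (x ∷ xs) * ∏ (x ∷ xs)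
        ≈⟨ *-congʳ (∑pick-cong (x ∷ xs) (λ c rest → trans (∑-cong-All (perms-↭ rest) (term-snoc c rest))
            (∑-* _ term (perms rest)))) ⟩
      ∑pick (λ c rest → when (maximal c rest) (lastSign c rest) * signedSum rest) (x ∷ xs) * ∏ (x ∷ xs)
        ≈⟨ ∑pick-∏ (λ c rest → when (maximal c rest) (lastSign c rest) * signedSum rest) (x ∷ xs) ⟩
      ∑pick (λ c rest → when (maximal c rest) (lastSign c rest) * signedSum rest * (w c * ∏ rest)) (x ∷ xs)
        ≈⟨ ∑pick-cong (x ∷ xs) (λ c rest → collect (maximal c rest) (lastSign c rest) (signedSum rest) (w c) (∏ rest)) ⟩
      ∑pick (λ c rest → when (maximal c rest) (lastSign c rest * w c * weightedSum rest)) (x ∷ xs) ∎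
      where
      collect : ∀ b s t w p → when b s * t * (w * p) ≈ when b (s * w * (t * p))
      collect true  s t w p = solve 4 (λ s t w p → s :* t :* (w :* p) := s :* w :* (t :* p)) refl s t w p
      collect false s t w p = trans (*-congʳ (zeroˡ _)) (zeroˡ _)

  notAbove : ∀ {i c d} → proj₁ c ℕ.≤ i → suc i ℕ.≤ proj₁ d → not (d ≼ᵇ c) ≡ true
  notAbove c≤i i<d rewrite ≤ᵇ-false (ℕₚ.≤-<-trans c≤i i<d) = ≡.refl

  ⊲-below : ∀ {c d : Cell} → proj₁ c ℕ.< proj₁ d → (c ⊲ᵇ d) ≡ true
  ⊲-below c<d rewrite <ᵇ-true c<d = ≡.refl

  ⊲-above : ∀ {c d : Cell} → proj₁ d ℕ.< proj₁ c → (c ⊲ᵇ d) ≡ false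
  ⊲-above {c} {d} d<c rewrite <ᵇ-false (ℕₚ.<⇒≤ d<c) | ≡ᵇ-false (λ e → ℕₚ.<⇒≢ d<c (≡.sym e)) = ≡.refl

  ⊲-left : ∀ {i l d} → InRow i l d → ((i , suc l) ⊲ᵇ d) ≡ false
  ⊲-left {i} {l} {i' , j} (≡.refl , j≤l) rewrite <ᵇ-false {i} {i} ℕₚ.≤-refl | ≡ᵇ-refl i = <ᵇ-false (ℕₚ.m≤n⇒m≤1+n j≤l)

  -- Lower rows reach column `suc l` only if the next one does. In that case the cell directly below
  -- is an obstruction, and it lies in the skew shape because of `hd μ ≤ l`.
  maximal-corner : ∀ i l μ λ' → Dec (just (suc l)) λ' → hd μ ℕ.≤ l → sub μ λ' ≡ true →
    maximal (i , suc l) (cellsFrom (suc i) μ λ') ≡ (hd λ' <ᵇ suc l)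
  maximal-corner i l μ []       D m≤l s = ≡.refl
  maximal-corner i l μ (q ∷ λ') (q≤ , D) m≤l s with ℕₚ.m≤n⇒m<n∨m≡n q≤
  ... | inj₁ q<l = ≡.trans
    (all-true (All.map short (cellsFrom-right (suc i) μ (q ∷ λ') {q} (ℕₚ.≤-refl , D) s)))
    (≡.sym (<ᵇ-true q<l))
    where
    short : ∀ {d} → proj₂ d ℕ.≤ q → not ((i , suc l) ≼ᵇ d) ≡ true
    short {i' , j} j≤q rewrite ≤ᵇ-false (ℕₚ.≤-<-trans j≤q q<l) = ≡.cong not (𝔹ₚ.∧-zeroʳ (i ≤ᵇ i'))
  ... | inj₂ ≡.refl
    rewrite rowCells-suc (suc i) m≤l | <ᵇ-false {suc l} {suc l} ℕₚ.≤-refl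
          | Listₚ.++-assoc (rowCells (suc i) (hd μ) l) ((suc i , suc l) ∷ []) (cellsFrom (suc (suc i)) (tl μ) λ')
          | all-++ (λ d → not ((i , suc l) ≼ᵇ d)) (rowCells (suc i) (hd μ) l) ((suc i , suc l) ∷ cellsFrom (suc (suc i))
              (tl μ) λ')
          | ≤ᵇ-true (ℕₚ.n≤1+n i) | ≤ᵇ-true (ℕₚ.≤-refl {suc l}) = 𝔹ₚ.∧-zeroʳ _

  -- In the order of the cell list, only the last cell of a row that is strictly longer than the next
  -- one can carry the largest entry.
  peel-corners : ∀ i μ λ' (K : Cell → List Cell → Carrier) (h : List Cell → Carrier) {cap cap'} →
    Dec cap μ → Dec cap' λ' → length μ ℕ.≤ length λ' → sub μ λ' ≡ true →
    (∀ i' j rest → i ℕ.≤ i' → K (i' , j) rest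
        ≈ sgn (count ((i' , j) ⊲ᵇ_) (cellsFrom i [] μ) ℕ.+ count ((i' , j) ⊲ᵇ_) rest) * w (i' , j) * h rest) →
    ∑pick (λ c rest → when (maximal c rest) (K c rest)) (cellsFrom i μ λ')
        ≈ d i (λ λ'' → when (sub μ λ'') (h (cellsFrom i μ λ''))) λ'
  peel-corners i μ []       K h Dμ Dλ len s K≈ = refl
  peel-corners i μ (l ∷ λ') K h Dμ (_ , Dλ) len s K≈ = begin
    ∑pick G (rowCells i (hd μ) l ++ B)
      ≈⟨ ∑pick-++ G (rowCells i (hd μ) l) B ⟩
    ∑pick (λ c rest → G c (rest ++ B)) (rowCells i (hd μ) l) + ∑pick (λ c rest → G c (rowCells i (hd μ) l ++ rest)) B
      ≈⟨ +-cong (row l (≤ᵇ⇒≤ {hd μ} m≤l) Dλ) lower ⟩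
    when (hd λ' <ᵇ l) (w (i , l) * sgn (size λ') * when (sub μ (pred l ∷ λ')) (h (cellsFrom i μ (pred l ∷ λ'))))
      + d (suc i) (λ λ'' → when (sub μ (l ∷ λ'')) (h (cellsFrom i μ (l ∷ λ'')))) λ' ∎
    where
    B = cellsFrom (suc i) (tl μ) λ'
    G : Cell → List Cell → Carrier
    G c rest = when (maximal c rest) (K c rest)
    s' = proj₂ (∧-true {hd μ ≤ᵇ l} s)
    m≤l = proj₁ (∧-true {hd μ ≤ᵇ l} s)

    upper-count : ∀ i' j → suc i ℕ.≤ i' → count ((i' , j) ⊲ᵇ_) (cellsFrom i [] μ)
        ≡ count ((i' , j) ⊲ᵇ_) (cellsFrom (suc i) [] (tl μ))
    upper-count i' j i<i' = split μ
      where
      split : ∀ μ → count ((i' , j) ⊲ᵇ_) (cellsFrom i [] μ) ≡ count ((i' , j) ⊲ᵇ_) (cellsFrom (suc i) [] (tl μ))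
      split []      = ≡.refl
      split (m ∷ μ) = ≡.trans (count-++ ((i' , j) ⊲ᵇ_) (rowCells i 0 m) (cellsFrom (suc i) [] μ))
        (≡.cong (ℕ._+ count ((i' , j) ⊲ᵇ_) (cellsFrom (suc i) [] μ))
            (count-none (All.map above (rowCells-InRow i 0 m z≤n))))
        where
        above : ∀ {d} → InRow i m d → ((i' , j) ⊲ᵇ d) ≡ false
        above {d} (≡.refl , _) = ⊲-above {i' , j} {d} i<i'

    lower : ∑pick (λ c rest → G c (rowCells i (hd μ) l ++ rest)) B
              ≈ d (suc i) (λ λ'' → when (sub μ (l ∷ λ'')) (h (cellsFrom i μ (l ∷ λ'')))) λ'
    lower = begin
      ∑pick (λ c rest → G c (rowCells i (hd μ) l ++ rest)) B
        ≈⟨ ∑pick-cong-All (cellsFrom-below (suc i) (tl μ) λ') (λ c rest i<c → reflexive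
            (≡.cong (λ b → when b (K c (rowCells i (hd μ) l ++ rest)))
             (≡.trans (all-++ (λ d → not (c ≼ᵇ d)) (rowCells i (hd μ) l) rest)
                      (≡.cong (_∧ maximal c rest) (all-true
                          (All.map (λ { {d} (≡.refl , _) → notAbove {i} {d} {c} ℕₚ.≤-refl i<c })
                          (rowCells-InRow i (hd μ) l (≤ᵇ⇒≤ {hd μ} m≤l)))))))) ⟩
      ∑pick (λ c rest → when (maximal c rest) (K c (rowCells i (hd μ) l ++ rest))) B
        -- `K` and `h` are arbitrary so that here they can absorb the cells of the row just passed.
        ≈⟨ peel-corners (suc i) (tl μ) λ' (λ c rest → K c (rowCells i (hd μ) l ++ rest))
            (λ rest → h (rowCells i (hd μ) l ++ rest))
             (Dec-tl μ Dμ) Dλ (length-tl μ len) s' K'≈ ⟩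
      d (suc i) (λ λ'' → when (sub (tl μ) λ'') (h (cellsFrom i μ (l ∷ λ'')))) λ'
        ≈⟨ d-cong (suc i) λ' (λ λ'' → reflexive (≡.cong (λ b → when (b ∧ sub (tl μ) λ'') (h (cellsFrom i μ (l ∷ λ''))))
            (≡.sym m≤l))) ⟩
      d (suc i) (λ λ'' → when (sub μ (l ∷ λ'')) (h (cellsFrom i μ (l ∷ λ'')))) λ' ∎
      where
      K'≈ : ∀ i' j rest → suc i ℕ.≤ i' → K (i' , j) (rowCells i (hd μ) l ++ rest)
        ≈ sgn (count ((i' , j) ⊲ᵇ_) (cellsFrom (suc i) [] (tl μ)) ℕ.+ count ((i' , j) ⊲ᵇ_) rest) * w (i' , j) * h
            (rowCells i (hd μ) l ++ rest)
      K'≈ i' j rest i<i' = trans (K≈ i' j _ (ℕₚ.<⇒≤ i<i'))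
          (reflexive (≡.cong (λ n → sgn n * w (i' , j) * h (rowCells i (hd μ) l ++ rest))
        (≡.cong₂ ℕ._+_ (upper-count i' j i<i')
          (≡.trans (count-++ ((i' , j) ⊲ᵇ_) (rowCells i (hd μ) l) rest)
            (≡.cong (ℕ._+ count ((i' , j) ⊲ᵇ_) rest)
                (count-none (All.map (λ { {d} (≡.refl , _) → ⊲-above {i' , j} {d} i<i' }) (rowCells-InRow i (hd μ) l
                (≤ᵇ⇒≤ {hd μ} m≤l)))))))))

    row : ∀ l → hd μ ℕ.≤ l → Dec (just l) λ' →
      ∑pick (λ c rest → G c (rest ++ B)) (rowCells i (hd μ) l)
        ≈ when (hd λ' <ᵇ l) (w (i , l) * sgn (size λ') * when (sub μ (pred l ∷ λ')) (h (cellsFrom i μ (pred l ∷ λ'))))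
    row l m≤l Dλ with ℕₚ.m≤n⇒m<n∨m≡n m≤l
    row zero m≤l Dλ | inj₂ m≡l rewrite m≡l = refl
    -- This row has no cells in the skew shape, and shortening it would destroy containment, so both
    -- sides vanish.
    row (suc l) _ Dλ | inj₂ m≡l rewrite m≡l | rowCells-empty i (suc l) | ≤ᵇ-false (ℕₚ.n<1+n l) =
      sym (trans (when-cong (hd λ' <ᵇ suc l) (zeroʳ _)) (when-0 (hd λ' <ᵇ suc l)))
    row (suc l) _ Dλ | inj₁ (s≤s m≤l) rewrite rowCells-suc i m≤l = begin
      ∑pick (λ c rest → G c (rest ++ B)) (A ++ c₀ ∷ [])
        ≈⟨ ∑pick-++ (λ c rest → G c (rest ++ B)) A (c₀ ∷ []) ⟩
      ∑pick (λ c rest → G c ((rest ++ c₀ ∷ []) ++ B)) A + (G c₀ ((A ++ []) ++ B) + 0#)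
        ≈⟨ +-cong (trans (∑pick-cong-All (rowCells-InRow i (hd μ) l m≤l) (λ c rest inRow → reflexive
            (≡.cong (λ b → when b (K c ((rest ++ c₀ ∷ []) ++ B))) (blocked c rest inRow))))
                         (∑pick-0 A))
                  (trans (+-identityʳ _) (reflexive (≡.cong (λ A → G c₀ (A ++ B)) (Listₚ.++-identityʳ A)))) ⟩
      0# + G c₀ (A ++ B)
        ≈⟨ +-identityˡ _ ⟩
      when (maximal c₀ (A ++ B)) (K c₀ (A ++ B))
        ≈⟨ reflexive (≡.cong (λ b → when b (K c₀ (A ++ B))) corner) ⟩
      when (hd λ' <ᵇ suc l) (K c₀ (A ++ B))
        ≈⟨ when-cong (hd λ' <ᵇ suc l) (begin
             K c₀ (A ++ B) ≈⟨ K≈ i (suc l) (A ++ B) ℕₚ.≤-refl ⟩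
             sgn (count (c₀ ⊲ᵇ_) (cellsFrom i [] μ) ℕ.+ count (c₀ ⊲ᵇ_) (A ++ B)) * w c₀ * h (A ++ B)
               ≈⟨ *-congʳ (trans (*-comm _ _) (*-congˡ (reflexive (≡.cong sgn cellsBelow)))) ⟩
             w c₀ * sgn (size λ') * h (A ++ B)
               ≈⟨ *-congˡ (reflexive (≡.cong (λ b → when b (h (A ++ B))) (≡.sym sub-pred))) ⟩
             w c₀ * sgn (size λ') * when (sub μ (l ∷ λ')) (h (A ++ B)) ∎) ⟩
      when (hd λ' <ᵇ suc l) (w c₀ * sgn (size λ') * when (sub μ (l ∷ λ')) (h (A ++ B))) ∎
      where
      A = rowCells i (hd μ) l
      c₀ : Cell
      c₀ = (i , suc l)
      sub-pred : sub μ (l ∷ λ') ≡ true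
      sub-pred rewrite ≤ᵇ-true m≤l = s'
      blocked : ∀ c rest → InRow i l c → maximal c ((rest ++ c₀ ∷ []) ++ B) ≡ false
      blocked (i' , j) rest (≡.refl , j≤l) rewrite Listₚ.++-assoc rest (c₀ ∷ []) B | all-++ (λ d → not ((i , j) ≼ᵇ d))
          rest (c₀ ∷ B)
        | ≤ᵇ-true (ℕₚ.≤-refl {i}) | ≤ᵇ-true (ℕₚ.m≤n⇒m≤1+n j≤l) = 𝔹ₚ.∧-zeroʳ _
      corner : maximal c₀ (A ++ B) ≡ (hd λ' <ᵇ suc l)
      corner = ≡.trans (all-++ (λ d → not (c₀ ≼ᵇ d)) A B) (≡.cong₂ _∧_
        (all-true (All.map notLeft (rowCells-InRow i (hd μ) l m≤l)))
        (maximal-corner i l (tl μ) λ' Dλ (ℕₚ.≤-trans (Dec-hd (tl μ) (Dec-tl μ Dμ)) m≤l) s'))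
        where
        notLeft : ∀ {d} → InRow i l d → not (c₀ ≼ᵇ d) ≡ true
        notLeft {i' , j} (_ , j≤l) rewrite ≤ᵇ-false (s≤s j≤l) = ≡.cong not (𝔹ₚ.∧-zeroʳ (i ≤ᵇ i'))
      -- The sign of a skew tableau is computed on the whole shape, so cells of `μ` count as well:
      -- the lower rows of `μ` and of the skew shape together make up `λ'`, which gives the sign
      -- used in `d`.
      cellsBelow : count (c₀ ⊲ᵇ_) (cellsFrom i [] μ) ℕ.+ count (c₀ ⊲ᵇ_) (A ++ B) ≡ size λ'
      cellsBelow = ≡.trans (≡.cong₂ ℕ._+_ (straight μ m≤l)
        (≡.trans (count-++ (c₀ ⊲ᵇ_) A B) (≡.cong₂ ℕ._+_ (count-none (All.map ⊲-left (rowCells-InRow i (hd μ) l m≤l)))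
          (count-all (All.map (λ {d} → ⊲-below {c₀} {d}) (cellsFrom-below (suc i) (tl μ) λ'))))))
        (length-cellsFrom (suc i) (tl μ) λ' (length-tl μ len) s')
        where
        straight : ∀ μ → hd μ ℕ.≤ l → count (c₀ ⊲ᵇ_) (cellsFrom i [] μ) ≡ size (tl μ)
        straight []      _   = ≡.refl
        straight (m ∷ μ) m≤l = ≡.trans (count-++ (c₀ ⊲ᵇ_) (rowCells i 0 m) (cellsFrom (suc i) [] μ)) (≡.cong₂ ℕ._+_
          (count-none (All.map (λ { {d} (e , j≤m) → ⊲-left {i} {l} {d} (e , ℕₚ.≤-trans j≤m m≤l) })
              (rowCells-InRow i 0 m z≤n)))
          (≡.trans (count-all (All.map (λ {d} → ⊲-below {c₀} {d}) (cellsFrom-below (suc i) [] μ)))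
              (length-straight (suc i) μ)))

-- μ and λ agree up to trailing zeros, for length μ ≤ length λ.
agree : List ℕ → List ℕ → Bool
agree μ []       = true
agree μ (l ∷ λ') = (hd μ ≡ᵇ l) ∧ agree (tl μ) λ'

sub⇒size≤ : ∀ μ λ' → length μ ℕ.≤ length λ' → sub μ λ' ≡ true → size μ ℕ.≤ size λ'
sub⇒size≤ μ λ' len s = ℕₚ.≤-trans (ℕₚ.m≤m+n (size μ) _) (ℕₚ.≤-reflexive (length-cellsFrom 1 μ λ' len s))

agree⇒sub : ∀ μ λ' → agree μ λ' ≡ true → sub μ λ' ≡ true
agree⇒sub μ []       _ = ≡.refl
agree⇒sub μ (l ∷ λ') a with e , a' ← ∧-true {hd μ ≡ᵇ l} a
  rewrite ≤ᵇ-true (ℕₚ.≤-reflexive (≡ᵇ⇒≡ {hd μ} {l} e)) = agree⇒sub (tl μ) λ' a'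

agree⇒size : ∀ μ λ' → length μ ℕ.≤ length λ' → agree μ λ' ≡ true → size λ' ≡ size μ
agree⇒size [] []       _ _ = ≡.refl
agree⇒size μ  (l ∷ λ') len a with e , a' ← ∧-true {hd μ ≡ᵇ l} a =
  ≡.trans (≡.cong₂ ℕ._+_ (≡.sym (≡ᵇ⇒≡ {hd μ} {l} e)) (agree⇒size (tl μ) λ' (length-tl μ len) a')) (size-tl μ)

sub∧size⇒agree : ∀ μ λ' → length μ ℕ.≤ length λ' → sub μ λ' ≡ true → size λ' ≡ size μ → agree μ λ' ≡ true
sub∧size⇒agree μ []       len s e = ≡.refl
sub∧size⇒agree μ (l ∷ λ') len s e with m≤l , s' ← ∧-true {hd μ ≤ᵇ l} s
  rewrite ≡.sym (size-tl μ) = ≡.cong₂ _∧_ (T→≡ (ℕₚ.≡⇒≡ᵇ (hd μ) l hd≡)) (sub∧size⇒agree (tl μ) λ' (length-tl μ len) s'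
      size≡)
  where
  hd≤ : hd μ ℕ.≤ l
  hd≤ = ≤ᵇ⇒≤ {hd μ} m≤l
  size≤ : size (tl μ) ℕ.≤ size λ'
  size≤ = sub⇒size≤ (tl μ) λ' (length-tl μ len) s'
  hd≡ : hd μ ≡ l
  hd≡ = ℕₚ.≤-antisym hd≤ (ℕₚ.+-cancelʳ-≤ (size λ') l (hd μ) (ℕₚ.≤-trans (ℕₚ.≤-reflexive e) (ℕₚ.+-monoʳ-≤ (hd μ) size≤)))
  size≡ : size λ' ≡ size (tl μ)
  size≡ = ℕₚ.+-cancelˡ-≡ (hd μ) (size λ') (size (tl μ)) (≡.trans (≡.cong (ℕ._+ size λ') hd≡) e)

agree≡ : ∀ μ λ' → length μ ℕ.≤ length λ' → (size λ' ≡ᵇ size μ) ∧ sub μ λ' ≡ agree μ λ'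
agree≡ μ λ' len = go _ _ _ ≡.refl ≡.refl ≡.refl
  where
  go : ∀ a b c → (size λ' ≡ᵇ size μ) ≡ a → sub μ λ' ≡ b → agree μ λ' ≡ c → a ∧ b ≡ c
  go true  true  c     e s g = ≡.sym (≡.trans (≡.sym g) (sub∧size⇒agree μ λ' len s (≡ᵇ⇒≡ {size λ'} e)))
  go true  false false e s g = ≡.refl
  go true  false true  e s g = ≡.trans (≡.sym s) (agree⇒sub μ λ' g)
  go false b     false e s g = ≡.refl
  go false b     true  e s g = ≡.trans (≡.sym e) (T→≡ (ℕₚ.≡⇒≡ᵇ (size λ') (size μ) (agree⇒size μ λ' len g)))

≡ᵇ-sym : ∀ m n → (m ≡ᵇ n) ≡ (n ≡ᵇ m)
≡ᵇ-sym zero    zero    = ≡.refl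
≡ᵇ-sym zero    (suc n) = ≡.refl
≡ᵇ-sym (suc m) zero    = ≡.refl
≡ᵇ-sym (suc m) (suc n) = ≡ᵇ-sym m n

zeros : ℕ → List ℕ
zeros k = replicate k 0

padTo : ℕ → List ℕ → List ℕ
padTo zero    μ = []
padTo (suc L) μ = hd μ ∷ padTo L (tl μ)

padTo-zeros : ∀ α k → padTo (length α ℕ.+ k) α ≡ α ++ zeros k
padTo-zeros []      zero    = ≡.refl
padTo-zeros []      (suc k) = ≡.cong (0 ∷_) (padTo-zeros [] k)
padTo-zeros (q ∷ α) k       = ≡.cong (q ∷_) (padTo-zeros α k)

-- Sums over shapes, and the adjointness of adding and removing cells

module Shapes {c ℓ : Level} (R : CommutativeRing c ℓ) (w : Cell → CommutativeRing.Carrier R) where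
  open RingFacts R
  open Sums R
  open Operators R
  open Steps w
  open Tableaux R w

  𝟙 : List ℕ → Carrier
  𝟙 _ = 1#

  weightedTableaux : List ℕ → List ℕ → Carrier
  weightedTableaux μ λ' = Fillings.weightedSum (cellsFrom 1 [] μ) (cellsFrom 1 μ λ')

  tableaux : List ℕ → List ℕ → Carrier
  tableaux μ λ' = when (sub μ λ') (weightedTableaux μ λ')

  -- Removing a cell cannot create containment.
  d-sub-0 : ∀ i μ λ' (h : List ℕ → Carrier) → sub μ λ' ≡ false → d i (λ λ'' → when (sub μ λ'') (h λ'')) λ' ≈ 0#
  d-sub-0 i μ (l ∷ λ') h s = trans (+-cong
    (trans (when-cong (hd λ' <ᵇ l) (trans (*-congˡ (reflexive (≡.cong (λ b → when b (h (pred l ∷ λ'))) (shrink s))))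
        (zeroʳ _))) (when-0 (hd λ' <ᵇ l)))
    (tail _ ≡.refl)) (+-identityˡ 0#)
    where
    shrink : (hd μ ≤ᵇ l) ∧ sub (tl μ) λ' ≡ false → (hd μ ≤ᵇ pred l) ∧ sub (tl μ) λ' ≡ false
    shrink s with hd μ ≤ᵇ pred l in eq
    ... | false = ≡.refl
    ... | true rewrite ≤ᵇ-true (ℕₚ.≤-trans (≤ᵇ⇒≤ {hd μ} {pred l} eq) (ℕₚ.pred[n]≤n {l})) = s
    tail : ∀ b → (hd μ ≤ᵇ l) ≡ b → d (suc i) (λ λ'' → when ((hd μ ≤ᵇ l) ∧ sub (tl μ) λ'') (h (l ∷ λ''))) λ' ≈ 0#
    tail false e rewrite e = d-0 (suc i) λ'
    tail true  e rewrite e = d-sub-0 (suc i) (tl μ) λ' (h ∘ (l ∷_)) s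

  tableaux-step : ∀ μ λ' → Dec nothing μ → Dec nothing λ' → length μ ℕ.≤ length λ' → size μ ℕ.< size λ' →
    tableaux μ λ' ≈ d 1 (tableaux μ) λ'
  tableaux-step μ λ' Dμ Dλ len lt with sub μ λ' in s
  ... | false = sym (d-sub-0 1 μ λ' _ s)
  ... | true  = trans (peel (cellsFrom 1 μ λ') nonempty)
    (peel-corners 1 μ λ' (λ c rest → lastSign c rest * w c * weightedSum rest) weightedSum Dμ Dλ len s
      (λ i' j rest _ → reflexive (≡.cong (λ n → sgn n * w (i' , j) * weightedSum rest) (count-++ ((i' , j) ⊲ᵇ_)
          (cellsFrom 1 [] μ) rest))))
    where
    open Fillings (cellsFrom 1 [] μ)
    nonempty : 0 ℕ.< length (cellsFrom 1 μ λ')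
    nonempty = ℕₚ.+-cancelˡ-< (size μ) 0 _ (≡.subst₂ ℕ._<_ (≡.sym (ℕₚ.+-identityʳ (size μ)))
        (≡.sym (length-cellsFrom 1 μ λ' len s)) lt)

  δ : List ℕ → List ℕ → Carrier
  δ μ λ' = when (agree μ λ') 1#

  -- Each application of `d 1` splits off one entry, until only `μ` with its empty tableau of weight
  -- 1 is left. The size guard ensures that there is an entry to split off.
  tableaux-iterate : ∀ m μ λ' → Dec nothing μ → Dec nothing λ' → length μ ℕ.≤ length λ' →
    when (size λ' ≡ᵇ m ℕ.+ size μ) (tableaux μ λ') ≈ iterate (d 1) m (δ μ) λ'
  tableaux-iterate zero μ λ' Dμ Dλ len = begin
    when (size λ' ≡ᵇ size μ) (when (sub μ λ') (weightedTableaux μ λ')) ≈⟨ when-∧ (size λ' ≡ᵇ size μ) (sub μ λ') _ ⟨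
    when ((size λ' ≡ᵇ size μ) ∧ sub μ λ') (weightedTableaux μ λ')
        ≈⟨ reflexive (≡.cong (λ b → when b (weightedTableaux μ λ')) (agree≡ μ λ' len)) ⟩
    when (agree μ λ') (weightedTableaux μ λ')                          ≈⟨ empty _ ≡.refl ⟩
    when (agree μ λ') 1#                                               ∎
    where
    noCells : agree μ λ' ≡ true → length (cellsFrom 1 μ λ') ≡ 0
    noCells a = ℕₚ.+-cancelˡ-≡ (size μ) _ 0 (≡.trans (length-cellsFrom 1 μ λ' len (agree⇒sub μ λ' a))
      (≡.trans (agree⇒size μ λ' len a) (≡.sym (ℕₚ.+-identityʳ (size μ)))))
    empty : ∀ b → agree μ λ' ≡ b → when b (weightedTableaux μ λ') ≈ when b 1#
    empty false _ = refl
    empty true  a with cellsFrom 1 μ λ' | noCells a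
    ... | [] | _ = Fillings.weightedSum-[] (cellsFrom 1 [] μ)
  tableaux-iterate (suc m) μ λ' Dμ Dλ len = begin
    when (size λ' ≡ᵇ suc m ℕ.+ size μ) (tableaux μ λ')                    ≈⟨ step _ ≡.refl ⟩
    when (size λ' ≡ᵇ suc m ℕ.+ size μ) (d 1 (tableaux μ) λ')
        ≈⟨ d-size 1 (λ n → n ≡ᵇ suc m ℕ.+ size μ) (tableaux μ) λ' ⟨
    d 1 (λ λ'' → when (size λ'' ≡ᵇ m ℕ.+ size μ) (tableaux μ λ'')) λ'
        ≈⟨ d-cong-shape 1 λ' Dλ (λ λ'' D e → tableaux-iterate m μ λ'' Dμ D
        (ℕₚ.≤-trans len (ℕₚ.≤-reflexive (≡.sym e)))) ⟩
    d 1 (iterate (d 1) m (δ μ)) λ'                                        ∎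
    where
    step : ∀ b → (size λ' ≡ᵇ suc m ℕ.+ size μ) ≡ b → when b (tableaux μ λ') ≈ when b (d 1 (tableaux μ) λ')
    step false _ = refl
    step true  e = tableaux-step μ λ' Dμ Dλ len (ℕₚ.≤-trans (s≤s (ℕₚ.m≤n+m (size μ) m))
        (ℕₚ.≤-reflexive (≡.sym (≡ᵇ⇒≡ {size λ'} e))))

  -- The sum over the partitions inside a box of `L` rows and `p` columns, organised by rows.
  ∑dec : ℕ → ℕ → (List ℕ → Carrier) → Carrier
  ∑dec zero    p h = h []
  ∑dec (suc L) p h = ∑< (λ q → ∑dec L q (h ∘ (q ∷_))) (suc p)

  ∑dec-cong : ∀ L p {f g} → (∀ l → Dec (just p) l → length l ≡ L → f l ≈ g l) → ∑dec L p f ≈ ∑dec L p g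
  ∑dec-cong zero    p f≈g = f≈g [] tt ≡.refl
  ∑dec-cong (suc L) p f≈g = ∑<-cong (suc p)
      (λ { q (s≤s q≤p) → ∑dec-cong L q (λ l D e → f≈g (q ∷ l) (q≤p , D) (≡.cong suc e)) })

  ∑dec-cong′ : ∀ L p {f g} → (∀ l → f l ≈ g l) → ∑dec L p f ≈ ∑dec L p g
  ∑dec-cong′ L p f≈g = ∑dec-cong L p (λ l _ _ → f≈g l)

  ∑dec-+ : ∀ L p f g → ∑dec L p (λ l → f l + g l) ≈ ∑dec L p f + ∑dec L p g
  ∑dec-+ zero    p f g = refl
  ∑dec-+ (suc L) p f g = trans (∑<-cong (suc p) (λ q _ → ∑dec-+ L q (f ∘ (q ∷_)) (g ∘ (q ∷_))))
    (∑<-+ (suc p) (λ q → ∑dec L q (f ∘ (q ∷_))) (λ q → ∑dec L q (g ∘ (q ∷_))))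

  ∑dec-* : ∀ L p k f → ∑dec L p (λ l → k * f l) ≈ k * ∑dec L p f
  ∑dec-* zero    p k f = refl
  ∑dec-* (suc L) p k f = trans (∑<-cong (suc p) (λ q _ → ∑dec-* L q k (f ∘ (q ∷_))))
      (∑<-* (suc p) k (λ q → ∑dec L q (f ∘ (q ∷_))))

  ∑dec-0 : ∀ L p → ∑dec L p (λ _ → 0#) ≈ 0#
  ∑dec-0 L p = trans (∑dec-cong′ L p (λ _ → sym (zeroˡ 0#))) (trans (∑dec-* L p 0# (λ _ → 0#)) (zeroˡ _))

  ∑dec-when : ∀ L p b f → ∑dec L p (λ l → when b (f l)) ≈ when b (∑dec L p f)
  ∑dec-when L p true  f = refl
  ∑dec-when L p false f = ∑dec-0 L p

  ∑dec-lower : ∀ L q X → ∑dec L (suc q) (λ l → when (hd l <ᵇ suc q) (X l)) ≈ ∑dec L q X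
  ∑dec-lower zero    q X = refl
  ∑dec-lower (suc L) q X = trans (∑<-cong (suc (suc q)) (λ r _ → ∑dec-when L r (r <ᵇ suc q) (X ∘ (r ∷_))))
      (∑<-restrict {suc q} {suc (suc q)} (λ r → ∑dec L r (X ∘ (r ∷_))) (ℕₚ.n≤1+n _))

  ∑-boxLists-suc : ∀ L B F → ∑ F (boxLists (suc L) B) ≈ ∑< (λ p → ∑ (F ∘ (p ∷_)) (boxLists L B)) (suc B)
  ∑-boxLists-suc L B F = trans (∑-concatMap F (λ p → map (p ∷_) (boxLists L B)) (upTo (suc B)))
    (trans (∑-cong (upTo (suc B)) (λ p → ∑-map F (p ∷_) (boxLists L B))) (∑<-upTo _ (suc B)))

  ∑-boxLists : ∀ L B h → ∑ (λ l → when (decreasingᵇ l) (h l)) (boxLists L B) ≈ ∑dec L B h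
  ∑-boxLists zero    B h = +-identityʳ _
  ∑-boxLists (suc L) B h = trans (∑-boxLists-suc L B _) (∑<-cong (suc B) (λ { p (s≤s p≤B) → below L p≤B (h ∘ (p ∷_)) }))
    where
    ≤ᵇ≡<ᵇ : ∀ q p → (q ≤ᵇ p) ≡ (q <ᵇ suc p)
    ≤ᵇ≡<ᵇ zero    p = ≡.refl
    ≤ᵇ≡<ᵇ (suc q) p = ≡.refl
    below : ∀ L {p} → p ℕ.≤ B → ∀ h → ∑ (λ l → when (decreasingᵇ (p ∷ l)) (h l)) (boxLists L B) ≈ ∑dec L p h
    below zero    p≤B h = +-identityʳ _
    below (suc L) {p} p≤B h = begin
      ∑ (λ l → when (decreasingᵇ (p ∷ l)) (h l)) (boxLists (suc L) B)
        ≈⟨ ∑-boxLists-suc L B _ ⟩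
      ∑< (λ q → ∑ (λ l → when ((q ≤ᵇ p) ∧ decreasingᵇ (q ∷ l)) (h (q ∷ l))) (boxLists L B)) (suc B)
        ≈⟨ ∑<-cong (suc B) (λ q q<B → trans (∑-cong (boxLists L B) (λ l → when-∧ (q ≤ᵇ p) (decreasingᵇ (q ∷ l))
            (h (q ∷ l))))
             (trans (∑-when (q ≤ᵇ p) (λ l → when (decreasingᵇ (q ∷ l)) (h (q ∷ l))) (boxLists L B))
             (trans (reflexive (≡.cong (λ b → when b (∑ (λ l → when (decreasingᵇ (q ∷ l)) (h (q ∷ l))) (boxLists L B)))
                 (≤ᵇ≡<ᵇ q p))) (when-cong (q <ᵇ suc p) (below L (ℕₚ.≤-pred q<B) (h ∘ (q ∷_))))))) ⟩
      ∑< (λ q → when (q <ᵇ suc p) (∑dec L q (h ∘ (q ∷_)))) (suc B)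
        ≈⟨ ∑<-restrict {suc p} {suc B} (λ q → ∑dec L q (h ∘ (q ∷_))) (s≤s p≤B) ⟩
      ∑dec (suc L) p h ∎

  -- Both sides sum over pairs of shapes in the box that differ by one cell; shifting the length of
  -- the affected row by one turns removals into additions. Staying in the box means creating no row
  -- and respecting the cap `p`.
  adjoint : ∀ L i p f g → ∑dec L p (λ l → f l * d i g l) ≈ ∑dec L p (λ l → u false i (just p) f l * g l)
  adjoint zero    i p f g = trans (zeroʳ _) (sym (zeroˡ _))
  adjoint (suc L) i p f g = begin
    ∑< (λ q → ∑dec L q (λ l → f (q ∷ l) * (when (hd l <ᵇ q) (w (i , q) * sgn (size l) * g (pred q ∷ l)) + d (suc i)
        (g ∘ (q ∷_)) l))) (suc p)
      ≈⟨ ∑<-cong (suc p) (λ q _ → ∑dec-cong′ L q (λ l → distribˡ (f (q ∷ l))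
          (when (hd l <ᵇ q) (w (i , q) * sgn (size l) * g (pred q ∷ l))) (d (suc i) (g ∘ (q ∷_)) l))) ⟩
    ∑< (λ q → ∑dec L q (λ l → f (q ∷ l) * when (hd l <ᵇ q) (w (i , q) * sgn (size l) * g (pred q ∷ l)) + f (q ∷ l) * d
        (suc i) (g ∘ (q ∷_)) l)) (suc p)
      ≈⟨ ∑∑-+ p (λ q l → f (q ∷ l) * when (hd l <ᵇ q) (w (i , q) * sgn (size l) * g (pred q ∷ l)))
          (λ q l → f (q ∷ l) * d (suc i) (g ∘ (q ∷_)) l) ⟩
    ∑< (λ q → ∑dec L q (λ l → f (q ∷ l) * when (hd l <ᵇ q) (w (i , q) * sgn (size l) * g (pred q ∷ l)))) (suc p)
      + ∑< (λ q → ∑dec L q (λ l → f (q ∷ l) * d (suc i) (g ∘ (q ∷_)) l)) (suc p)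
      ≈⟨ +-cong removals (∑<-cong (suc p) (λ q _ → adjoint L (suc i) q (f ∘ (q ∷_)) (g ∘ (q ∷_)))) ⟩
    ∑< (λ q → ∑dec L q (X q)) p + ∑< (λ q → ∑dec L q (λ l → u false (suc i) (just q) (f ∘ (q ∷_)) l * g (q ∷ l)))
        (suc p)
      ≈⟨ +-congʳ additions ⟨
    ∑< (λ q → ∑dec L q (λ l → when (q <ᵇ p) (w (i , suc q) * sgn (size l) * f (suc q ∷ l)) * g (q ∷ l))) (suc p)
      + ∑< (λ q → ∑dec L q (λ l → u false (suc i) (just q) (f ∘ (q ∷_)) l * g (q ∷ l))) (suc p)
      ≈⟨ ∑∑-+ p (λ q l → when (q <ᵇ p) (w (i , suc q) * sgn (size l) * f (suc q ∷ l)) * g (q ∷ l))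
          (λ q l → u false (suc i) (just q) (f ∘ (q ∷_)) l * g (q ∷ l)) ⟨
    ∑< (λ q → ∑dec L q (λ l → when (q <ᵇ p) (w (i , suc q) * sgn (size l) * f (suc q ∷ l)) * g (q ∷ l) + u false (suc i)
        (just q) (f ∘ (q ∷_)) l * g (q ∷ l))) (suc p)
      ≈⟨ ∑<-cong (suc p) (λ q _ → ∑dec-cong′ L q (λ l → distribʳ (g (q ∷ l))
          (when (q <ᵇ p) (w (i , suc q) * sgn (size l) * f (suc q ∷ l))) (u false (suc i) (just q) (f ∘ (q ∷_)) l))) ⟨
    ∑< (λ q → ∑dec L q (λ l → u false i (just p) f (q ∷ l) * g (q ∷ l))) (suc p) ∎
    where
    X : ℕ → List ℕ → Carrier
    X q l = w (i , suc q) * sgn (size l) * (f (suc q ∷ l) * g (q ∷ l))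
    ∑∑-+ : ∀ p (a b : ℕ → List ℕ → Carrier) →
      ∑< (λ q → ∑dec L q (λ l → a q l + b q l)) (suc p)
          ≈ ∑< (λ q → ∑dec L q (a q)) (suc p) + ∑< (λ q → ∑dec L q (b q)) (suc p)
    ∑∑-+ p a b = trans (∑<-cong (suc p) (λ q _ → ∑dec-+ L q (a q) (b q))) (∑<-+ (suc p) (λ q → ∑dec L q (a q))
        (λ q → ∑dec L q (b q)))
    removals : ∑< (λ q → ∑dec L q (λ l → f (q ∷ l) * when (hd l <ᵇ q) (w (i , q) * sgn (size l) * g (pred q ∷ l))))
        (suc p) ≈ ∑< (λ q → ∑dec L q (X q)) p
    removals = trans (+-cong (trans (∑dec-cong′ L 0 (λ l → zeroʳ _)) (∑dec-0 L 0)) (∑<-cong p (λ q _ → trans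
      (∑dec-cong′ L (suc q) (λ l → trans (sym (when-* (hd l <ᵇ suc q) _ _)) (when-cong (hd l <ᵇ suc q)
          (solve 4 (λ f w s g → f :* (w :* s :* g) := w :* s :* (f :* g)) refl _ _ _ _))))
      (∑dec-lower L q (X q))))) (+-identityˡ _)
    additions : ∑< (λ q → ∑dec L q (λ l → when (q <ᵇ p) (w (i , suc q) * sgn (size l) * f (suc q ∷ l)) * g (q ∷ l)))
        (suc p) ≈ ∑< (λ q → ∑dec L q (X q)) p
    additions = trans (∑<-cong (suc p) (λ q _ → trans (∑dec-cong′ L q (λ l → move (q <ᵇ p) _ _ _))
        (∑dec-when L q (q <ᵇ p) (X q)))) (∑<-restrict {p} {suc p} (λ q → ∑dec L q (X q)) (ℕₚ.n≤1+n p))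
      where
      move : ∀ b k x y → when b (k * x) * y ≈ when b (k * (x * y))
      move true  k x y = *-assoc _ _ _
      move false k x y = zeroˡ _

  adjoint-iterate : ∀ m L p f g → ∑dec L p (λ l → f l * iterate (d 1) m g l)
      ≈ ∑dec L p (λ l → iterate (u false 1 (just p)) m f l * g l)
  adjoint-iterate zero    L p f g = refl
  adjoint-iterate (suc m) L p f g = trans (adjoint L 1 p f (iterate (d 1) m g))
      (trans (adjoint-iterate m L p (u false 1 (just p) f) g)
    (∑dec-cong′ L p (λ l → *-congʳ (reflexive (≡.cong (λ h → h l) (iterate-comm (u false 1 (just p)) m f))))))

  ∑dec-δ : ∀ L {p} (f : List ℕ → Carrier) α → Dec (just p) α → ∑dec L p (λ l → f l * δ α l) ≈ f (padTo L α)
  ∑dec-δ zero    f α D = *-identityʳ _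
  ∑dec-δ (suc L) {p} f α D = begin
    ∑< (λ q → ∑dec L q (λ l → f (q ∷ l) * when ((hd α ≡ᵇ q) ∧ agree (tl α) l) 1#)) (suc p)
      ≈⟨ ∑<-cong (suc p) (λ q _ → trans (∑dec-cong′ L q (λ l → trans (*-congˡ (when-∧ (hd α ≡ᵇ q) (agree (tl α) l) 1#))
          (sym (when-* (hd α ≡ᵇ q) (f (q ∷ l)) _))))
           (∑dec-when L q (hd α ≡ᵇ q) (λ l → f (q ∷ l) * δ (tl α) l))) ⟩
    ∑< (λ q → when (hd α ≡ᵇ q) (∑dec L q (λ l → f (q ∷ l) * δ (tl α) l))) (suc p)
      ≈⟨ ∑<-pick {hd α} {suc p} (λ q → ∑dec L q (λ l → f (q ∷ l) * δ (tl α) l)) (s≤s (Dec-hd α D)) ⟩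
    ∑dec L (hd α) (λ l → f (hd α ∷ l) * δ (tl α) l)
      ≈⟨ ∑dec-δ L (f ∘ (hd α ∷_)) (tl α) (Dec-tl α D) ⟩
    f (padTo (suc L) α) ∎

  -- Exactly one list of this length agrees with `λ'`. Thus the sum over inner shapes replaces the
  -- indicator by the constant function.
  ∑dec-δ-one : ∀ {p} λ' → Dec (just p) λ' → ∑dec (length λ') p (λ μ → δ μ λ') ≈ 1#
  ∑dec-δ-one []       D = refl
  ∑dec-δ-one {p} (l ∷ λ') (l≤p , D) = begin
    ∑< (λ q → ∑dec L q (λ μ → when ((q ≡ᵇ l) ∧ agree μ λ') 1#)) (suc p)
      ≈⟨ ∑<-cong (suc p) (λ q _ → trans (∑dec-cong′ L q (λ μ → when-∧ (q ≡ᵇ l) (agree μ λ') 1#))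
          (trans (∑dec-when L q (q ≡ᵇ l) _)
           (reflexive (≡.cong (λ b → when b (∑dec L q (λ μ → δ μ λ'))) (≡ᵇ-sym q l))))) ⟩
    ∑< (λ q → when (l ≡ᵇ q) (∑dec L q (λ μ → δ μ λ'))) (suc p)
      ≈⟨ ∑<-pick {l} {suc p} (λ q → ∑dec L q (λ μ → δ μ λ')) (s≤s l≤p) ⟩
    ∑dec L l (λ μ → δ μ λ')
      ≈⟨ ∑dec-δ-one λ' D ⟩
    1# ∎
    where
    L = length λ'

  d-∑dec : ∀ L p i (G : List ℕ → List ℕ → Carrier) λ' → d i (λ l → ∑dec L p (λ μ → G μ l)) λ'
      ≈ ∑dec L p (λ μ → d i (G μ) λ')
  d-∑dec L p i G []      = sym (∑dec-0 L p)
  d-∑dec L p i G (q ∷ l) = trans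
    (+-cong (trans (when-cong (hd l <ᵇ q) (sym (∑dec-* L p _ _))) (sym (∑dec-when L p (hd l <ᵇ q) _)))
        (d-∑dec L p (suc i) (λ μ l → G μ (q ∷ l)) l))
    (sym (∑dec-+ L p _ _))

  iterate-d-∑dec : ∀ m L p (G : List ℕ → List ℕ → Carrier) λ' →
    iterate (d 1) m (λ l → ∑dec L p (λ μ → G μ l)) λ' ≈ ∑dec L p (λ μ → iterate (d 1) m (G μ) λ')
  iterate-d-∑dec zero    L p G λ' = refl
  iterate-d-∑dec (suc m) L p G λ' = trans (d-cong 1 λ' (iterate-d-∑dec m L p G))
      (d-∑dec L p 1 (λ μ → iterate (d 1) m (G μ)) λ')

  iterate-d-cong-shape : ∀ m {c f g} l → Dec c l → (∀ l' → Dec c l' → length l' ≡ length l → f l'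
      ≈ g l') → iterate (d 1) m f l ≈ iterate (d 1) m g l
  iterate-d-cong-shape zero    l D f≈g = f≈g l D ≡.refl
  iterate-d-cong-shape (suc m) l D f≈g = d-cong-shape 1 l D (λ l' D' e → iterate-d-cong-shape m l' D'
      (λ l'' D'' e' → f≈g l'' D'' (≡.trans e' e)))

  sum-inner : ∀ m B α → Dec nothing α → Dec (just B) α →
    ∑dec (length α) B (λ μ → when (size α ≡ᵇ m ℕ.+ size μ) (tableaux μ α)) ≈ iterate (d 1) m 𝟙 α
  sum-inner m B α D DB = begin
    ∑dec (length α) B (λ μ → when (size α ≡ᵇ m ℕ.+ size μ) (tableaux μ α))
      ≈⟨ ∑dec-cong (length α) B (λ μ Dμ e → tableaux-iterate m μ α (Dec-weaken μ (λ _ → tt) Dμ) D (ℕₚ.≤-reflexive e)) ⟩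
    ∑dec (length α) B (λ μ → iterate (d 1) m (δ μ) α)
      ≈⟨ iterate-d-∑dec m (length α) B δ α ⟨
    iterate (d 1) m (λ l → ∑dec (length α) B (λ μ → δ μ l)) α
      ≈⟨ iterate-d-cong-shape m α DB (λ l D' e → trans (reflexive (≡.cong (λ L → ∑dec L B (λ μ → δ μ l)) (≡.sym e)))
          (∑dec-δ-one l D')) ⟩
    iterate (d 1) m 𝟙 α ∎

  u-zeros : ∀ e i f k → u e i (just 0) f (zeros k) ≈ 0#
  u-zeros false i f zero    = refl
  u-zeros true  i f zero    = refl
  u-zeros e     i f (suc k) = trans (+-identityˡ _) (u-zeros e (suc i) (f ∘ (0 ∷_)) k)

  -- As long as spare zeros are listed, it does not matter whether rows below the listed ones may be created.
  u-spare : ∀ i c l k {f g} → (∀ l' → size l' ≡ suc (size l) → f (l' ++ zeros k) ≈ g (l' ++ zeros k)) →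
    u false i c f (l ++ zeros (suc k)) ≈ u true i c g (l ++ zeros (suc k))
  u-spare i c [] k {f} {g} f≈g = +-cong (when-cong (room c 0) (*-congˡ (f≈g (1 ∷ []) ≡.refl)))
    (trans (u-zeros false (suc i) (f ∘ (0 ∷_)) k) (sym (u-zeros true (suc i) (g ∘ (0 ∷_)) k)))
  u-spare i c (q ∷ l) k {f} {g} f≈g = +-cong
    (when-cong (room c q) (*-congˡ (begin
      f (suc q ∷ l ++ zeros (suc k))        ≡⟨ ≡.cong (λ l → f (suc q ∷ l)) (Listₚ.++-assoc l (0 ∷ []) (zeros k)) ⟨
      f ((suc q ∷ l ++ 0 ∷ []) ++ zeros k)  ≈⟨ f≈g (suc q ∷ l ++ 0 ∷ []) (≡.cong (λ n → suc (q ℕ.+ n)) (size-pad l)) ⟩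
      g ((suc q ∷ l ++ 0 ∷ []) ++ zeros k)  ≡⟨ ≡.cong (λ l → g (suc q ∷ l)) (Listₚ.++-assoc l (0 ∷ []) (zeros k)) ⟩
      g (suc q ∷ l ++ zeros (suc k))        ∎)))
    (u-spare (suc i) (just q) l k (λ l' e → f≈g (q ∷ l') (≡.trans (≡.cong (q ℕ.+_) e) (ℕₚ.+-suc q (size l)))))

  u-uncap : ∀ e i B l f → hd l ℕ.< B → u e i (just B) f l ≈ u e i nothing f l
  u-uncap e i B []      f h<B rewrite <ᵇ-true h<B = refl
  u-uncap e i B (q ∷ l) f h<B rewrite <ᵇ-true h<B = refl

  -- An addition fills at most one spare zero and lengthens the first row by at most one, so `m`
  -- additions never feel the bounds of the box.
  iterate-u-spare : ∀ m B l → size l ℕ.+ m ℕ.≤ B →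
    iterate (u false 1 (just B)) m 𝟙 (l ++ zeros m) ≈ iterate (u true 1 nothing) m 𝟙 (l ++ zeros m)
  iterate-u-spare zero    B l size≤ = refl
  iterate-u-spare (suc m) B l size≤ = trans (u-uncap false 1 B (l ++ zeros (suc m)) _ (hd< l size≤))
    (u-spare 1 nothing l m (λ l' e → iterate-u-spare m B l'
        (ℕₚ.≤-trans (ℕₚ.≤-reflexive (≡.trans (≡.cong (ℕ._+ m) e) (≡.sym (ℕₚ.+-suc (size l) m)))) size≤)))
    where
    hd< : ∀ l → size l ℕ.+ suc m ℕ.≤ B → hd (l ++ zeros (suc m)) ℕ.< B
    hd< []      s≤ = ℕₚ.≤-trans (s≤s z≤n) s≤
    hd< (q ∷ l) s≤ = ℕₚ.≤-trans (ℕₚ.≤-trans (ℕₚ.≤-trans (s≤s (ℕₚ.≤-trans (ℕₚ.m≤m+n q (size l)) (ℕₚ.m≤m+n _ m)))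
        (ℕₚ.≤-reflexive (≡.sym (ℕₚ.+-suc (q ℕ.+ size l) m)))) s≤) ℕₚ.≤-refl

  iterate-u-pad : ∀ m → PadInv (iterate (u true 1 nothing) m 𝟙)
  iterate-u-pad zero    l = refl
  iterate-u-pad (suc m)   = u-pad 1 nothing _ (iterate-u-pad m)

  PadInv-zeros : ∀ f → PadInv f → ∀ k l → f (l ++ zeros k) ≈ f l
  PadInv-zeros f inv zero    l = reflexive (≡.cong f (Listₚ.++-identityʳ l))
  PadInv-zeros f inv (suc k) l = trans (reflexive (≡.cong f (≡.sym (Listₚ.++-assoc l (0 ∷ []) (zeros k)))))
      (trans (PadInv-zeros f inv k (l ++ 0 ∷ [])) (inv l))

  -- Paired with `𝟙`, the removals from the varying outer shape become additions to the fixed `α`,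
  -- by adjointness.
  sum-outer : ∀ m α → Dec nothing α → Dec (just (size α ℕ.+ m)) α →
    ∑dec (length α ℕ.+ m) (size α ℕ.+ m) (λ λ' → when (size λ' ≡ᵇ m ℕ.+ size α) (tableaux α λ'))
        ≈ iterate (u true 1 nothing) m 𝟙 α
  sum-outer m α D DB = begin
    ∑dec L B (λ λ' → when (size λ' ≡ᵇ m ℕ.+ size α) (tableaux α λ'))
      ≈⟨ ∑dec-cong L B (λ λ' Dλ e → trans (tableaux-iterate m α λ' D (Dec-weaken λ' (λ _ → tt) Dλ)
          (ℕₚ.≤-trans (ℕₚ.m≤m+n (length α) m) (ℕₚ.≤-reflexive (≡.sym e)))) (sym (*-identityˡ _))) ⟩
    ∑dec L B (λ λ' → 𝟙 λ' * iterate (d 1) m (δ α) λ')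
      ≈⟨ adjoint-iterate m L B 𝟙 (δ α) ⟩
    ∑dec L B (λ λ' → iterate (u false 1 (just B)) m 𝟙 λ' * δ α λ')
      ≈⟨ ∑dec-δ L (iterate (u false 1 (just B)) m 𝟙) α DB ⟩
    iterate (u false 1 (just B)) m 𝟙 (padTo L α)
      ≡⟨ ≡.cong (iterate (u false 1 (just B)) m 𝟙) (padTo-zeros α m) ⟩
    iterate (u false 1 (just B)) m 𝟙 (α ++ zeros m)
      ≈⟨ iterate-u-spare m B α ℕₚ.≤-refl ⟩
    iterate (u true 1 nothing) m 𝟙 (α ++ zeros m)
      ≈⟨ PadInv-zeros _ (iterate-u-pad m) m α ⟩
    iterate (u true 1 nothing) m 𝟙 α ∎
    where
    L = length α ℕ.+ m
    B = size α ℕ.+ m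

-- Laurent polynomials

module Q = RingFacts ℚₚ.+-*-commutativeRing

Exponent : Set
Exponent = ℤ × ℤ × ℤ

_⊕_ : Exponent → Exponent → Exponent
(a , b , c) ⊕ (a' , b' , c') = a ℤ.+ a' , b ℤ.+ b' , c ℤ.+ c'

⊕-comm : ∀ e e' → e ⊕ e' ≡ e' ⊕ e
⊕-comm (a , b , c) (a' , b' , c') = ≡.cong₂ _,_ (ℤₚ.+-comm a a') (≡.cong₂ _,_ (ℤₚ.+-comm b b') (ℤₚ.+-comm c c'))

⊕-assoc : ∀ e e' e'' → (e ⊕ e') ⊕ e'' ≡ e ⊕ (e' ⊕ e'')
⊕-assoc (a , b , c) (a' , b' , c') (a'' , b'' , c'') =
  ≡.cong₂ _,_ (ℤₚ.+-assoc a a' a'') (≡.cong₂ _,_ (ℤₚ.+-assoc b b' b'') (ℤₚ.+-assoc c c' c''))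

⊕-identityˡ : ∀ e → (+ 0 , + 0 , + 0) ⊕ e ≡ e
⊕-identityˡ (a , b , c) = ≡.cong₂ _,_ (ℤₚ.+-identityˡ a) (≡.cong₂ _,_ (ℤₚ.+-identityˡ b) (ℤₚ.+-identityˡ c))

⟨_,_⟩ : LPoly → (Exponent → ℚ) → ℚ
⟨ [] , φ ⟩          = 0ℚ
⟨ (q , e) ∷ P , φ ⟩ = q ℚ.* φ e ℚ.+ ⟨ P , φ ⟩

-- Equality tested against all functionals on exponents, not only the coefficient functionals:
-- this makes compatibility with multiplication immediate.
infix 4 _≐_
_≐_ : LPoly → LPoly → Set
P ≐ Q = ∀ φ → ⟨ P , φ ⟩ ≡ ⟨ Q , φ ⟩

-- The same relation as a record, from which P and Q can be inferred.
infix 4 _~_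
record _~_ (P Q : LPoly) : Set where
  constructor equal
  field at : P ≐ Q
open _~_ using (at)

⟨⟩-cong : ∀ P {φ ψ} → (∀ e → φ e ≡ ψ e) → ⟨ P , φ ⟩ ≡ ⟨ P , ψ ⟩
⟨⟩-cong []            φ≡ψ = ≡.refl
⟨⟩-cong ((q , e) ∷ P) φ≡ψ = ≡.cong₂ (λ x y → q ℚ.* x ℚ.+ y) (φ≡ψ e) (⟨⟩-cong P φ≡ψ)

⟨⟩-++ : ∀ P Q φ → ⟨ P ++ Q , φ ⟩ ≡ ⟨ P , φ ⟩ ℚ.+ ⟨ Q , φ ⟩
⟨⟩-++ []            Q φ = ≡.sym (ℚₚ.+-identityˡ _)
⟨⟩-++ ((q , e) ∷ P) Q φ = ≡.trans (≡.cong (q ℚ.* φ e ℚ.+_) (⟨⟩-++ P Q φ))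
    (≡.sym (ℚₚ.+-assoc (q ℚ.* φ e) ⟨ P , φ ⟩ ⟨ Q , φ ⟩))

⟨⟩-+ʳ : ∀ P φ ψ → ⟨ P , (λ e → φ e ℚ.+ ψ e) ⟩ ≡ ⟨ P , φ ⟩ ℚ.+ ⟨ P , ψ ⟩
⟨⟩-+ʳ []            φ ψ = ≡.sym (ℚₚ.+-identityˡ 0ℚ)
⟨⟩-+ʳ ((q , e) ∷ P) φ ψ = ≡.trans (≡.cong (q ℚ.* (φ e ℚ.+ ψ e) ℚ.+_) (⟨⟩-+ʳ P φ ψ))
  (Q.solve 5 (λ q x y u v → q Q.:* (x Q.:+ y) Q.:+ (u Q.:+ v) Q.:= (q Q.:* x Q.:+ u) Q.:+ (q Q.:* y Q.:+ v)) ≡.refl q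
      (φ e) (ψ e) ⟨ P , φ ⟩ ⟨ P , ψ ⟩)

⟨⟩-*ʳ : ∀ P k φ → ⟨ P , (λ e → k ℚ.* φ e) ⟩ ≡ k ℚ.* ⟨ P , φ ⟩
⟨⟩-*ʳ []            k φ = ≡.sym (ℚₚ.*-zeroʳ k)
⟨⟩-*ʳ ((q , e) ∷ P) k φ = ≡.trans (≡.cong (q ℚ.* (k ℚ.* φ e) ℚ.+_) (⟨⟩-*ʳ P k φ))
  (Q.solve 4 (λ q k x u → q Q.:* (k Q.:* x) Q.:+ k Q.:* u Q.:= k Q.:* (q Q.:* x Q.:+ u)) ≡.refl q k (φ e) ⟨ P , φ ⟩)

⟨⟩-0ʳ : ∀ P → ⟨ P , (λ _ → 0ℚ) ⟩ ≡ 0ℚ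
⟨⟩-0ʳ []            = ≡.refl
⟨⟩-0ʳ ((q , e) ∷ P) = ≡.trans (≡.cong₂ ℚ._+_ (ℚₚ.*-zeroʳ q) (⟨⟩-0ʳ P)) (ℚₚ.+-identityˡ 0ℚ)

⟨⟩-swap : ∀ P Q (φ : Exponent → Exponent → ℚ) →
  ⟨ P , (λ e → ⟨ Q , φ e ⟩) ⟩ ≡ ⟨ Q , (λ e' → ⟨ P , (λ e → φ e e') ⟩) ⟩
⟨⟩-swap []            Q φ = ≡.sym (⟨⟩-0ʳ Q)
⟨⟩-swap ((q , e) ∷ P) Q φ = ≡.trans (≡.cong₂ ℚ._+_ (≡.sym (⟨⟩-*ʳ Q q (φ e))) (⟨⟩-swap P Q φ)) (≡.sym (⟨⟩-+ʳ Q _ _))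

-- A name for the product of terms that is local to `_*P_`.
shift : Term → Term → Term
shift (q , e) (q' , e') = q ℚ.* q' , e ⊕ e'

⟨⟩-shift : ∀ q e Q φ → ⟨ map (shift (q , e)) Q , φ ⟩ ≡ q ℚ.* ⟨ Q , φ ∘ (e ⊕_) ⟩
⟨⟩-shift q e []              φ = ≡.sym (ℚₚ.*-zeroʳ q)
⟨⟩-shift q e ((q' , e') ∷ Q) φ = ≡.trans (≡.cong (q ℚ.* q' ℚ.* φ (e ⊕ e') ℚ.+_) (⟨⟩-shift q e Q φ))
  (Q.solve 4 (λ q q' x u → q Q.:* q' Q.:* x Q.:+ q Q.:* u Q.:= q Q.:* (q' Q.:* x Q.:+ u)) ≡.refl q q' (φ (e ⊕ e'))
      ⟨ Q , φ ∘ (e ⊕_) ⟩)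

-- A product is paired with `φ` by pairing its factors one after the other. The axioms for `_*P_`
-- thus reduce to those for `_⊕_`, to linearity and to the exchange of sums in `⟨⟩-swap`.
⟨⟩-* : ∀ P Q φ → ⟨ P *P Q , φ ⟩ ≡ ⟨ P , (λ e → ⟨ Q , φ ∘ (e ⊕_) ⟩) ⟩
⟨⟩-* []            Q φ = ≡.refl
⟨⟩-* ((q , e) ∷ P) Q φ = ≡.trans (⟨⟩-++ (map (shift (q , e)) Q) (P *P Q) φ)
  (≡.cong₂ ℚ._+_ (⟨⟩-shift q e Q φ) (⟨⟩-* P Q φ))

-P_ : LPoly → LPoly
-P_ = map (λ (q , e) → ℚ.- q , e)

⟨⟩-neg : ∀ P φ → ⟨ -P P , φ ⟩ ≡ ℚ.- ⟨ P , φ ⟩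
⟨⟩-neg []            φ = ≡.refl
⟨⟩-neg ((q , e) ∷ P) φ = ≡.trans (≡.cong (ℚ.- q ℚ.* φ e ℚ.+_) (⟨⟩-neg P φ))
  (Q.solve 3 (λ q x u → Q.:- q Q.:* x Q.:+ Q.:- u Q.:= Q.:- (q Q.:* x Q.:+ u)) ≡.refl q (φ e) ⟨ P , φ ⟩)

*P-comm : ∀ P Q → P *P Q ≐ Q *P P
*P-comm P Q φ = ≡.trans (⟨⟩-* P Q φ) (≡.trans (⟨⟩-swap P Q _)
  (≡.trans (⟨⟩-cong Q (λ e' → ⟨⟩-cong P (λ e → ≡.cong φ (⊕-comm e e')))) (≡.sym (⟨⟩-* Q P φ))))

*P-cong : ∀ {P P' Q Q'} → P ≐ P' → Q ≐ Q' → P *P Q ≐ P' *P Q'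
*P-cong {P} {P'} {Q} {Q'} P≐P' Q≐Q' φ = ≡.trans (⟨⟩-* P Q φ) (≡.trans (P≐P' _)
  (≡.trans (⟨⟩-cong P' (λ e → Q≐Q' _)) (≡.sym (⟨⟩-* P' Q' φ))))

*P-assoc : ∀ P Q S → (P *P Q) *P S ≐ P *P (Q *P S)
*P-assoc P Q S φ = ≡.trans (⟨⟩-* (P *P Q) S φ) (≡.trans (⟨⟩-* P Q _) (≡.sym (≡.trans (⟨⟩-* P (Q *P S) φ)
  (⟨⟩-cong P (λ e → ≡.trans (⟨⟩-* Q S _)
      (⟨⟩-cong Q (λ e' → ⟨⟩-cong S (λ e'' → ≡.cong φ (≡.sym (⊕-assoc e e' e''))))))))))

*P-identityˡ : ∀ P → 1P *P P ≐ P
*P-identityˡ P φ = ≡.trans (⟨⟩-* 1P P φ) (≡.trans (ℚₚ.+-identityʳ _) (≡.trans (ℚₚ.*-identityˡ _)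
  (⟨⟩-cong P (λ e → ≡.cong φ (⊕-identityˡ e)))))

*P-distribˡ : ∀ P Q S → P *P (Q +P S) ≐ (P *P Q) +P (P *P S)
*P-distribˡ P Q S φ = ≡.trans (⟨⟩-* P (Q +P S) φ) (≡.trans (⟨⟩-cong P (λ e → ⟨⟩-++ Q S _))
  (≡.trans (⟨⟩-+ʳ P _ _) (≡.trans (≡.cong₂ ℚ._+_ (≡.sym (⟨⟩-* P Q φ)) (≡.sym (⟨⟩-* P S φ)))
      (≡.sym (⟨⟩-++ (P *P Q) (P *P S) φ)))))

+P-cong : ∀ {P P' Q Q'} → P ≐ P' → Q ≐ Q' → P +P Q ≐ P' +P Q'
+P-cong {P} {P'} {Q} {Q'} P≐P' Q≐Q' φ = ≡.trans (⟨⟩-++ P Q φ) (≡.trans (≡.cong₂ ℚ._+_ (P≐P' φ) (Q≐Q' φ))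
    (≡.sym (⟨⟩-++ P' Q' φ)))

+P-assoc : ∀ P Q S → (P +P Q) +P S ≐ P +P (Q +P S)
+P-assoc P Q S φ = ≡.trans (⟨⟩-++ (P +P Q) S φ) (≡.trans (≡.cong (ℚ._+ ⟨ S , φ ⟩) (⟨⟩-++ P Q φ))
  (≡.trans (ℚₚ.+-assoc ⟨ P , φ ⟩ ⟨ Q , φ ⟩ ⟨ S , φ ⟩)
      (≡.sym (≡.trans (⟨⟩-++ P (Q +P S) φ) (≡.cong (⟨ P , φ ⟩ ℚ.+_) (⟨⟩-++ Q S φ))))))

+P-comm : ∀ P Q → P +P Q ≐ Q +P P
+P-comm P Q φ = ≡.trans (⟨⟩-++ P Q φ) (≡.trans (ℚₚ.+-comm ⟨ P , φ ⟩ ⟨ Q , φ ⟩) (≡.sym (⟨⟩-++ Q P φ)))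

+P-inverseʳ : ∀ P → P +P (-P P) ≐ 0P
+P-inverseʳ P φ = ≡.trans (⟨⟩-++ P (-P P) φ) (≡.trans (≡.cong (⟨ P , φ ⟩ ℚ.+_) (⟨⟩-neg P φ)) (ℚₚ.+-inverseʳ ⟨ P , φ ⟩))

laurentRing : CommutativeRing 0ℓ 0ℓ
laurentRing = record
  { Carrier = LPoly ; _≈_ = _~_ ; _+_ = _+P_ ; _*_ = _*P_ ; -_ = -P_ ; 0# = 0P ; 1# = 1P
  ; isCommutativeRing = record
    { isRing = record
      { +-isAbelianGroup = record
        { isGroup = record
          { isMonoid = record
            { isSemigroup = record
              { isMagma = record
                { isEquivalence = record
                  { refl  = equal (λ _ → ≡.refl)
                  ; sym   = λ p → equal (λ φ → ≡.sym (at p φ))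
                  ; trans = λ p q → equal (λ φ → ≡.trans (at p φ) (at q φ))
                  }
                ; ∙-cong = λ {P} {P'} {Q} {Q'} p q → equal (+P-cong {P} {P'} {Q} {Q'} (at p) (at q))
                }
              ; assoc = λ P Q S → equal (+P-assoc P Q S)
              }
            ; identity = (λ P → equal (λ _ → ≡.refl)) , λ P → equal (+P-comm P [])
            }
          ; inverse = (λ P → equal (λ φ → ≡.trans (+P-comm (-P P) P φ) (+P-inverseʳ P φ))) , λ P → equal (+P-inverseʳ P)
          ; ⁻¹-cong = λ {P} {Q} p → equal (λ φ → ≡.trans (⟨⟩-neg P φ) (≡.trans (≡.cong ℚ.-_ (at p φ))
              (≡.sym (⟨⟩-neg Q φ))))
          }
        ; comm = λ P Q → equal (+P-comm P Q)
        }
      ; *-cong = λ {P} {P'} {Q} {Q'} p q → equal (*P-cong {P} {P'} {Q} {Q'} (at p) (at q))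
      ; *-assoc = λ P Q S → equal (*P-assoc P Q S)
      ; *-identity = (λ P → equal (*P-identityˡ P)) , λ P → equal (λ φ → ≡.trans (*P-comm P 1P φ) (*P-identityˡ P φ))
      ; distrib = (λ P Q S → equal (*P-distribˡ P Q S)) , λ P Q S → equal (λ φ → ≡.trans (*P-comm (Q +P S) P φ)
          (≡.trans (*P-distribˡ P Q S φ) (+P-cong {P *P Q} {Q *P P} {P *P S} {S *P P} (*P-comm P Q) (*P-comm P S) φ)))
      }
    ; *-comm = λ P Q → equal (*P-comm P Q)
    }
  }

indicator : ℤ → ℤ → ℤ → Exponent → ℚ
indicator a b c (a' , b' , c') = if ⌊ a' ℤ.≟ a ⌋ ∧ ⌊ b' ℤ.≟ b ⌋ ∧ ⌊ c' ℤ.≟ c ⌋ then 1ℚ else 0ℚ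

coeff-⟨⟩ : ∀ P a b c → coeff P a b c ≡ ⟨ P , indicator a b c ⟩
coeff-⟨⟩ []                        a b c = ≡.refl
coeff-⟨⟩ ((q , (a' , b' , c')) ∷ P) a b c with ⌊ a' ℤ.≟ a ⌋ ∧ ⌊ b' ℤ.≟ b ⌋ ∧ ⌊ c' ℤ.≟ c ⌋
... | true  = ≡.cong₂ ℚ._+_ (≡.sym (ℚₚ.*-identityʳ q)) (coeff-⟨⟩ P a b c)
... | false = ≡.trans (coeff-⟨⟩ P a b c) (≡.sym (≡.trans (≡.cong (ℚ._+ ⟨ P , indicator a b c ⟩) (ℚₚ.*-zeroʳ q))
    (ℚₚ.+-identityˡ _)))

~⇒≈P : ∀ {P Q} → P ~ Q → P ≈P Q
~⇒≈P {P} {Q} P~Q a b c = ≡.trans (coeff-⟨⟩ P a b c) (≡.trans (at P~Q (indicator a b c)) (≡.sym (coeff-⟨⟩ Q a b c)))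

-- Arithmetic of rational scalars

toℚᵘ-/ : ∀ i d → ℚ.toℚᵘ (i ℚ./ suc d) ℚᵘ.≃ mkℚᵘ i d
toℚᵘ-/ i d = ℚₚ.toℚᵘ-fromℚᵘ (mkℚᵘ i d)

-- Normalised fractions do not compute for variable denominators. Unnormalised ones do, and `toℚᵘ`
-- is injective.
reciprocal-* : ∀ a b .{{_ : NonZero a}} .{{_ : NonZero b}} .{{_ : NonZero (a ℕ.* b)}} →
  (+ 1) ℚ./ (a ℕ.* b) ≡ ((+ 1) ℚ./ a) ℚ.* ((+ 1) ℚ./ b)
reciprocal-* (suc a) (suc b) = ℚₚ.toℚᵘ-injective (ℚᵘₚ.≃-trans (toℚᵘ-/ (+ 1) (b ℕ.+ a ℕ.* suc b))
  (ℚᵘₚ.≃-sym (ℚᵘₚ.≃-trans (ℚₚ.toℚᵘ-homo-* ((+ 1) ℚ./ suc a) ((+ 1) ℚ./ suc b)) (ℚᵘₚ.*-cong (toℚᵘ-/ (+ 1) a)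
      (toℚᵘ-/ (+ 1) b)))))

reciprocal-inverse : ∀ n → ((+ 1) ℚ./ suc n) ℚ.* ℤtoℚ (+ suc n) ≡ 1ℚ
reciprocal-inverse n = ℚₚ.toℚᵘ-injective (ℚᵘₚ.≃-trans (ℚₚ.toℚᵘ-homo-* ((+ 1) ℚ./ suc n) (ℤtoℚ (+ suc n)))
  (ℚᵘₚ.≃-trans (ℚᵘₚ.*-cong (toℚᵘ-/ (+ 1) n) (toℚᵘ-/ (+ suc n) 0))
    (*≡* (≡.trans (ℤₚ.*-identityʳ _) (≡.trans (ℤₚ.*-identityˡ (+ suc n))
        (≡.cong +_ (≡.trans (≡.sym (ℕₚ.*-identityʳ (suc n))) (≡.sym (ℕₚ.*-identityˡ (suc n ℕ.* 1))))))))))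

ℤtoℚ-+ : ∀ i j → ℤtoℚ (i ℤ.+ j) ≡ ℤtoℚ i ℚ.+ ℤtoℚ j
ℤtoℚ-+ i j = ℚₚ.toℚᵘ-injective (ℚᵘₚ.≃-trans (toℚᵘ-/ (i ℤ.+ j) 0)
  (ℚᵘₚ.≃-sym (ℚᵘₚ.≃-trans (ℚₚ.toℚᵘ-homo-+ (ℤtoℚ i) (ℤtoℚ j)) (ℚᵘₚ.≃-trans (ℚᵘₚ.+-cong (toℚᵘ-/ i 0) (toℚᵘ-/ j 0))
    (*≡* (≡.cong (ℤ._* + 1) (≡.cong₂ ℤ._+_ (ℤₚ.*-identityʳ i) (ℤₚ.*-identityʳ j))))))))

ℤtoℚ-* : ∀ i j → ℤtoℚ (i ℤ.* j) ≡ ℤtoℚ i ℚ.* ℤtoℚ j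
ℤtoℚ-* i j = ℚₚ.toℚᵘ-injective (ℚᵘₚ.≃-trans (toℚᵘ-/ (i ℤ.* j) 0)
  (ℚᵘₚ.≃-sym (ℚᵘₚ.≃-trans (ℚₚ.toℚᵘ-homo-* (ℤtoℚ i) (ℤtoℚ j)) (ℚᵘₚ.*-cong (toℚᵘ-/ i 0) (toℚᵘ-/ j 0)))))

ℤtoℚ-neg : ∀ i → ℤtoℚ (ℤ.- i) ≡ ℚ.- ℤtoℚ i
ℤtoℚ-neg i = ℚₚ.toℚᵘ-injective (ℚᵘₚ.≃-trans (toℚᵘ-/ (ℤ.- i) 0)
  (ℚᵘₚ.≃-sym (ℚᵘₚ.≃-trans (ℚₚ.toℚᵘ-homo‿- (ℤtoℚ i)) (ℚᵘₚ.-‿cong (toℚᵘ-/ i 0)))))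

-- The weights in `x`, `y` and `z`

evenᵇ-suc : ∀ n → evenᵇ (suc n) ≡ not (evenᵇ n)
evenᵇ-suc zero          = ≡.refl
evenᵇ-suc (suc zero)    = ≡.refl
evenᵇ-suc (suc (suc n)) = evenᵇ-suc n

open RingFacts laurentRing
open Sums laurentRing

bit : Bool → ℕ
bit b = if b then 1 else 0

monomial : ℕ → ℕ → ℕ → LPoly
monomial a b c = (xP ^P a) *P ((yP ^P b) *P (zP ^P c))

wᵘ wᵈ : Cell → LPoly
wᵘ (i , j) = monomial (bit (evenᵇ i)) (bit (evenᵇ j)) (bit (evenᵇ i ∧ evenᵇ j))
wᵈ (i , j) = negMono  (bit (evenᵇ i)) (bit (evenᵇ j)) (bit (evenᵇ i ∧ evenᵇ j))

-- A cell in an even row contributes `x` when added and the inverse of `-x` when removed, hence the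
-- factor -1 there.
ε : ℕ → LPoly
ε i = if evenᵇ i then - 1P else 1P

κ : LPoly
κ = (xP ^P 2) *P ((yP ^P 2) *P zP)

horizontal vertical : ℕ → LPoly
horizontal i = if evenᵇ i then (xP ^P 2) *P (yP *P zP) else yP
vertical   j = if evenᵇ j then xP *P ((yP ^P 2) *P zP) else xP

-- Weights depend on parities only, and for each choice of these both sides evaluate to the same
-- expression; the domino identities below hold for the same reason.
wᵘwᵈ : ∀ i j → wᵘ (i , j) *P wᵈ (i , j) ~ ε i
wᵘwᵈ i j with evenᵇ i | evenᵇ j
... | false | false = equal (λ _ → ≡.refl)
... | false | true  = equal (λ _ → ≡.refl)
... | true  | false = equal (λ _ → ≡.refl)
... | true  | true  = equal (λ _ → ≡.refl)

ε-suc : ∀ i → ε (suc i) ~ - ε i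
ε-suc i rewrite evenᵇ-suc i with evenᵇ i
... | false = equal (λ _ → ≡.refl)
... | true  = equal (λ _ → ≡.refl)

wᵘ-horizontal : ∀ i j → wᵘ (i , suc j) *P wᵘ (i , suc (suc j)) ~ horizontal i
wᵘ-horizontal i j rewrite evenᵇ-suc j with evenᵇ i | evenᵇ j
... | false | false = equal (λ _ → ≡.refl)
... | false | true  = equal (λ _ → ≡.refl)
... | true  | false = equal (λ _ → ≡.refl)
... | true  | true  = equal (λ _ → ≡.refl)

wᵘ-vertical : ∀ i j → wᵘ (i , j) *P wᵘ (suc i , j) ~ vertical j
wᵘ-vertical i j rewrite evenᵇ-suc i with evenᵇ i | evenᵇ j
... | false | false = equal (λ _ → ≡.refl)
... | false | true  = equal (λ _ → ≡.refl)
... | true  | false = equal (λ _ → ≡.refl)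
... | true  | true  = equal (λ _ → ≡.refl)

wᵈ-horizontal : ∀ i j → κ *P (wᵈ (i , suc j) *P wᵈ (i , suc (suc j))) ~ horizontal (suc i)
wᵈ-horizontal i j rewrite evenᵇ-suc j | evenᵇ-suc i with evenᵇ i | evenᵇ j
... | false | false = equal (λ _ → ≡.refl)
... | false | true  = equal (λ _ → ≡.refl)
... | true  | false = equal (λ _ → ≡.refl)
... | true  | true  = equal (λ _ → ≡.refl)

wᵈ-vertical : ∀ i j → κ *P (wᵈ (i , suc j) *P wᵈ (suc i , suc j)) ~ - vertical (suc (suc j))
wᵈ-vertical i j rewrite evenᵇ-suc j | evenᵇ-suc i with evenᵇ i | evenᵇ j
... | false | false = equal (λ _ → ≡.refl)
... | false | true  = equal (λ _ → ≡.refl)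
... | true  | false = equal (λ _ → ≡.refl)
... | true  | true  = equal (λ _ → ≡.refl)

-- Monomials and signed sums of tableaux as ring elements

negMono-+ : ∀ a b c v h δ → negMono (a ℕ.+ v) (b ℕ.+ h) (c ℕ.+ δ) ≡ negMono a b c *P negMono v h δ
negMono-+ a b c v h δ = ≡.cong (_∷ []) (≡.cong₂ _,_ (scalar a)
  (≡.cong₂ _,_ (ℤₚ.neg-distrib-+ (+ a) (+ v)) (≡.cong₂ _,_ (ℤₚ.neg-distrib-+ (+ b) (+ h)) (ℤₚ.neg-distrib-+ (+ c)
      (+ δ)))))
  where
  signℕ-+ : ∀ a → signℕ (a ℕ.+ v) ≡ signℕ a ℤ.* signℕ v
  signℕ-+ zero    = ≡.sym (ℤₚ.*-identityˡ (signℕ v))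
  signℕ-+ (suc a) = ≡.trans (≡.cong ℤ.-_ (signℕ-+ a)) (ℤₚ.neg-distribˡ-* (signℕ a) (signℕ v))
  scalar : ∀ a → ℤtoℚ (signℕ (a ℕ.+ v)) ≡ ℤtoℚ (signℕ a) ℚ.* ℤtoℚ (signℕ v)
  scalar a = ≡.trans (≡.cong ℤtoℚ (signℕ-+ a)) (ℤtoℚ-* (signℕ a) (signℕ v))

open import Algebra.Properties.Semiring.Exp semiring using (_^_; ^-homo-*; ^-congˡ)

^≡^P : ∀ P n → P ^ n ≡ P ^P n
^≡^P P zero    = ≡.refl
^≡^P P (suc n) = ≡.cong (P *P_) (^≡^P P n)

^P-+ : ∀ P m n → P ^P (m ℕ.+ n) ~ (P ^P m) *P (P ^P n)
^P-+ P m n rewrite ≡.sym (^≡^P P (m ℕ.+ n)) | ≡.sym (^≡^P P m) | ≡.sym (^≡^P P n) = ^-homo-* P m n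

monomial-+ : ∀ a b c v h δ → monomial (a ℕ.+ v) (b ℕ.+ h) (c ℕ.+ δ) ~ monomial a b c *P monomial v h δ
monomial-+ a b c v h δ = trans (*-cong (^P-+ xP a v) (*-cong (^P-+ yP b h) (^P-+ zP c δ)))
  (solve 6 (λ x x' y y' z z' → (x :* x') :* ((y :* y') :* (z :* z')) := (x :* (y :* z)) :* (x' :* (y' :* z'))) refl
    (xP ^P a) (xP ^P v) (yP ^P b) (yP ^P h) (zP ^P c) (zP ^P δ))

evenRow evenColumn evenBoth : Cell → Bool
evenRow    (i , j) = evenᵇ i
evenColumn (i , j) = evenᵇ j
evenBoth   (i , j) = evenᵇ i ∧ evenᵇ j

module ᵘ = Tableaux laurentRing wᵘ
module ᵈ = Tableaux laurentRing wᵈ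

∏ᵘ : ∀ L → monomial (count evenRow L) (count evenColumn L) (count evenBoth L) ~ ᵘ.∏ L
∏ᵘ []      = equal (λ _ → ≡.refl)
∏ᵘ (c ∷ L) = trans
  (monomial-+ (bit (evenRow c)) (bit (evenColumn c)) (bit (evenBoth c)) (count evenRow L) (count evenColumn L)
      (count evenBoth L))
  (*-congˡ {wᵘ c} (∏ᵘ L))

∏ᵈ : ∀ L → negMono (count evenRow L) (count evenColumn L) (count evenBoth L) ~ ᵈ.∏ L
∏ᵈ []      = equal (λ _ → ≡.refl)
∏ᵈ (c ∷ L) = trans
  (reflexive (negMono-+ (bit (evenRow c)) (bit (evenColumn c)) (bit (evenBoth c)) (count evenRow L) (count evenColumn L)
      (count evenBoth L)))
  (*-congˡ {wᵈ c} (∏ᵈ L))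

scalar : ℚ → LPoly
scalar q = mono q (+ 0) (+ 0) (+ 0)

scalar-+ : ∀ p q → scalar (p ℚ.+ q) ~ scalar p +P scalar q
scalar-+ p q = equal (λ φ → Q.solve 3 (λ p q x → (p Q.:+ q) Q.:* x Q.:+ Q.:0
    Q.:= p Q.:* x Q.:+ (q Q.:* x Q.:+ Q.:0)) ≡.refl p q (φ (+ 0 , + 0 , + 0)))

scalar-0 : scalar 0ℚ ~ 0P
scalar-0 = equal (λ φ → ≡.trans (ℚₚ.+-identityʳ (0ℚ ℚ.* φ (+ 0 , + 0 , + 0))) (ℚₚ.*-zeroˡ (φ (+ 0 , + 0 , + 0))))

scalar-sign : ∀ n → scalar (ℤtoℚ (signℕ n)) ~ sgn n
scalar-sign zero    = equal (λ _ → ≡.refl)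
scalar-sign (suc n) = trans (reflexive (≡.cong scalar (ℤtoℚ-neg (signℕ n)))) (-‿cong (scalar-sign n))

scalar-sumℤ : ∀ {A : Set} (f : A → ℤ) xs → scalar (ℤtoℚ (sumℤ (map f xs))) ~ ∑ (scalar ∘ ℤtoℚ ∘ f) xs
scalar-sumℤ f []       = scalar-0
scalar-sumℤ f (x ∷ xs) = trans (reflexive (≡.cong scalar (ℤtoℚ-+ (f x) (sumℤ (map f xs)))))
  (trans (scalar-+ (ℤtoℚ (f x)) (ℤtoℚ (sumℤ (map f xs)))) (+-congˡ (scalar-sumℤ f xs)))

scalar-I : ∀ (w : Cell → LPoly) μ λ' → scalar (ℤtoℚ (I μ λ'))
    ~ Tableaux.Fillings.signedSum laurentRing w (cellsFrom 1 [] μ) (cellsFrom 1 μ λ')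
scalar-I w μ λ' rewrite cells≡cellsFrom μ λ' | cells≡cellsFrom [] μ = begin
  scalar (ℤtoℚ (sumℤ (map S (filterᵇ isSYTᵇ (perms C)))))     ≈⟨ scalar-sumℤ S (filterᵇ isSYTᵇ (perms C)) ⟩
  ∑ (scalar ∘ ℤtoℚ ∘ S) (filterᵇ isSYTᵇ (perms C))            ≈⟨ ∑-filterᵇ (scalar ∘ ℤtoℚ ∘ S) isSYTᵇ (perms C) ⟩
  ∑ (λ v → when (isSYTᵇ v) (scalar (ℤtoℚ (S v)))) (perms C)   ≈⟨ ∑-cong (perms C) same ⟩
  ∑ term (perms C)                                            ∎
  where
  open Tableaux.Fillings laurentRing w (cellsFrom 1 [] μ) using (term)
  base C : List Cell
  base = cellsFrom 1 [] μ
  C = cellsFrom 1 μ λ'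
  S : List Cell → ℤ
  S v = signStraight base ℤ.* signStraight (base ++ v)
  same : ∀ v → when (isSYTᵇ v) (scalar (ℤtoℚ (S v))) ~ term v
  same v rewrite isSYTᵇ≡standard v = when-cong (standard v) (trans
    (reflexive (≡.cong scalar (ℤtoℚ-* (signStraight base) (signStraight (base ++ v)))))
    (*-cong (scalar-sign (inversions base)) (scalar-sign (inversions (base ++ v)))))

sumP-map : ∀ {A : Set} (f : A → LPoly) xs → sumP (map f xs) ≡ ∑ f xs
sumP-map f []       = ≡.refl
sumP-map f (x ∷ xs) = ≡.cong (f x ++_) (sumP-map f xs)

-- `Fpos` and `Fneg` as iterated operators

IsPartition⇒Dec : ∀ {α} → IsPartition α → Dec nothing α
IsPartition⇒Dec nil                = tt
IsPartition⇒Dec (one p _) = tt , tt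
IsPartition⇒Dec (cons p q ps q≤p P) = tt , q≤p , proj₂ (IsPartition⇒Dec P)

hd≤size : ∀ l → hd l ℕ.≤ size l
hd≤size []      = z≤n
hd≤size (q ∷ l) = ℕₚ.m≤m+n q (size l)

∑-shapes : ∀ (w : Cell → LPoly) (good : List ℕ → Bool) F G L B →
  (∀ l → Dec (just B) l → length l ≡ L → when (good l) (F l) ~ G l) →
  ∑ F (filterᵇ (λ l → decreasingᵇ l ∧ good l) (boxLists L B)) ~ Shapes.∑dec laurentRing w L B G
∑-shapes w good F G L B F≈G = begin
  ∑ F (filterᵇ (λ l → decreasingᵇ l ∧ good l) (boxLists L B))
    ≈⟨ ∑-filterᵇ F (λ l → decreasingᵇ l ∧ good l) (boxLists L B) ⟩
  ∑ (λ l → when (decreasingᵇ l ∧ good l) (F l)) (boxLists L B)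
    ≈⟨ ∑-cong (boxLists L B) (λ l → when-∧ (decreasingᵇ l) (good l) (F l)) ⟩
  ∑ (λ l → when (decreasingᵇ l) (when (good l) (F l))) (boxLists L B)
    ≈⟨ ∑-boxLists L B (λ l → when (good l) (F l)) ⟩
  ∑dec L B (λ l → when (good l) (F l))
    ≈⟨ ∑dec-cong L B F≈G ⟩
  ∑dec L B G ∎
  where open Shapes laurentRing w

U₁ d₁ : (List ℕ → LPoly) → List ℕ → LPoly
U₁ = Operators.Steps.u laurentRing wᵘ true 1 nothing
d₁ = Operators.Steps.d laurentRing wᵈ 1

𝟙 : List ℕ → LPoly
𝟙 _ = 1P

filter-shape : ∀ b b' (F G : LPoly) → F ~ G → when (b ∧ b') F ~ when b' (when b G)
filter-shape true  true  F G F≈G = F≈G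
filter-shape true  false F G F≈G = equal (λ _ → ≡.refl)
filter-shape false true  F G F≈G = equal (λ _ → ≡.refl)
filter-shape false false F G F≈G = equal (λ _ → ≡.refl)

Fpos≈ : ∀ α → IsPartition α → ∀ n → Fpos α n ~ iterate U₁ (2 ℕ.* n) 𝟙 α
Fpos≈ α P n = trans (reflexive (sumP-map F (outerShapes α m)))
  (trans
    (∑-shapes wᵘ (λ l → ⊆ᵇ α l ∧ (size l ≡ᵇ size α ℕ.+ m)) F G L B F≈G)
    (sum-outer m α D (Dec-hd-cap α (ℕₚ.≤-trans (hd≤size α) (ℕₚ.m≤m+n (size α) m)) D)))
  where
  open Shapes laurentRing wᵘ hiding (𝟙)
  m = 2 ℕ.* n
  L = length α ℕ.+ m
  B = size α ℕ.+ m
  D = IsPartition⇒Dec P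
  F G : List ℕ → LPoly
  F l = scaleP (ℤtoℚ (I α l)) (monomial (vS α l) (hS α l) (dS α l))
  G l = when (size l ≡ᵇ m ℕ.+ size α) (tableaux α l)
  weight : ∀ l → F l ~ weightedTableaux α l
  weight l = *-cong (scalar-I wᵘ α l)
    (≡.subst (λ C → monomial (count evenRow C) (count evenColumn C) (count evenBoth C)
        ~ ᵘ.∏ (cellsFrom 1 α l)) (≡.sym (cells≡cellsFrom α l)) (∏ᵘ (cellsFrom 1 α l)))
  F≈G : ∀ l → Dec (just B) l → length l ≡ L → when (⊆ᵇ α l ∧ (size l ≡ᵇ size α ℕ.+ m)) (F l) ~ G l
  F≈G l _ e rewrite ⊆ᵇ≡sub α l (ℕₚ.≤-trans (ℕₚ.m≤m+n (length α) m) (ℕₚ.≤-reflexive (≡.sym e))) | ℕₚ.+-comm (size α) m =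
    filter-shape (sub α l) (size l ≡ᵇ m ℕ.+ size α) (F l) (weightedTableaux α l) (weight l)

Fneg≈ : ∀ α → IsPartition α → ∀ n → Fneg α n ~ iterate d₁ (2 ℕ.* n) 𝟙 α
Fneg≈ α P n = trans (reflexive (sumP-map F (innerShapes α m)))
  (trans
    (∑-shapes wᵈ (λ μ → ⊆ᵇ μ α ∧ (size μ ℕ.+ m ≡ᵇ size α)) F G (length α) (size α) F≈G)
    (sum-inner m (size α) α D (Dec-hd-cap α (hd≤size α) D)))
  where
  open Shapes laurentRing wᵈ hiding (𝟙)
  m = 2 ℕ.* n
  D = IsPartition⇒Dec P
  F G : List ℕ → LPoly
  F μ = scaleP (ℤtoℚ (I μ α)) (negMono (vS μ α) (hS μ α) (dS μ α))
  G μ = when (size α ≡ᵇ m ℕ.+ size μ) (tableaux μ α)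
  weight : ∀ μ → F μ ~ weightedTableaux μ α
  weight μ = *-cong (scalar-I wᵈ μ α)
    (≡.subst (λ C → negMono (count evenRow C) (count evenColumn C) (count evenBoth C)
        ~ ᵈ.∏ (cellsFrom 1 μ α)) (≡.sym (cells≡cellsFrom μ α)) (∏ᵈ (cellsFrom 1 μ α)))
  F≈G : ∀ μ → Dec (just (size α)) μ → length μ ≡ length α → when (⊆ᵇ μ α ∧ (size μ ℕ.+ m ≡ᵇ size α)) (F μ) ~ G μ
  F≈G μ _ e rewrite ⊆ᵇ≡sub μ α (ℕₚ.≤-reflexive e) | ℕₚ.+-comm (size μ) m | ≡ᵇ-sym (m ℕ.+ size μ) (size α) =
    filter-shape (sub μ α) (size α ≡ᵇ m ℕ.+ size μ) (F μ) (weightedTableaux μ α) (weight μ)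

-- The generating functions

open BinomialTransform laurentRing

φ ρ : ℕ → LPoly
φ n = scalar (invFact n)
ρ n = scalar ((+ 1) ℚ./ suc n)

φ-suc : ∀ n → φ (suc n) ~ ρ n *P φ n
φ-suc n = reflexive (≡.cong scalar (reciprocal-* (suc n) (n !) {{_}} {{n ℕₚ.!≢0}} {{suc n ℕₚ.!≢0}}))

ν≈ : ∀ n → ν n ~ scalar (ℤtoℚ (+ n))
ν≈ zero    = sym scalar-0
ν≈ (suc n) = trans (+-congˡ (ν≈ n)) (sym (trans (reflexive (≡.cong scalar (ℤtoℚ-+ (+ 1) (+ n))))
    (scalar-+ 1ℚ (ℤtoℚ (+ n)))))

ρν : ∀ n → ρ n *P ν (suc n) ~ 1P
ρν n = trans (*-congˡ {ρ n} (ν≈ (suc n))) (reflexive (≡.cong scalar (reciprocal-inverse n)))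

open DividedPowers φ ρ (equal (λ _ → ≡.refl)) φ-suc ρν using (exponential)

open Clifford laurentRing wᵘ wᵈ ε wᵘwᵈ ε-suc using (U²; d²; module Dominoes)
open Dominoes κ horizontal vertical wᵘ-horizontal wᵘ-vertical wᵈ-horizontal wᵈ-vertical using (E-binomial)

iterate-2* : ∀ {A : Set} (T : A → A) n x → iterate T (2 ℕ.* n) x ≡ iterate (T ∘ T) n x
iterate-2* T zero    x = ≡.refl
iterate-2* T (suc n) x rewrite ℕₚ.+-suc n (n ℕ.+ 0) = ≡.cong (T ∘ T) (iterate-2* T n x)

*S≈conv : ∀ A B n → (A *S B) n ~ conv n A B
*S≈conv A B n = trans (reflexive (sumP-map (λ k → A k *P B (n ∸ k)) (upTo (suc n))))
    (trans (∑<-upTo (λ k → A k *P B (n ∸ k)) (suc n)) (go A n))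
  where
  go : ∀ A n → ∑< (λ k → A k *P B (n ∸ k)) (suc n) ~ conv n A B
  go A zero    = +-identityʳ (A 0 *P B 0)
  go A (suc n) = +-congˡ {A 0 *P B (suc n)} (go (A ∘ suc) n)

theorem4p9 : (α : List ℕ) → IsPartition α →
    (denSeries α 0 ≈P 1P) × (numSeries α ≈S (denSeries α *S expSeries))
-- At `k = 0` the right-hand side of `den` evaluates to `1P`: the denominator has constant term 1,
-- so the quotient of series makes sense.
theorem4p9 α P = ~⇒≈P (den 0) , λ n → ~⇒≈P (main n)
  where
  s : LPoly
  s = horizontal 1 +P vertical 1
  a : ℕ → LPoly
  a k = (κ ^ k) *P iterate d² k 𝟙 α
  den : ∀ k → denSeries α k ~ φ k *P a k
  den k = *-congˡ {φ k} (begin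
    Fneg α k *P (κ ^P k)
        ≈⟨ *-cong (trans (Fneg≈ α P k) (reflexive (≡.cong (λ f → f α) (iterate-2* d₁ k 𝟙))))
        (reflexive (≡.sym (^≡^P κ k))) ⟩
    iterate d² k 𝟙 α *P (κ ^ k)          ≈⟨ *-comm (iterate d² k 𝟙 α) (κ ^ k) ⟩
    a k                                    ∎)
  ex : ∀ k → expSeries k ~ φ k *P (s ^ k)
  -- `s` evaluates to `yP +P xP`, with the summands in the opposite order.
  ex k = *-congˡ {φ k} (trans (reflexive (≡.sym (^≡^P (xP +P yP) k))) (^-congˡ k (+-comm xP yP)))
  main : ∀ n → numSeries α n ~ (denSeries α *S expSeries) n
  main n = begin
    φ n *P Fpos α n
        ≈⟨ *-congˡ {φ n} (trans (Fpos≈ α P n) (reflexive (≡.cong (λ f → f α) (iterate-2* U₁ n 𝟙)))) ⟩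
    φ n *P iterate U² n 𝟙 α                            ≈⟨ *-congˡ {φ n} (E-binomial n α (IsPartition⇒Dec P)) ⟩
    φ n *P binomial s n a                                ≈⟨ exponential s n a ⟩
    conv n (λ k → φ k *P a k) (λ k → φ k *P (s ^ k))     ≈⟨ conv-cong n den ex ⟨
    conv n (denSeries α) expSeries                       ≈⟨ *S≈conv (denSeries α) expSeries n ⟨
    (denSeries α *S expSeries) n                         ∎
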